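{- Let $(X,d)$ be a finite metric space with $n = |X|$ points and doubling dimension $\dim$, let $0<\varepsilon<1$ be a constant, and let $k$ be an integer with $1 \le k \le n-2$. Then there exists a $(k, 1+\varepsilon)$-vertex-fault-tolerant spanner $H$ of $X$ such that: (i) the maximum degree of $H$ is $\varepsilon^{ -O(\dim)}\cdot k^2$; (ii) the hop-diameter of $H$ is $O(\log n)$; (iii) the lightness of $H$ is $\varepsilon^{ -O(\dim)}\cdot k^3 \cdot \log n$.
   Context: A finite metric space $(X,d)$ is viewed as the complete graph on $X$ in which edge $\{x,y\}$ has weight $d(x,y)$. For a weighted subgraph $H$ and $x,y$ in its vertex set, $d_H(x,y)$ is the shortest-path distance in $H$. A subgraph $H=(X,E')$ is a $t$-spanner of $X$ if $d_H(x,y)\le t\cdot d(x,y)$ for all $x,y\in X$; a path in $H$ between $x$ and $y$ of length at most $t\cdot d(x,y)$ is a $t$-spanner path. For $1\le k\le n-2$, $H$ is a $(k,t)$-vertex-fault-tolerant spanner ($(k,t)$-VFTS) if for every $S\subseteq X$ with $|S|\le k$, the graph $H\setminus S$ (remove the vertices of $S$ and their incident edges) is a $t$-spanner of $X\setminus S$. The hop-diameter of a $t$-spanner $H$ is the smallest $D$ such that every pair $x,y\in X$ is connected in $H$ by a $t$-spanner path with at most $D$ edges. The lightness of $H$ is the total weight of its edges divided by the weight of a minimum spanning tree of $(X,d)$. The doubling dimension $\dim$ of $(X,d)$ is the smallest $\rho$ such that every ball in $X$ can be covered by $2^\rho$ balls of half the radius. In the bounds, the implicit constants in the $O(\cdot)$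 notation do not depend on $n$, $k$, or the metric space. -}

module Defs where

open import Algebra.Bundles using (CommutativeRing; Semiring)
open import Algebra.Structures using (IsCommutativeRing)
import Algebra.Definitions.RawSemiring as RawSemiringDefs
open import Data.Bool using (Bool; true; false; _∧_; if_then_else_)
open import Data.Fin using (Fin)
import Data.Fin.Properties as Fin
open import Data.Fin.Subset using (Subset; _∈_; ⊤; ∁; ∣_∣)
open import Data.List using (List; []; _∷_)
open import Data.List.Relation.Unary.Unique.Propositional using (Unique)
open import Data.Nat as ℕ using (ℕ; zero; suc)
open import Data.Product using (∃; ∃-syntax; Σ-syntax; _×_; _,_)
import Data.Vec as Vec
import Data.Vec.Functional as Vector
open import Level using (0ℓ)
open import Relation.Binary.PropositionalEquality using (_≡_; _≢_)
open import Relation.Binary.Structures using (IsDecTotalOrder)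
open import Relation.Nullary using (¬_; yes; no; ⌊_⌋)

-- The real numbers, axiomatised as a complete ordered field: classically ℝ is
-- the only model, up to isomorphism. The order is decidable because the
-- mathematics is classical. `_⁻¹` and `⨆` are total functions, with
-- unspecified values outside the domain of their laws. `archimedean` follows
-- classically from completeness; it is listed because a witness cannot be
-- extracted constructively.
record CompleteOrderedField : Set₁ where
  infixl 6 _+_
  infixl 7 _*_
  infix  8 -_
  infix  9 _⁻¹
  infix  4 _≤_ _<_

  field
    Carrier : Set
    _+_ _*_ : Carrier → Carrier → Carrier
    -_ _⁻¹  : Carrier → Carrier
    0# 1#   : Carrier
    _≤_     : Carrier → Carrier → Set
    isCommutativeRing : IsCommutativeRing _≡_ _+_ _*_ -_ 0# 1#
    0≢1               : 0# ≢ 1#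
    ⁻¹-inverse        : ∀ x → x ≢ 0# → x * x ⁻¹ ≡ 1#
    isDecTotalOrder   : IsDecTotalOrder _≡_ _≤_
    +-monoʳ-≤         : ∀ z {x y} → x ≤ y → z + x ≤ z + y
    *-nonNegative     : ∀ {x y} → 0# ≤ x → 0# ≤ y → 0# ≤ x * y

  commutativeRing : CommutativeRing 0ℓ 0ℓ
  commutativeRing = record { isCommutativeRing = isCommutativeRing }

  open RawSemiringDefs (Semiring.rawSemiring (CommutativeRing.semiring commutativeRing)) public
    using (sum) renaming (_×_ to _·_; _^_ to _^ⁿ_)

  open IsDecTotalOrder isDecTotalOrder public using (_≤?_)

  _<_ : Carrier → Carrier → Set
  x < y = x ≤ y × x ≢ y

  fromℕ : ℕ → Carrier
  fromℕ m = m · 1#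

  2# : Carrier
  2# = 1# + 1#

  UpperBound : (Carrier → Set) → Carrier → Set
  UpperBound P u = ∀ x → P x → x ≤ u

  field
    archimedean : ∀ x → ∃[ m ] x ≤ fromℕ m
    ⨆           : (Carrier → Set) → Carrier
    ⨆-upper     : ∀ P → ∃ P → ∃ (UpperBound P) → UpperBound P (⨆ P)
    ⨆-least     : ∀ P → ∃ P → ∀ u → UpperBound P u → ⨆ P ≤ u

  -- For b ≥ 1, the number b ^ s is the supremum of the rational powers
  -- b ^ ((p - r) / q) with (p - r) / q ≤ s, where q = suc q′.
  BelowPower : Carrier → Carrier → Carrier → Set
  BelowPower b s y =
    0# ≤ y ×
    (∃[ p ] ∃[ r ] ∃[ q′ ]
      (fromℕ p ≤ fromℕ (suc q′) * s + fromℕ r) ×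
      ((y ^ⁿ suc q′) * (b ^ⁿ r) ≤ b ^ⁿ p))

  -- Real power of a base b > 0.
  infixr 8 _^_
  _^_ : Carrier → Carrier → Carrier
  b ^ s with 1# ≤? b
  ... | yes _ = ⨆ (BelowPower b s)
  ... | no  _ = ⨆ (BelowPower (b ⁻¹) (- s))

  -- Meaningful for x > 0.
  log₂ : Carrier → Carrier
  log₂ x = ⨆ (λ s → 2# ^ s ≤ x)

module Spanners (𝓡 : CompleteOrderedField) where

  open CompleteOrderedField 𝓡 renaming (Carrier to ℝ)

  record Metric (n : ℕ) : Set where
    field
      d         : Fin n → Fin n → ℝ
      d-nonneg  : ∀ x y → 0# ≤ d x y
      d-refl    : ∀ x → d x x ≡ 0#
      d-sep     : ∀ x y → d x y ≡ 0# → x ≡ y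
      d-sym     : ∀ x y → d x y ≡ d y x
      d-triangle : ∀ x y z → d x z ≤ d x y + d y z

  -- A subgraph (X , E′) of the complete graph on X = Fin n.
  record Graph (n : ℕ) : Set where
    field
      adj       : Fin n → Fin n → Bool
      adj-sym   : ∀ x y → adj x y ≡ adj y x
      adj-irrefl : ∀ x → adj x x ≡ false

    Adj : Fin n → Fin n → Set
    Adj x y = adj x y ≡ true

    degree : Fin n → ℕ
    degree x = ∣ Vec.tabulate (adj x) ∣

    maxDegree : ℕ
    maxDegree = Vector.foldr ℕ._⊔_ 0 degree

  -- Paths in the subgraph of H induced on U; vertices may repeat, which
  -- affects neither shortest-path distances nor hop-diameters.
  data Path {n : ℕ} (H : Graph n) (U : Subset n) : Fin n → Fin n → Set where
    stop : ∀ {x} → x ∈ U → Path H U x x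
    step : ∀ {x y z} → x ∈ U → Graph.Adj H x y → Path H U y z → Path H U x z

  module _ {n : ℕ} {H : Graph n} {U : Subset n} where

    hops : ∀ {x y} → Path H U x y → ℕ
    hops (stop _)     = 0
    hops (step _ _ p) = suc (hops p)

    vertices : ∀ {x y} → Path H U x y → List (Fin n)
    vertices (stop {x} _)     = x ∷ []
    vertices (step {x} _ _ p) = x ∷ vertices p

  module _ {n : ℕ} (T : Graph n) where

    Connected : Set
    Connected = ∀ x y → Path T ⊤ x y

    -- A cycle is an edge x y closed up by a path from y to x that has at least
    -- two edges and no repeated vertex.
    Cycle : Set
    Cycle = ∃[ x ] ∃[ y ] Graph.Adj T x y ×
      (Σ[ p ∈ Path T ⊤ y x ] Unique (vertices p) × 2 ℕ.≤ hops p)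

    IsSpanningTree : Set
    IsSpanningTree = Connected × ¬ Cycle

  module _ {n : ℕ} (M : Metric n) where

    open Metric M

    length : ∀ {H : Graph n} {U x y} → Path H U x y → ℝ
    length (stop _)               = 0#
    length (step {x} {y} _ _ p) = d x y + length p

    -- δ is the shortest-path distance between x and y in H[U]; there is no
    -- such δ when x and y are disconnected.
    IsGraphDistance : Graph n → Subset n → Fin n → Fin n → ℝ → Set
    IsGraphDistance H U x y δ =
      (Σ[ p ∈ Path H U x y ] length p ≡ δ) ×
      (∀ (p : Path H U x y) → δ ≤ length p)

    -- H[U] is a t-spanner of the subspace U.
    IsSpanner : ℝ → Graph n → Subset n → Set
    IsSpanner t H U = ∀ x y → x ∈ U → y ∈ U →
      ∃[ δ ] IsGraphDistance H U x y δ × δ ≤ t * d x y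

    -- The induced subgraph on ∁ S is H ∖ S.
    IsVFTS : ℕ → ℝ → Graph n → Set
    IsVFTS k t H = ∀ (S : Subset n) → ∣ S ∣ ℕ.≤ k → IsSpanner t H (∁ S)

    HopBound : ℝ → Graph n → ℕ → Set
    HopBound t H D = ∀ x y →
      Σ[ p ∈ Path H ⊤ x y ] length p ≤ t * d x y × hops p ℕ.≤ D

    IsHopDiameter : ℝ → Graph n → ℕ → Set
    IsHopDiameter t H D = HopBound t H D × (∀ D′ → HopBound t H D′ → D ℕ.≤ D′)

    weight : Graph n → ℝ
    weight H = sum λ x → sum λ y →
      if ⌊ x Fin.<? y ⌋ ∧ Graph.adj H x y then d x y else 0#

    IsMST : Graph n → Set
    IsMST T = IsSpanningTree T × (∀ T′ → IsSpanningTree T′ → weight T ≤ weight T′)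

    IsLightness : Graph n → ℝ → Set
    IsLightness H ℓ = ∃[ T ] IsMST T × ℓ ≡ weight H * weight T ⁻¹

    -- Closed balls. On a finite space open balls give the same covering
    -- condition, after a small change of the radius.
    _∈Ball[_,_] : Fin n → Fin n → ℝ → Set
    y ∈Ball[ x , r ] = d x y ≤ r

    -- Every ball is covered by at most 2 ^ ρ balls of half the radius.
    IsDoubling : ℝ → Set
    IsDoubling ρ = ∀ x r → 0# < r →
      ∃[ m ] fromℕ m ≤ 2# ^ ρ ×
      (Σ[ c ∈ (Fin m → Fin n) ]
        (∀ y → y ∈Ball[ x , r ] → ∃[ j ] y ∈Ball[ c j , r * 2# ⁻¹ ]))

    IsDoublingDimension : ℝ → Set
    IsDoublingDimension dim = IsDoubling dim × (∀ ρ → IsDoubling ρ → dim ≤ ρ)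

{-# OPTIONS --safe #-}

-- Fix nested nets N₀ ⊇ N₁ ⊇ … whose scales grow by a factor B = Θ(1/ε), and let
-- every point of Nᵢ have a parent in Nᵢ₊₁, so that each point but one dies at some
-- level. Two points of Nᵢ within B² times the scale of level i are said to cross.
--
-- Fault tolerance: represent a cluster of level i by the k + 1 of its points that
-- died last (or by all of them), and join the representatives of crossing clusters
-- completely. Whatever k points fail, a pair at distance about B times the scale of
-- level i still sees an edge between points near its ends, so by induction on the
-- level the stretch is 1 + ε. Of two crossing points one dies within three levels,
-- and either way each of the two clusters has then received a new death; hence a
-- vertex is a representative on only O(k) levels with crossings while it is alive,
-- and on O(k) more once it is dead.
--
-- Hops: decompose the cluster tree into heavy paths and give each branching node a
-- private vertex, the centre of a child that dies there. On each heavy path put a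
-- weight-balanced search tree, in which the hop counts telescope to O(log n), and a
-- binary heap by order of arrival, which reaches every node of the path without
-- leaving its cluster.
--
-- Weight: all edges are charged to deaths, a death at level i paying O(Bⁱ). Doubling
-- a connected graph gives a tour, which shows that the deaths of one level cost at
-- most twice the weight of a spanning tree; only O(log n) levels matter, because the
-- total cost of the deaths below scale diameter / n is at most the diameter.

module Submission where

open import Defs
open import Algebra.Bundles using (CommutativeRing)
import Algebra.Solver.Ring.NaturalCoefficients.Default as SemiringSolver
import Algebra.Properties.Semiring.Mult as Mult
import Algebra.Properties.Semiring.Exp as Exp
import Algebra.Properties.CommutativeSemiring.Exp as CommExp
import Algebra.Properties.Ring as RingProperties
open import Data.Nat as ℕ using (ℕ; zero; suc; z≤n; s≤s)
import Data.Nat.Properties as ℕ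
open import Data.Product using (∃; ∃-syntax; Σ-syntax; _×_; _,_; proj₁; proj₂)
open import Data.Sum using (_⊎_; inj₁; inj₂)
open import Data.Empty using (⊥; ⊥-elim)
open import Relation.Nullary using (¬_; Dec; yes; no; ⌊_⌋)
open import Relation.Binary.Structures using (IsDecTotalOrder)
open import Relation.Binary.PropositionalEquality
open import Function using (_∘_; id)
open import Data.Bool using (Bool; true; false; _∧_; if_then_else_)
import Data.Bool.Properties as Bool
open import Data.Fin as Fin using (Fin; zero; suc)
import Data.Fin.Properties as Fin
open import Data.Fin.Subset using (Subset; ∣_∣; ⊤; ∁) renaming (_∈_ to _∈ˢ_; _∉_ to _∉ˢ_; ⊥ to ∅)
import Data.Fin.Subset.Properties as Subset
import Data.Vec as Vec
import Data.Vec.Functional as Vector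
open import Data.List as List using (List; []; _∷_; _++_; map; concatMap; allFin; filter; tabulate; cartesianProduct)
open import Data.List.Properties using (map-tabulate; length-tabulate; length-++)
open import Data.List.Membership.Propositional using (_∈_; _∉_; find; lose)
open import Data.List.Membership.Propositional.Properties using (∈-++⁻; ∈-++⁺ˡ; ∈-++⁺ʳ; ∈-allFin; ∈-map⁺; ∈-map⁻; ∈-filter⁺; ∈-filter⁻; ∈-cartesianProduct⁺)
import Data.List.Membership.DecPropositional as DecMembership
open import Data.List.Relation.Unary.Any using (here; there; any?)
open import Data.List.Relation.Unary.All using (All; []; _∷_)
import Data.List.Relation.Unary.All as All
open import Data.List.Relation.Unary.AllPairs using ([]; _∷_)
open import Data.List.Relation.Unary.Unique.Propositional using (Unique)
import Data.List.Relation.Unary.Unique.Propositional.Properties as Unique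
open import Data.List.Relation.Binary.Permutation.Propositional using (_↭_; ↭-refl; ↭-sym; ↭-trans; prep; swap)
import Data.List.Relation.Binary.Permutation.Propositional as Perm
open import Data.Product.Properties using (≡-dec)
open import Relation.Nullary.Decidable using (_×-dec_; _⊎-dec_; ¬?)
open import Data.List.Relation.Binary.Permutation.Propositional.Properties using (∈-resp-↭)
open import Data.List.Relation.Binary.BagAndSetEquality using (∼bag⇒↭)
open import Data.List.Membership.Propositional.Properties.WithK using (unique∧set⇒bag)
open import Data.List.Relation.Binary.Sublist.Propositional using (_⊆_; []; _∷_; _∷ʳ_)
open import Data.List.Relation.Binary.Sublist.Propositional.Properties using (filter-⊆)
open import Function.Bundles using (mk⇔)
open import Data.Nat.Tactic.RingSolver using (solve-∀)

-- The number of levels depends on the spread of the metric and not on `n`, so degree and weight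
-- cannot be counted level by level; they are counted by deaths, of which there are fewer than `n`.
-- The length of a hop link is therefore split between its two ends, and the charge inequalities
-- hold for an arbitrary `φ`: one instance gives the weight, another the degree. A heavy path
-- carries two structures because neither suffices alone. The balanced tree needs the finished path,
-- yet every cluster through which the path runs must already have short routes at its own scale;
-- the heaps of these clusters are nested, so all of them together are paid for once. Distances
-- enter the combinatorial part only as integer multiples of a unit, which makes it a matter of
-- natural numbers. Powers of `B` and absolute constants end up in a power of `ε ⁻¹` whose exponent
-- is a multiple of `dim`. This requires `dim` to be bounded below, and two closest points do force
-- `dim` to be at least one half.

module Combinatorics where

  open import Data.Nat using (_+_; _*_; _∸_; _^_; _≤_; _<_; _⊓_; ⌊_/2⌋; _≤?_; _<?_; >-nonZero)
  open import Data.Nat.Properties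
  open import Data.List using (length; take; downFrom)
  open import Data.List.Properties using (filter-++; length-map; length-take; take-all; ++-assoc; map-∘)
  open import Data.List.Membership.Propositional.Properties using (∈-downFrom⁺; ∈-downFrom⁻; ∈-cartesianProduct⁻)
  open import Data.List.Relation.Unary.Any using (Any)
  open import Data.List.Relation.Binary.Permutation.Propositional using (↭⇒↭ₛ)
  open import Relation.Unary using (Pred; Decidable)
  open import Level using (0ℓ)
  open import Relation.Binary.Definitions using (tri<; tri≈; tri>)
  open import Data.Fin.Subset using (_-_)
  open import Data.List.Relation.Binary.Permutation.Propositional.Properties using (↭-length; map⁺)
  import Data.List.Relation.Binary.Permutation.Setoid.Properties as PermS

  -- Sums over lists, indicators and counting.

  ≤-by : ∀ {a b} c → a + c ≡ b → a ≤ b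
  ≤-by c refl = m≤m+n _ c

  ∑ : {A : Set} → (A → ℕ) → List A → ℕ
  ∑ f []       = 0
  ∑ f (x ∷ xs) = f x + ∑ f xs

  module _ {A : Set} where

    ∑-++ : (f : A → ℕ) → ∀ xs ys → ∑ f (xs ++ ys) ≡ ∑ f xs + ∑ f ys
    ∑-++ f []       ys = refl
    ∑-++ f (x ∷ xs) ys = trans (cong (f x +_) (∑-++ f xs ys)) (sym (+-assoc (f x) _ _))

    ∑-mono : {f g : A → ℕ} → ∀ xs → (∀ {x} → x ∈ xs → f x ≤ g x) → ∑ f xs ≤ ∑ g xs
    ∑-mono []       h = z≤n
    ∑-mono (x ∷ xs) h = +-mono-≤ (h (here refl)) (∑-mono xs (h ∘ there))

    ∑-cong : {f g : A → ℕ} → ∀ xs → (∀ x → f x ≡ g x) → ∑ f xs ≡ ∑ g xs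
    ∑-cong []       h = refl
    ∑-cong (x ∷ xs) h = cong₂ _+_ (h x) (∑-cong xs h)

    +-interchange : ∀ a b c d → (a + b) + (c + d) ≡ (a + c) + (b + d)
    +-interchange = solve-∀

    ∑-+ : (f g : A → ℕ) → ∀ xs → ∑ (λ x → f x + g x) xs ≡ ∑ f xs + ∑ g xs
    ∑-+ f g []       = refl
    ∑-+ f g (x ∷ xs) = trans (cong (f x + g x +_) (∑-+ f g xs)) (+-interchange (f x) (g x) _ _)

    ∑-* : ∀ c (f : A → ℕ) xs → ∑ (λ x → c * f x) xs ≡ c * ∑ f xs
    ∑-* c f []       = sym (*-zeroʳ c)
    ∑-* c f (x ∷ xs) = trans (cong (c * f x +_) (∑-* c f xs)) (sym (*-distribˡ-+ c (f x) _))

    ∑-const : ∀ c (xs : List A) → ∑ (λ _ → c) xs ≡ length xs * c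
    ∑-const c []       = refl
    ∑-const c (x ∷ xs) = cong (c +_) (∑-const c xs)

    ∑-≤-const : ∀ c {f : A → ℕ} xs → (∀ {x} → x ∈ xs → f x ≤ c) → ∑ f xs ≤ length xs * c
    ∑-≤-const c xs h = ≤-trans (∑-mono xs h) (≤-reflexive (∑-const c xs))

    ∑-∈ : (f : A → ℕ) → ∀ {x xs} → x ∈ xs → f x ≤ ∑ f xs
    ∑-∈ f {xs = y ∷ xs} (here refl) = m≤m+n (f y) _
    ∑-∈ f {xs = y ∷ xs} (there p)   = ≤-trans (∑-∈ f p) (m≤n+m _ (f y))

  ∑-map : {A B : Set} (f : B → ℕ) (g : A → B) → ∀ xs → ∑ f (map g xs) ≡ ∑ (f ∘ g) xs
  ∑-map f g []       = refl
  ∑-map f g (x ∷ xs) = cong (f (g x) +_) (∑-map f g xs)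

  ∑-concatMap : {A B : Set} (f : B → ℕ) (g : A → List B) → ∀ xs →
                ∑ f (concatMap g xs) ≡ ∑ (λ x → ∑ f (g x)) xs
  ∑-concatMap f g []       = refl
  ∑-concatMap f g (x ∷ xs) = trans (∑-++ f (g x) _) (cong (∑ f (g x) +_) (∑-concatMap f g xs))

  ∑-swap : {A B : Set} (f : A → B → ℕ) → ∀ xs ys →
           ∑ (λ x → ∑ (f x) ys) xs ≡ ∑ (λ y → ∑ (λ x → f x y) xs) ys
  ∑-swap f [] ys = sym (trans (∑-const 0 ys) (*-zeroʳ (length ys)))
  ∑-swap f (x ∷ xs) ys = trans (cong (∑ (f x) ys +_) (∑-swap f xs ys)) (sym (∑-+ (f x) _ ys))

  length-concatMap : {A B : Set} (g : A → List B) → ∀ xs →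
                     length (concatMap g xs) ≡ ∑ (length ∘ g) xs
  length-concatMap g []       = refl
  length-concatMap g (x ∷ xs) = trans (length-++ (g x)) (cong (length (g x) +_) (length-concatMap g xs))

  ∈-concatMap : {A B : Set} (g : A → List B) → ∀ {x y xs} → x ∈ xs → y ∈ g x → y ∈ concatMap g xs
  ∈-concatMap g (here refl) q = ∈-++⁺ˡ q
  ∈-concatMap g {xs = z ∷ xs} (there p) q = ∈-++⁺ʳ (g z) (∈-concatMap g p q)

  ∈-concatMap⁻ : {A B : Set} (g : A → List B) → ∀ {y} xs → y ∈ concatMap g xs → ∃[ x ] x ∈ xs × y ∈ g x
  ∈-concatMap⁻ g (x ∷ xs) p with ∈-++⁻ (g x) p
  ... | inj₁ q = x , here refl , q
  ... | inj₂ q with ∈-concatMap⁻ g xs q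
  ... | z , z∈ , r = z , there z∈ , r

  ind : {P : Set} → Dec P → ℕ → ℕ
  ind (yes _) m = m
  ind (no _)  m = 0

  ind-yes : {P : Set} (p? : Dec P) → P → ∀ m → ind p? m ≡ m
  ind-yes (yes _) p m = refl
  ind-yes (no ¬p) p m = ⊥-elim (¬p p)

  ind-no : {P : Set} (p? : Dec P) → ¬ P → ∀ m → ind p? m ≡ 0
  ind-no (yes p) ¬p m = ⊥-elim (¬p p)
  ind-no (no _)  ¬p m = refl

  ind-≤ : {P : Set} (p? : Dec P) → ∀ m → ind p? m ≤ m
  ind-≤ (yes _) m = ≤-refl
  ind-≤ (no _)  m = z≤n

  ind-mono : {P : Set} (p? : Dec P) → ∀ {m m′} → m ≤ m′ → ind p? m ≤ ind p? m′
  ind-mono (yes _) h = h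
  ind-mono (no _)  h = z≤n

  ind-+ : {P : Set} (p? : Dec P) → ∀ m m′ → ind p? (m + m′) ≡ ind p? m + ind p? m′
  ind-+ (yes _) m m′ = refl
  ind-+ (no _)  m m′ = refl

  module _ {A : Set} where

    length-filter-mono : {P Q : Pred A 0ℓ} (P? : Decidable P) (Q? : Decidable Q) → ∀ xs →
      (∀ {x} → P x → Q x) → length (filter P? xs) ≤ length (filter Q? xs)
    length-filter-mono P? Q? [] h = z≤n
    length-filter-mono P? Q? (x ∷ xs) h with P? x | Q? x
    ... | yes p | yes q = s≤s (length-filter-mono P? Q? xs h)
    ... | yes p | no ¬q = ⊥-elim (¬q (h p))
    ... | no ¬p | yes q = m≤n⇒m≤1+n (length-filter-mono P? Q? xs h)
    ... | no ¬p | no ¬q = length-filter-mono P? Q? xs h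

    ∈⇒0<length : ∀ {x : A} {xs} → x ∈ xs → 0 < length xs
    ∈⇒0<length (here _)  = s≤s z≤n
    ∈⇒0<length (there _) = s≤s z≤n

    -- Used to bound the number of recent deaths in a cluster: a vertex that still ranks among the
    -- first `k + 1` has at most `k` entries before it.
    ∈-take-++⁻ : ∀ m (xs ys : List A) {x} → x ∈ take m (xs ++ ys) → x ∉ xs → length xs < m
    ∈-take-++⁻ (suc m) [] ys p x∉ = s≤s z≤n
    ∈-take-++⁻ (suc m) (z ∷ xs) ys (here refl) x∉ = ⊥-elim (x∉ (here refl))
    ∈-take-++⁻ (suc m) (z ∷ xs) ys (there p) x∉ = s≤s (∈-take-++⁻ m xs ys p (x∉ ∘ there))

    ∈-take⁻ : ∀ m (xs : List A) {x} → x ∈ take m xs → x ∈ xs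
    ∈-take⁻ (suc m) (z ∷ xs) (here p)  = here p
    ∈-take⁻ (suc m) (z ∷ xs) (there p) = there (∈-take⁻ m xs p)

  -- A set of levels is small if a capped counter that increases within three
  -- levels of each of its members bounds it.
  module _ {A : Pred ℕ 0ℓ} (A? : Decidable A) (k : ℕ) (g : ℕ → ℕ)
           (g-mono : ∀ i → g i ≤ g (suc i))
           (bounded : ∀ {i} → A i → g i ≤ k) (grows : ∀ {i} → A i → g i < g (3 + i)) where

    private
      c : ℕ → ℕ
      c i = g i ⊓ suc k

      c-mono : ∀ i → c i ≤ c (suc i)
      c-mono i = ⊓-monoˡ-≤ (suc k) (g-mono i)

      -- At a member of `A` the cap `suc k` is not yet reached, so capping does not destroy the
      -- growth.
      c-grows : ∀ {i} → A i → suc (c i) ≤ c (3 + i)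
      c-grows {i} a = ⊓-glb (≤-trans (s≤s (m⊓n≤m (g i) _)) (grows a)) (s≤s (≤-trans (m⊓n≤m (g i) _) (bounded a)))

      -- The sum of three consecutive values is a potential: from `m` to `suc m` it changes by the
      -- difference of `c (3 + m)` and `c m`, which is at least one at a member of `A`.
      count : ∀ m → length (filter A? (downFrom m)) ≤ c m + (c (1 + m) + c (2 + m))
      count zero = z≤n
      count (suc m) with A? m
      ... | no _ = ≤-trans (count m) (+-mono-≤ (c-mono m) (+-mono-≤ (c-mono (1 + m)) (c-mono (2 + m))))
      ... | yes a = ≤-trans (s≤s (count m)) (≤-trans (≤-reflexive (rot (c m) (c (1 + m)) (c (2 + m))))
                      (+-monoʳ-≤ (c (1 + m)) (+-monoʳ-≤ (c (2 + m)) (c-grows a))))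
        where rot : ∀ x y z → suc (x + (y + z)) ≡ y + (z + suc x)
              rot = solve-∀

    levels : ℕ → List ℕ
    levels m = filter A? (downFrom m)

    ∈-levels : ∀ {i m} → i < m → A i → i ∈ levels m
    ∈-levels {i} {m} i<m a = ∈-filter⁺ A? (∈-downFrom⁺ i<m) a

    levels-bound : ∀ m → length (levels m) ≤ 3 * suc k
    levels-bound m = ≤-trans (count m)
      (≤-trans (+-mono-≤ (m⊓n≤n (g m) _) (+-mono-≤ (m⊓n≤n (g (1 + m)) _) (m⊓n≤n (g (2 + m)) _)))
               (≤-reflexive (cong (λ z → suc k + (suc k + z)) (sym (+-identityʳ (suc k))))))

  least : {P : Pred ℕ 0ℓ} → Decidable P → ∀ m → P m → ∃[ l ] P l × (∀ j → P j → l ≤ j)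
  least P? m p with P? 0
  least P? m p | yes p0 = 0 , p0 , λ _ _ → z≤n
  least P? zero p | no ¬p0 = ⊥-elim (¬p0 p)
  least {P} P? (suc m) p | no ¬p0 with least (P? ∘ suc) m p
  ... | l , pl , min = suc l , pl , λ { zero pj → ⊥-elim (¬p0 pj) ; (suc j) pj → s≤s (min j pj) }

  pickMax : {A : Set} (f : A → ℕ) → ∀ x xs → ∃[ m ] ∃[ rest ] (x ∷ xs ↭ m ∷ rest) × All (λ y → f y ≤ f m) rest
  pickMax f x [] = x , [] , ↭-refl , []
  pickMax f x (y ∷ ys) with pickMax f y ys
  ... | m , rest , p , a with f x ≤? f m
  ... | yes x≤m = m , x ∷ rest , ↭-trans (prep x p) (swap x m ↭-refl) , x≤m ∷ a
  ... | no  x≰m = x , m ∷ rest , prep x p , m≤x ∷ All.map (λ h → ≤-trans h m≤x) a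
    where m≤x = <⇒≤ (≰⇒> x≰m)

  length-cartesianProduct : {A B : Set} (xs : List A) (ys : List B) →
                            length (cartesianProduct xs ys) ≡ length xs * length ys
  length-cartesianProduct []       ys = refl
  length-cartesianProduct (x ∷ xs) ys =
    trans (length-++ (map (x ,_) ys)) (cong₂ _+_ (length-map (x ,_) ys) (length-cartesianProduct xs ys))

  n<2^n : ∀ m → m < 2 ^ m
  n<2^n zero    = s≤s z≤n
  n<2^n (suc m) = ≤-trans (s≤s (n<2^n m)) (≤-trans (+-monoˡ-≤ (2 ^ m) (m^n>0 2 m)) (+-monoʳ-≤ (2 ^ m) (m≤m+n (2 ^ m) 0)))

  -- A metric seen through integer multiples of a unit: Le x y m means that the
  -- distance of x and y is at most m units.
  record Scale (n : ℕ) : Set₁ where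
    field
      Le       : Fin n → Fin n → ℕ → Set
      Le?      : ∀ x y m → Dec (Le x y m)
      Le-refl  : ∀ x → Le x x 0
      Le-sym   : ∀ {x y m} → Le x y m → Le y x m
      Le-trans : ∀ {x y z a b} → Le x y a → Le y z b → Le x z (a + b)
      Le-mono  : ∀ {x y a b} → a ≤ b → Le x y a → Le x y b
      half B   : ℕ
      B≡       : B ≡ 2 * half
      16≤half  : 16 ≤ half
      -- The bound is `B` and not `0`, so that points within the scale of level 1 coincide; the
      -- induction on levels in `survive` starts there.
      discrete : ∀ {x y} → Le x y B → x ≡ y
      top      : ℕ
      Le-top   : ∀ x y → Le x y (B ^ top)
      Λ        : ℕ
      -- The radius is the one in `Cross`. The centres of the children of a cluster lie in a smaller
      -- ball, so the same `Λ` counts them.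
      packing  : ∀ i p qs → Unique qs → (∀ {q} → q ∈ qs → Le p q (2 * B ^ (2 + i))) →
                 (∀ {q q′} → q ∈ qs → q′ ∈ qs → Le q q′ (B ^ i) → q ≡ q′) → length qs ≤ Λ

  -- Nested nets, ancestors, crossing pairs and deaths.

  module Nets {n : ℕ} (𝓢 : Scale n) where

    open Scale 𝓢 public

    X : Set
    X = Fin n

    points : List X
    points = allFin n

    ∈points : ∀ x → x ∈ points
    ∈points = ∈-allFin

    32≤B : 32 ≤ B
    32≤B = subst (32 ≤_) (sym B≡) (*-monoʳ-≤ 2 16≤half)

    1≤B : 1 ≤ B
    1≤B = ≤-trans (s≤s z≤n) 32≤B

    1≤B^ : ∀ i → 1 ≤ B ^ i
    1≤B^ i = m^n>0 B {{>-nonZero 1≤B}} i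

    *B^-step : ∀ c {c′} i → c ≤ 32 * c′ → c * B ^ i ≤ c′ * B ^ suc i
    *B^-step c {c′} i h = begin
      c * B ^ i          ≤⟨ *-monoˡ-≤ (B ^ i) h ⟩
      32 * c′ * B ^ i    ≤⟨ *-monoˡ-≤ (B ^ i) (*-monoˡ-≤ c′ 32≤B) ⟩
      B * c′ * B ^ i     ≡⟨ rearr B c′ (B ^ i) ⟩
      c′ * (B * B ^ i)   ∎
      where open ≤-Reasoning
            rearr : ∀ b c p → b * c * p ≡ c * (b * p)
            rearr = solve-∀

    B^-mono : ∀ {i j} → i ≤ j → B ^ i ≤ B ^ j
    B^-mono = ^-monoʳ-≤ B {{>-nonZero 1≤B}}

    separate : ℕ → List X → List X
    separate r []       = []
    separate r (x ∷ xs) with any? (λ y → Le? x y r) (separate r xs)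
    ... | yes _ = separate r xs
    ... | no  _ = x ∷ separate r xs

    separate-⊆ : ∀ r xs {x} → x ∈ separate r xs → x ∈ xs
    separate-⊆ r (x ∷ xs) p with any? (λ y → Le? x y r) (separate r xs)
    separate-⊆ r (x ∷ xs) p         | yes _ = there (separate-⊆ r xs p)
    separate-⊆ r (x ∷ xs) (here e)  | no _  = here e
    separate-⊆ r (x ∷ xs) (there p) | no _  = there (separate-⊆ r xs p)

    separate-sep : ∀ r xs {x y} → x ∈ separate r xs → y ∈ separate r xs → Le x y r → x ≡ y
    separate-sep r (z ∷ xs) p q h with any? (λ y → Le? z y r) (separate r xs)
    separate-sep r (z ∷ xs) p q h                     | yes _ = separate-sep r xs p q h
    separate-sep r (z ∷ xs) (here refl) (here refl) h | no _  = refl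
    separate-sep r (z ∷ xs) (here refl) (there q) h   | no ¬a = ⊥-elim (¬a (lose q h))
    separate-sep r (z ∷ xs) (there p) (here refl) h   | no ¬a = ⊥-elim (¬a (lose p (Le-sym h)))
    separate-sep r (z ∷ xs) (there p) (there q) h     | no _  = separate-sep r xs p q h

    separate-cover : ∀ r xs {x} → x ∈ xs → ∃[ y ] y ∈ separate r xs × Le x y r
    separate-cover r (z ∷ xs) p with any? (λ y → Le? z y r) (separate r xs)
    separate-cover r (z ∷ xs) (here refl) | yes a = find a
    separate-cover r (z ∷ xs) (there p)   | yes _ = separate-cover r xs p
    separate-cover r (z ∷ xs) (here refl) | no _  = z , here refl , Le-mono z≤n (Le-refl z)
    separate-cover r (z ∷ xs) (there p)   | no _  with separate-cover r xs p
    ... | y , y∈ , h = y , there y∈ , h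

    net : ℕ → List X
    net zero    = points
    net (suc i) = separate (B ^ suc i) (net i)

    -- Two points of the next net cannot both lie within half of its scale of `w`, so a net point
    -- that close is unique, and it is preferred as the parent. This is what lets a surviving point
    -- absorb the points that cross it; a parent at the full covering radius could be any of
    -- several. The last case is a junk value, never reached from a point of the net.
    π : ℕ → X → X
    π i w with any? (λ p → Le? w p (half * B ^ i)) (net (suc i))
    ... | yes a = proj₁ (find a)
    ... | no  _ with any? (λ p → Le? w p (B ^ suc i)) (net (suc i))
    ...   | yes a = proj₁ (find a)
    ...   | no  _ = w

    net-sep : ∀ i {x y} → x ∈ net i → y ∈ net i → Le x y (B ^ i) → x ≡ y
    net-sep zero    p q h = discrete (Le-mono 1≤B h)
    net-sep (suc i) p q h = separate-sep (B ^ suc i) (net i) p q h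

    B^suc : ∀ i → half * B ^ i + half * B ^ i ≡ B ^ suc i
    B^suc i = trans (lem half (B ^ i)) (cong (_* B ^ i) (sym B≡))
      where lem : ∀ h p → h * p + h * p ≡ (2 * h) * p
            lem = solve-∀

    half≤ : ∀ i → half * B ^ i ≤ B ^ suc i
    half≤ i = ≤-by (half * B ^ i) (B^suc i)

    π-spec : ∀ i {w} → w ∈ net i →
      π i w ∈ net (suc i) × Le w (π i w) (B ^ suc i) ×
      (∀ {p} → p ∈ net (suc i) → Le w p (half * B ^ i) → π i w ≡ p)
    π-spec i {w} w∈ with any? (λ p → Le? w p (half * B ^ i)) (net (suc i))
    ... | yes a with find a
    ...   | q , q∈ , h = q∈ , Le-mono (half≤ i) h , λ p∈ h′ →
            net-sep (suc i) q∈ p∈ (subst (Le _ _) (B^suc i) (Le-trans (Le-sym h) h′))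
    π-spec i {w} w∈ | no ¬a with any? (λ p → Le? w p (B ^ suc i)) (net (suc i))
    ...   | yes a with find a
    ...     | q , q∈ , h = q∈ , h , λ p∈ h′ → ⊥-elim (¬a (lose p∈ h′))
    π-spec i {w} w∈ | no ¬a | no ¬b with separate-cover (B ^ suc i) (net i) w∈
    ...     | y , y∈ , h = ⊥-elim (¬b (lose y∈ h))

    anc : ℕ → X → X
    anc zero    x = x
    anc (suc i) x = π i (anc i x)

    -- Membership in the net of level `i`, phrased through `anc`; the two agree because `π` fixes
    -- the points of the next net.
    Alive : ℕ → X → Set
    Alive i x = anc i x ≡ x

    alive? : ∀ i x → Dec (Alive i x)
    alive? i x = anc i x Fin.≟ x

    anc∈net : ∀ i x → anc i x ∈ net i
    anc∈net zero    x = ∈points x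
    anc∈net (suc i) x = proj₁ (π-spec i (anc∈net i x))

    net⇒alive : ∀ i {x} → x ∈ net i → Alive i x
    net⇒alive zero    p = refl
    net⇒alive (suc i) {x} p =
      trans (cong (π i) (net⇒alive i x∈)) (proj₂ (proj₂ (π-spec i x∈)) p (Le-mono z≤n (Le-refl x)))
      where x∈ = separate-⊆ (B ^ suc i) (net i) p

    alive⇒net : ∀ i {x} → Alive i x → x ∈ net i
    alive⇒net i {x} e = subst (_∈ net i) e (anc∈net i x)

    alive-anc : ∀ i x → Alive i (anc i x)
    alive-anc i x = net⇒alive i (anc∈net i x)

    alive-pred : ∀ i {x} → Alive (suc i) x → Alive i x
    alive-pred i e = net⇒alive i (separate-⊆ (B ^ suc i) (net i) (alive⇒net (suc i) e))

    alive-≤ : ∀ i j {x} → Alive (j + i) x → Alive i x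
    alive-≤ i zero    e = e
    alive-≤ i (suc j) e = alive-≤ i j (alive-pred (j + i) e)

    alive-sep : ∀ i {x y} → Alive i x → Alive i y → Le x y (B ^ i) → x ≡ y
    alive-sep i e e′ = net-sep i (alive⇒net i e) (alive⇒net i e′)

    anc-suc : ∀ i {x y} → anc i x ≡ anc i y → anc (suc i) x ≡ anc (suc i) y
    anc-suc i = cong (π i)

    anc-+ : ∀ j i {x y} → anc i x ≡ anc i y → anc (j + i) x ≡ anc (j + i) y
    anc-+ zero    i e = e
    anc-+ (suc j) i e = anc-suc (j + i) (anc-+ j i e)

    anc-anc : ∀ i x → anc (suc i) (anc i x) ≡ anc (suc i) x
    anc-anc i x = anc-suc i (alive-anc i x)

    -- A geometric sum: all displacement up to level `i` fits into one step at the scale of level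
    -- `suc i`.
    Le-anc : ∀ i x → Le x (anc i x) (2 * B ^ i)
    Le-anc zero    x = Le-mono z≤n (Le-refl x)
    Le-anc (suc i) x = Le-mono (≤-trans (+-monoˡ-≤ (B ^ suc i) (*B^-step 2 {1} i (s≤s (s≤s z≤n))))
                                        (≤-reflexive (lem (B ^ suc i))))
      (Le-trans (Le-anc i x) (proj₁ (proj₂ (π-spec i (anc∈net i x)))))
      where lem : ∀ b → 1 * b + b ≡ 2 * b
            lem = solve-∀

    Le-cluster : ∀ i {x y} → anc i x ≡ anc i y → Le x y (4 * B ^ i)
    Le-cluster i {x} {y} e = subst (Le x y) (lem (B ^ i))
      (Le-trans (subst (λ z → Le x z _) e (Le-anc i x)) (Le-sym (Le-anc i y)))
      where lem : ∀ b → 2 * b + 2 * b ≡ 4 * b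
            lem = solve-∀

    -- The factor 2 leaves room for moving both ends of a pair at distance `B ^ (2 + i)` to their
    -- ancestors of level `i`.
    Cross : ℕ → X → X → Set
    Cross i p q = Alive i p × Alive i q × p ≢ q × Le p q (2 * B ^ (2 + i))

    cross? : ∀ i p q → Dec (Cross i p q)
    cross? i p q = alive? i p ×-dec alive? i q ×-dec ¬? (p Fin.≟ q) ×-dec Le? p q _

    cross-sym : ∀ i {p q} → Cross i p q → Cross i q p
    cross-sym i (a , b , c , d) = b , a , c ∘ sym , Le-sym d

    crossing : ℕ → X → List X
    crossing i p = filter (cross? i p) points

    crossing-bound : ∀ i p → length (crossing i p) ≤ Λ
    crossing-bound i p = packing i p (crossing i p) (Unique.filter⁺ (cross? i p) (Unique.allFin⁺ n))
      (λ q∈ → proj₂ (proj₂ (proj₂ (spec q∈))))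
      (λ q∈ q′∈ → alive-sep i (proj₁ (proj₂ (spec q∈))) (proj₁ (proj₂ (spec q′∈))))
      where spec : ∀ {q} → q ∈ crossing i p → Cross i p q
            spec q∈ = proj₂ (∈-filter⁻ (cross? i p) {xs = points} q∈)

    -- If p survives, then q is close enough to be absorbed by p itself.
    cross-absorb : ∀ i {p q} → Cross i p q →
      ¬ Alive (3 + i) p ⊎ (anc (3 + i) q ≡ p × ¬ Alive (3 + i) q)
    cross-absorb i {p} {q} (ap , aq , p≢q , h) with alive? (3 + i) p
    ... | no ¬a = inj₁ ¬a
    ... | yes a = inj₂ (e , λ a′ → p≢q (trans (sym e) a′))
      where
        le : Le (anc (2 + i) q) p (half * B ^ (2 + i))
        -- Crossing and the displacement of `q` up to level `2 + i` each contribute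
        -- `2 * B ^ (2 + i)`. The sum is below half of the next scale, where the parent is forced.
        le = Le-mono (≤-trans (≤-reflexive (lem (B ^ (2 + i)))) (*-monoˡ-≤ (B ^ (2 + i)) (≤-trans (m≤m+n 4 12) 16≤half)))
               (Le-sym (Le-trans h (Le-anc (2 + i) q)))
          where lem : ∀ b → 2 * b + 2 * b ≡ 4 * b
                lem = solve-∀
        e : anc (3 + i) q ≡ p
        e = proj₂ (proj₂ (π-spec (2 + i) (anc∈net (2 + i) q))) (alive⇒net (3 + i) a) le

    -- A common ancestor would put the pair within `4 * B ^ i`, hence within `B ^ suc i`. Replacing
    -- both ends by their ancestors adds `4 * B ^ i`, which fits into the second copy of
    -- `B ^ (2 + i)`.
    cross-exists : ∀ i {x y} → ¬ Le x y (B ^ suc i) → Le x y (B ^ (2 + i)) → Cross i (anc i x) (anc i y)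
    cross-exists i {x} {y} far near = alive-anc i x , alive-anc i y ,
      (λ e → far (Le-mono (≤-trans (*B^-step 4 {1} i (m≤m+n 4 28)) (≤-reflexive (*-identityˡ _))) (Le-cluster i e))) ,
      Le-mono (≤-trans (+-mono-≤ {x = 2 * B ^ i + B ^ (2 + i)} (+-monoˡ-≤ _ (*B^-step 2 {1} i (m≤m+n 2 30))) (*B^-step 2 {1} i (m≤m+n 2 30))) bound)
        (Le-trans (Le-trans (Le-sym (Le-anc i x)) near) (Le-anc i y))
      where
        open ≤-Reasoning
        lem : ∀ a b → 1 * a + b + 1 * a ≡ 2 * a + b
        lem = solve-∀
        bound : 1 * B ^ suc i + B ^ (2 + i) + 1 * B ^ suc i ≤ 2 * B ^ (2 + i)
        bound = begin
          1 * B ^ suc i + B ^ (2 + i) + 1 * B ^ suc i ≡⟨ lem (B ^ suc i) (B ^ (2 + i)) ⟩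
          2 * B ^ suc i + B ^ (2 + i) ≤⟨ +-monoˡ-≤ _ (*B^-step 2 {1} (suc i) (m≤m+n 2 30)) ⟩
          1 * B ^ (2 + i) + B ^ (2 + i) ≡⟨ +-comm (1 * B ^ (2 + i)) _ ⟩
          2 * B ^ (2 + i) ∎

    Dies : ℕ → X → Set
    Dies i x = Alive i x × ¬ Alive (suc i) x

    dies? : ∀ i x → Dec (Dies i x)
    dies? i x = alive? i x ×-dec ¬? (alive? (suc i) x)

    dying : ℕ → List X
    dying i = filter (dies? i) points

    ∈dying : ∀ i {x} → Dies i x → x ∈ dying i
    ∈dying i {x} = ∈-filter⁺ (dies? i) (∈points x)

    dying-∈ : ∀ i {x} → x ∈ dying i → Dies i x
    dying-∈ i = proj₂ ∘ ∈-filter⁻ (dies? i) {xs = points}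

    dies-within : ∀ i {x} → Alive i x → ¬ Alive (3 + i) x → ∃[ δ ] δ < 3 × Dies (δ + i) x
    dies-within i {x} a ¬a with alive? (1 + i) x
    ... | no ¬a₁ = 0 , s≤s z≤n , a , ¬a₁
    ... | yes a₁ with alive? (2 + i) x
    ...   | no ¬a₂ = 1 , s≤s (s≤s z≤n) , a₁ , ¬a₂
    ...   | yes a₂ = 2 , s≤s (s≤s (s≤s z≤n)) , a₂ , ¬a

    -- From level `top` on, the scale exceeds the diameter, so a point and its parent coincide.
    dies<top : ∀ j {x} → Dies j x → j < top
    dies<top j {x} (a , ¬a) with j <? top
    ... | yes h = h
    ... | no ¬h = ⊥-elim (¬a (sym (alive-sep j a (alive-pred j (alive-anc (suc j) x))
                    (Le-mono (B^-mono (≮⇒≥ ¬h)) (Le-top x (anc (suc j) x))))))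

    -- Latest first: this is the order of preference for representatives.
    deaths : ℕ → ℕ → List X
    deaths s zero    = []
    deaths s (suc i) with s ≤? i
    ... | yes _ = dying i ++ deaths s i
    ... | no  _ = []

    deaths-suc : ∀ {s i} → s ≤ i → deaths s (suc i) ≡ dying i ++ deaths s i
    deaths-suc {s} {i} h with s ≤? i
    ... | yes _ = refl
    ... | no ¬h = ⊥-elim (¬h h)

    deaths-∈ : ∀ s i {x} → x ∈ deaths s i → ∃[ j ] s ≤ j × j < i × Dies j x
    deaths-∈ s (suc i) p with s ≤? i
    deaths-∈ s (suc i) p | yes s≤i with ∈-++⁻ (dying i) p
    ... | inj₁ q = i , s≤i , ≤-refl , dying-∈ i q
    ... | inj₂ q with deaths-∈ s i q
    ...   | j , a , b , c = j , a , m≤n⇒m≤1+n b , c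

    dead-after : ∀ j {i x} → Dies j x → j < i → ¬ Alive i x
    dead-after j {i} {x} (_ , ¬a) j<i a = ¬a (alive-≤ (suc j) (i ∸ suc j) (subst (λ z → Alive z x) (sym (m∸n+n≡m j<i)) a))

    dies-unique : ∀ j j′ {x} → Dies j x → Dies j′ x → j ≡ j′
    dies-unique j j′ a b with <-cmp j j′
    ... | tri≈ _ e _ = e
    ... | tri< h _ _ = ⊥-elim (dead-after j a h (proj₁ b))
    ... | tri> _ _ h = ⊥-elim (dead-after j′ b h (proj₁ a))

    dead⇒deaths : ∀ i {x} → ¬ Alive i x → x ∈ deaths 0 i
    dead⇒deaths zero    ¬a = ⊥-elim (¬a refl)
    dead⇒deaths (suc i) {x} ¬a with alive? i x
    ... | yes a  = ∈-++⁺ˡ (∈dying i (a , ¬a))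
    ... | no ¬a′ = ∈-++⁺ʳ (dying i) (dead⇒deaths i ¬a′)

    deaths-unique : ∀ i → Unique (deaths 0 i)
    deaths-unique zero    = []
    deaths-unique (suc i) = Unique.++⁺ (Unique.filter⁺ (dies? i) (Unique.allFin⁺ n)) (deaths-unique i)
      (λ (p , q) → let (j , _ , j<i , d) = deaths-∈ 0 i q in dead-after j d j<i (proj₁ (dying-∈ i p)))

    deaths-split : ∀ s t → deaths 0 (t + s) ≡ deaths s (t + s) ++ deaths 0 s
    deaths-split s zero = sym (cong (_++ deaths 0 s) (lem s ≤-refl))
      where lem : ∀ i → i ≤ s → deaths s i ≡ []
            lem zero    _ = refl
            lem (suc i) h with s ≤? i
            ... | yes h′ = ⊥-elim (<-irrefl refl (≤-trans h h′))
            ... | no _   = refl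
    deaths-split s (suc t) = trans (cong (dying (t + s) ++_) (deaths-split s t))
      (trans (sym (++-assoc (dying (t + s)) _ _)) (cong (_++ deaths 0 s) (sym (deaths-suc (m≤n+m s t)))))

    Edge : Set
    Edge = X × X × ℕ

    len : Edge → ℕ
    len (_ , _ , m) = m

    Linked : List Edge → X → X → Set
    Linked E x y = ∃[ m ] ((x , y , m) ∈ E ⊎ (y , x , m) ∈ E)

    -- The value of all deaths below a level, in units. Edge lengths are compared with it here, and
    -- it is compared with the spanning tree in `Lightness`.
    ΦUpTo : ℕ → ℕ
    ΦUpTo m = ∑ (λ j → length (dying j) * B ^ j) (downFrom m)

    Φ : ℕ
    Φ = ΦUpTo top

  nonempty : {A : Set} {xs : List A} → 0 < length xs → ∃[ x ] x ∈ xs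
  nonempty {xs = x ∷ _} _ = x , here refl

  unique-⊆ : ∀ {n} (S : Subset n) (xs : List (Fin n)) → Unique xs → (∀ {x} → x ∈ xs → x ∈ˢ S) → length xs ≤ ∣ S ∣
  unique-⊆ S []       u        h = z≤n
  unique-⊆ S (x ∷ xs) u@(_ ∷ u′) h =
    ≤-trans (s≤s (unique-⊆ (S - x) xs u′ λ {y} y∈ → Subset.x∈p∧x≢y⇒x∈p-y (h (there y∈))
              (λ { refl → Unique.Unique[x∷xs]⇒x∉xs u y∈ })))
            (Subset.x∈p⇒∣p-x∣<∣p∣ (h (here refl)))

  -- Representatives and the fault-tolerant edges.

  module FaultTolerance {n : ℕ} (𝓢 : Scale n) (k : ℕ) where

    open Nets 𝓢
    open DecMembership (Fin._≟_ {n}) using (_∈?_)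

    inCluster? : ∀ i p v → Dec (anc i v ≡ p)
    inCluster? i p v = anc i v Fin.≟ p

    -- The centre `p` comes last because it is the only point of the cluster that is still alive at
    -- level `i`. Every point of the cluster thus occurs exactly once.
    ranked : ℕ → X → List X
    ranked i p = filter (inCluster? i p) (deaths 0 i) ++ p ∷ []

    -- A vertex stays among the representatives only until k + 1 further deaths.
    rep : ℕ → X → List X
    rep i p = take (suc k) (ranked i p)

    length-rep : ∀ i p → length (rep i p) ≤ suc k
    length-rep i p = ≤-trans (≤-reflexive (length-take (suc k) (ranked i p))) (m⊓n≤m (suc k) _)

    rep-anc : ∀ i {p v} → Alive i p → v ∈ rep i p → anc i v ≡ p
    rep-anc i {p} ap v∈ with ∈-++⁻ (filter (inCluster? i p) (deaths 0 i)) (∈-take⁻ (suc k) (ranked i p) v∈)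
    ... | inj₁ q = proj₂ (∈-filter⁻ (inCluster? i p) {xs = deaths 0 i} q)
    ... | inj₂ (here refl) = ap

    ∈ranked : ∀ i x → x ∈ ranked i (anc i x)
    ∈ranked i x with alive? i x
    ... | yes a = ∈-++⁺ʳ (filter (inCluster? i _) (deaths 0 i)) (here (sym a))
    ... | no ¬a = ∈-++⁺ˡ (∈-filter⁺ (inCluster? i _) (dead⇒deaths i ¬a) refl)

    ranked-unique : ∀ i {p} → Alive i p → Unique (ranked i p)
    ranked-unique i {p} ap = Unique.++⁺ (Unique.filter⁺ (inCluster? i p) (deaths-unique i)) ([] ∷ [])
      λ { (q , here refl) → let (j , _ , j<i , d) = deaths-∈ 0 i (proj₁ (∈-filter⁻ (inCluster? i p) {xs = deaths 0 i} q))
                             in dead-after j d j<i ap }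

    -- A short list contains the whole cluster and in particular `x`; a long one contributes `k + 1`
    -- distinct vertices, too many for `S`.
    rep-survives : ∀ i x (S : Subset n) → ∣ S ∣ ≤ k → x ∉ˢ S →
      ∃[ v ] v ∈ rep i (anc i x) × v ∉ˢ S
    rep-survives i x S S≤k x∉S with length (ranked i (anc i x)) ≤? suc k
    ... | yes short = x , subst (x ∈_) (sym (take-all (suc k) (ranked i (anc i x)) short)) (∈ranked i x) , x∉S
    ... | no long with any? (λ v → ¬? (v Subset.∈? S)) (rep i (anc i x))
    ...   | yes a = find a
    ...   | no ¬a = ⊥-elim (<-irrefl refl (≤-trans (≤-reflexive eq) (≤-trans
              (unique-⊆ S (rep i (anc i x)) (Unique.take⁺ (suc k) (ranked-unique i (alive-anc i x))) all) S≤k)))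
      where
        eq : suc k ≡ length (rep i (anc i x))
        eq = sym (trans (length-take (suc k) (ranked i (anc i x))) (m≤n⇒m⊓n≡m (<⇒≤ (≰⇒> long))))
        all : ∀ {v} → v ∈ rep i (anc i x) → v ∈ˢ S
        all {v} v∈ with v Subset.∈? S
        ... | yes p = p
        ... | no ¬p = ⊥-elim (¬a (lose v∈ ¬p))

    bipartite : ℕ → ℕ → X → X → List Edge
    bipartite m i w q = map (λ (x , y) → x , y , m) (cartesianProduct (rep i w) (rep i q))

    block : ℕ → ℕ → X → List Edge
    block m i w = concatMap (bipartite m i w) (crossing i w)

    -- Crossing gives `2 * B ^ (2 + i)`, and passing from the centres to representatives adds
    -- `4 * B ^ i`, which is less than one further `B ^ (2 + i)`.
    reach : ℕ → ℕ
    reach j = 3 * B ^ (2 + j)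

    -- The charging rule read backwards: a crossing of level `i` is charged to a death at level `i`,
    -- `1 + i` or `2 + i`, so a death at level `j` looks at the three levels `j ∸ δ`. Near the
    -- bottom the truncation repeats level 0, which only yields duplicates.
    blocks : ℕ → X → List Edge
    blocks j w = concatMap (λ δ → block (reach j) (j ∸ δ) w) (0 ∷ 1 ∷ 2 ∷ [])

    ftEdges : List Edge
    ftEdges = concatMap (λ j → concatMap (blocks j) (dying j)) (downFrom top)

    record FTEdge (e : Edge) : Set where
      constructor ftEdge
      field
        j i : ℕ
        i≤j : i ≤ j
        j<top : j < top
        w q : X
        crosses : Cross i w q
        x∈ : proj₁ e ∈ rep i w
        y∈ : proj₁ (proj₂ e) ∈ rep i q
        len≡ : len e ≡ reach j

    bipartite-∈ : ∀ {m i w q e} → e ∈ bipartite m i w q → proj₁ e ∈ rep i w × proj₁ (proj₂ e) ∈ rep i q × len e ≡ m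
    bipartite-∈ {m} {i} {w} {q} e∈ with ∈-map⁻ (λ (x , y) → x , y , m) e∈
    ... | xy , xy∈ , refl with ∈-cartesianProduct⁻ (rep i w) (rep i q) xy∈
    ...   | x∈ , y∈ = x∈ , y∈ , refl

    ftEdges-∈ : ∀ {e} → e ∈ ftEdges → FTEdge e
    ftEdges-∈ e∈ with ∈-concatMap⁻ (λ j → concatMap (blocks j) (dying j)) (downFrom top) e∈
    ... | j , j∈ , e∈₁ with ∈-concatMap⁻ (blocks j) (dying j) e∈₁
    ... | w , w∈ , e∈₂ with ∈-concatMap⁻ (λ δ → block (reach j) (j ∸ δ) w) (0 ∷ 1 ∷ 2 ∷ []) e∈₂
    ... | δ , _ , e∈₃ with ∈-concatMap⁻ (bipartite (reach j) (j ∸ δ) w) (crossing (j ∸ δ) w) e∈₃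
    ... | q , q∈ , e∈₄ with bipartite-∈ {reach j} {j ∸ δ} {w} {q} e∈₄
    ... | x∈ , y∈ , l = ftEdge j (j ∸ δ) (m∸n≤m j δ) (∈-downFrom⁻ j∈) w q
           (proj₂ (∈-filter⁻ (cross? (j ∸ δ) w) {xs = points} q∈)) x∈ y∈ l

    rep-Le : ∀ i {v p} → Alive i p → v ∈ rep i p → Le v p (2 * B ^ i)
    rep-Le i {v} ap v∈ = subst (λ z → Le v z (2 * B ^ i)) (rep-anc i ap v∈) (Le-anc i v)

    ftEdge-Le : ∀ {x y m} → FTEdge (x , y , m) → Le x y m
    ftEdge-Le {x} {y} (ftEdge j i i≤j _ w q (aw , aq , _ , h) x∈ y∈ m≡) =
      subst (Le x y) (sym m≡) (Le-mono bound (Le-trans (Le-trans (rep-Le i aw x∈) h) (Le-sym (rep-Le i aq y∈))))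
      where
        open ≤-Reasoning
        lem : ∀ b c → 2 * b + 2 * c + 2 * b ≡ 4 * b + 2 * c
        lem = solve-∀
        bound : 2 * B ^ i + 2 * B ^ (2 + i) + 2 * B ^ i ≤ 3 * B ^ (2 + j)
        bound = begin
          2 * B ^ i + 2 * B ^ (2 + i) + 2 * B ^ i ≡⟨ lem (B ^ i) (B ^ (2 + i)) ⟩
          4 * B ^ i + 2 * B ^ (2 + i)  ≤⟨ +-monoˡ-≤ _ (*B^-step 4 {1} i (m≤m+n 4 28)) ⟩
          1 * B ^ suc i + 2 * B ^ (2 + i) ≤⟨ +-monoˡ-≤ _ (*B^-step 1 {1} (suc i) (m≤m+n 1 31)) ⟩
          1 * B ^ (2 + i) + 2 * B ^ (2 + i) ≡⟨ sym (*-distribʳ-+ (B ^ (2 + i)) 1 2) ⟩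
          3 * B ^ (2 + i) ≤⟨ *-monoʳ-≤ 3 (B^-mono (s≤s (s≤s i≤j))) ⟩
          3 * B ^ (2 + j) ∎

    ftEdges-Le : ∀ {x y m} → (x , y , m) ∈ ftEdges → Le x y m
    ftEdges-Le e∈ = ftEdge-Le (ftEdges-∈ e∈)

    -- The 9 is three levels per death times the 3 in `reach`; each of the at most `Λ` crossings
    -- brings `suc k * suc k` pairs.
    ftWeight : ∑ len ftEdges ≤ 9 * (B * B) * (Λ * (suc k * suc k)) * Φ
    ftWeight = begin
      ∑ len ftEdges ≡⟨ ∑-concatMap len _ (downFrom top) ⟩
      ∑ (λ j → ∑ len (concatMap (blocks j) (dying j))) (downFrom top)
        ≤⟨ ∑-mono (downFrom top) (λ {j} _ → level j) ⟩
      ∑ (λ j → C * (length (dying j) * B ^ j)) (downFrom top) ≡⟨ ∑-* C _ (downFrom top) ⟩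
      C * Φ ∎
      where
        open ≤-Reasoning
        C = 9 * (B * B) * (Λ * (suc k * suc k))

        bip : ∀ m i w q → ∑ len (bipartite m i w q) ≤ suc k * suc k * m
        bip m i w q = begin
          ∑ len (bipartite m i w q) ≡⟨ ∑-map len _ (cartesianProduct (rep i w) (rep i q)) ⟩
          ∑ (λ _ → m) (cartesianProduct (rep i w) (rep i q)) ≡⟨ ∑-const m (cartesianProduct (rep i w) (rep i q)) ⟩
          length (cartesianProduct (rep i w) (rep i q)) * m
            ≡⟨ cong (_* m) (length-cartesianProduct (rep i w) (rep i q)) ⟩
          length (rep i w) * length (rep i q) * m
            ≤⟨ *-monoˡ-≤ m (*-mono-≤ (length-rep i w) (length-rep i q)) ⟩
          suc k * suc k * m ∎

        blk : ∀ m i w → ∑ len (block m i w) ≤ Λ * (suc k * suc k * m)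
        blk m i w = begin
          ∑ len (block m i w) ≡⟨ ∑-concatMap len _ (crossing i w) ⟩
          ∑ (λ q → ∑ len (bipartite m i w q)) (crossing i w) ≤⟨ ∑-≤-const _ (crossing i w) (λ {q} _ → bip m i w q) ⟩
          length (crossing i w) * (suc k * suc k * m) ≤⟨ *-monoˡ-≤ _ (crossing-bound i w) ⟩
          Λ * (suc k * suc k * m) ∎

        rearr : ∀ b p l c d → d * (3 * (l * (c * (3 * (b * (b * p)))))) ≡ 9 * (b * b) * (l * c) * (d * p)
        rearr = solve-∀

        level : ∀ j → ∑ len (concatMap (blocks j) (dying j)) ≤ C * (length (dying j) * B ^ j)
        level j = begin
          ∑ len (concatMap (blocks j) (dying j)) ≡⟨ ∑-concatMap len (blocks j) (dying j) ⟩
          ∑ (λ w → ∑ len (blocks j w)) (dying j)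
            ≤⟨ ∑-≤-const _ (dying j) (λ {w} _ → ≤-trans (≤-reflexive (∑-concatMap len (λ δ → block (reach j) (j ∸ δ) w) (0 ∷ 1 ∷ 2 ∷ [])))
                 (∑-≤-const _ (0 ∷ 1 ∷ 2 ∷ []) (λ {δ} _ → blk (reach j) (j ∸ δ) w))) ⟩
          length (dying j) * (3 * (Λ * (suc k * suc k * reach j))) ≡⟨ rearr B (B ^ j) Λ (suc k * suc k) (length (dying j)) ⟩
          C * (length (dying j) * B ^ j) ∎

    linked-by : ∀ i {w q x y} → Cross i w q → ¬ Alive (3 + i) w → x ∈ rep i w → y ∈ rep i q →
      ∃[ m ] (x , y , m) ∈ ftEdges
    linked-by i {w} {q} {x} {y} cr ¬a x∈ y∈ with dies-within i (proj₁ cr) ¬a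
    ... | δ , δ<3 , d = reach j ,
      ∈-concatMap (λ j → concatMap (blocks j) (dying j)) (∈-downFrom⁺ (dies<top j d))
        (∈-concatMap (blocks j) (∈dying j d)
          (∈-concatMap (λ δ → block (reach j) (j ∸ δ) w) (∈three δ<3)
            (subst (λ z → (x , y , reach j) ∈ block (reach j) z w) (sym (m+n∸m≡n δ i))
              (∈-concatMap (bipartite (reach j) i w) (∈-filter⁺ (cross? i w) (∈points q) cr)
                (∈-map⁺ (λ (x , y) → x , y , reach j) (∈-cartesianProduct⁺ x∈ y∈))))))
      where
        j = δ + i
        ∈three : ∀ {δ} → δ < 3 → δ ∈ 0 ∷ 1 ∷ 2 ∷ []
        ∈three {0} _ = here refl
        ∈three {1} _ = there (here refl)
        ∈three {2} _ = there (there (here refl))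
        ∈three {suc (suc (suc _))} (s≤s (s≤s (s≤s ())))

    Bridged : List Edge → Subset n → ℕ → X → X → Set
    Bridged E S i x y =
      ∃[ x′ ] ∃[ y′ ] x′ ∉ˢ S × y′ ∉ˢ S × anc i x′ ≡ anc i x × anc i y′ ≡ anc i y × Linked E x′ y′

    -- By `cross-absorb` one of the two centres dies soon enough to be charged. When it is the
    -- second one, the link is stored in the reverse direction, hence the symmetric `Linked`.
    ftEdges-bridge : ∀ (S : Subset n) → ∣ S ∣ ≤ k → ∀ i {x y} → x ∉ˢ S → y ∉ˢ S →
      ¬ Le x y (B ^ suc i) → Le x y (B ^ (2 + i)) →
      Bridged ftEdges S i x y
    ftEdges-bridge S S≤k i {x} {y} x∉ y∉ far near =
      result (rep-survives i x S S≤k x∉) (rep-survives i y S S≤k y∉)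
      where
        cr = cross-exists i far near
        link : ∀ {x′ y′} → x′ ∈ rep i (anc i x) → y′ ∈ rep i (anc i y) → Linked ftEdges x′ y′
        link x′∈ y′∈ with cross-absorb i cr
        ... | inj₁ ¬a       = let (m , e∈) = linked-by i cr ¬a x′∈ y′∈ in m , inj₁ e∈
        ... | inj₂ (_ , ¬a) = let (m , e∈) = linked-by i (cross-sym i cr) ¬a y′∈ x′∈ in m , inj₂ e∈
        result : ∃[ v ] v ∈ rep i (anc i x) × v ∉ˢ S → ∃[ v ] v ∈ rep i (anc i y) × v ∉ˢ S →
          Bridged ftEdges S i x y
        result (x′ , x′∈ , x′∉) (y′ , y′∈ , y′∉) =
          x′ , y′ , x′∉ , y′∉ , rep-anc i (alive-anc i x) x′∈ , rep-anc i (alive-anc i y) y′∈ , link x′∈ y′∈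

    -- The degree of a vertex in the fault-tolerant edges.

    module Neighbours (v : X) where

      Active : ℕ → Set
      Active i = v ∈ rep i (anc i v) × 0 < length (crossing i (anc i v))

      active? : ∀ i → Dec (Active i)
      active? i = (v ∈? rep i (anc i v)) ×-dec (0 <? length (crossing i (anc i v)))

      recent : ℕ → List X
      recent i = dying (2 + i) ++ dying (1 + i) ++ dying i

      ∈recent : ∀ i {w} → ∃[ δ ] δ < 3 × Dies (δ + i) w → w ∈ recent i
      ∈recent i (0 , _ , d) = ∈-++⁺ʳ (dying (2 + i)) (∈-++⁺ʳ (dying (1 + i)) (∈dying i d))
      ∈recent i (1 , _ , d) = ∈-++⁺ʳ (dying (2 + i)) (∈-++⁺ˡ (∈dying (1 + i) d))
      ∈recent i (2 , _ , d) = ∈-++⁺ˡ (∈dying (2 + i) d)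
      ∈recent i (suc (suc (suc _)) , s≤s (s≤s (s≤s ())) , _)

      -- Either the centre above `v` dies, or it survives and absorbs a crossing partner that dies.
      -- In both cases the death lands in the cluster that contains `v` three levels up.
      newDeath : ∀ i → 0 < length (crossing i (anc i v)) → ∃[ w ] anc (3 + i) w ≡ anc (3 + i) v × w ∈ recent i
      newDeath i 0< with nonempty 0<
      ... | q , q∈ = pick (proj₂ (∈-filter⁻ (cross? i (anc i v)) {xs = points} q∈))
        where
          up : anc (3 + i) (anc i v) ≡ anc (3 + i) v
          up = anc-+ 3 i (alive-anc i v)
          pick : Cross i (anc i v) q → ∃[ w ] anc (3 + i) w ≡ anc (3 + i) v × w ∈ recent i
          pick cr with cross-absorb i cr
          ... | inj₁ ¬a = anc i v , up , ∈recent i (dies-within i (proj₁ cr) ¬a)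
          ... | inj₂ (e , ¬a) = q , trans (sym (trans (cong (anc (3 + i)) (sym e)) (alive-anc (3 + i) q))) up ,
                                ∈recent i (dies-within i (proj₁ (proj₂ cr)) ¬a)

      module _ (s : ℕ) where

        near? : ∀ i w → Dec (anc i w ≡ anc i v)
        near? i = inCluster? i (anc i v)

        -- Only deaths from level `s` on are counted, so that `v` is not among them. `s = 0` serves
        -- the levels up to the death of `v`, and `suc l` those after a death at level `l`; together
        -- they give the two halves of `6 * suc k`.
        g : ℕ → ℕ
        g i = length (filter (near? i) (deaths s i))

        length-filter-++ : ∀ i (xs ys : List X) →
          length (filter (near? i) (xs ++ ys)) ≡ length (filter (near? i) xs) + length (filter (near? i) ys)
        length-filter-++ i xs ys = trans (cong length (filter-++ (near? i) xs ys)) (length-++ (filter (near? i) xs))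

        deaths-empty : ∀ i → ¬ s ≤ i → deaths s i ≡ []
        deaths-empty zero    _ = refl
        deaths-empty (suc i) ¬h with s ≤? i
        ... | yes h = ⊥-elim (¬h (m≤n⇒m≤1+n h))
        ... | no _  = refl

        g-mono : ∀ i → g i ≤ g (suc i)
        g-mono i with s ≤? i
        ... | no ¬h rewrite deaths-empty i ¬h = z≤n
        ... | yes h = ≤-trans (length-filter-mono (near? i) (near? (suc i)) (deaths s i) (λ {x} → anc-suc i))
                (≤-trans (m≤n+m _ (length (filter (near? (suc i)) (dying i))))
                         (≤-reflexive (sym (length-filter-++ (suc i) (dying i) (deaths s i)))))

        A : ℕ → Set
        A i = s ≤ i × v ∉ deaths s i × Active i

        A? : ∀ i → Dec (A i)
        A? i = (s ≤? i) ×-dec ¬? (v ∈? deaths s i) ×-dec active? i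

        -- The counted deaths all precede `v` in `ranked`, and `v` is among the first `k + 1`.
        bounded : ∀ {i} → A i → g i ≤ k
        bounded {i} (s≤i , v∉ , v∈ , _) =
          ≤-pred (∈-take-++⁻ (suc k) (filter (near? i) (deaths s i)) (filter (near? i) (deaths 0 s) ++ anc i v ∷ [])
            (subst (λ z → v ∈ take (suc k) z) eq v∈)
            (v∉ ∘ proj₁ ∘ ∈-filter⁻ (near? i) {xs = deaths s i}))
          where
            split : deaths 0 i ≡ deaths s i ++ deaths 0 s
            split = subst (λ z → deaths 0 z ≡ deaths s z ++ deaths 0 s) (m∸n+n≡m s≤i) (deaths-split s (i ∸ s))
            eq : ranked i (anc i v) ≡ filter (near? i) (deaths s i) ++ (filter (near? i) (deaths 0 s) ++ anc i v ∷ [])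
            eq = trans (cong (λ z → filter (near? i) z ++ anc i v ∷ []) split)
                   (trans (cong (_++ anc i v ∷ []) (filter-++ (near? i) (deaths s i) (deaths 0 s)))
                          (++-assoc (filter (near? i) (deaths s i)) _ _))

        grows : ∀ {i} → A i → g i < g (3 + i)
        grows {i} (s≤i , _ , _ , 0<) = begin
          suc (g i) ≤⟨ +-mono-≤ (new (newDeath i 0<))
                         (length-filter-mono (near? i) (near? (3 + i)) (deaths s i) (λ {x} → anc-+ 3 i)) ⟩
          length (filter (near? (3 + i)) (recent i)) + length (filter (near? (3 + i)) (deaths s i))
            ≡⟨ sym (length-filter-++ (3 + i) (recent i) (deaths s i)) ⟩
          length (filter (near? (3 + i)) (recent i ++ deaths s i)) ≡⟨ cong (length ∘ filter (near? (3 + i))) (sym unfold) ⟩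
          g (3 + i) ∎
          where
            open ≤-Reasoning
            new : ∃[ w ] anc (3 + i) w ≡ anc (3 + i) v × w ∈ recent i → 0 < length (filter (near? (3 + i)) (recent i))
            new (w , e , w∈) = ∈⇒0<length (∈-filter⁺ (near? (3 + i)) w∈ e)
            unfold : deaths s (3 + i) ≡ recent i ++ deaths s i
            unfold = trans (deaths-suc (≤-trans s≤i (m≤n+m i 2))) (trans (cong (dying (2 + i) ++_)
              (trans (deaths-suc (≤-trans s≤i (m≤n+m i 1))) (trans (cong (dying (1 + i) ++_) (deaths-suc s≤i))
                 (sym (++-assoc (dying (1 + i)) (dying i) (deaths s i))))))
              (sym (++-assoc (dying (2 + i)) (dying (1 + i) ++ dying i) (deaths s i))))

        used : List ℕ
        used = levels A? k g g-mono bounded grows top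

        used-bound : length used ≤ 3 * suc k
        used-bound = levels-bound A? k g g-mono bounded grows top

        ∈used : ∀ {i} → i < top → A i → i ∈ used
        ∈used = ∈-levels A? k g g-mono bounded grows

      ActiveIn : List ℕ → Set
      ActiveIn js = ∀ {i} → i < top → Active i → i ∈ js

      immortal : ¬ (∃[ l ] Dies l v) → ActiveIn (used 0)
      immortal ¬d {i} i<top a = ∈used 0 i<top (z≤n , (λ v∈ → absurd (deaths-∈ 0 i v∈)) , a)
        where absurd : ∃[ j ] 0 ≤ j × j < i × Dies j v → ⊥
              absurd (j , _ , _ , d) = ¬d (j , d)

      mortal : ∀ l → Dies l v → ActiveIn (used 0 ++ used (suc l))
      mortal l dl {i} i<top a = cover (suc l ≤? i)
        where
          late : ∃[ j ] suc l ≤ j × j < i × Dies j v → ⊥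
          late (j , l<j , _ , d) = <-irrefl (dies-unique l j dl d) l<j
          early : ¬ suc l ≤ i → ∃[ j ] 0 ≤ j × j < i × Dies j v → ⊥
          early l≮i (j , _ , j<i , d) = l≮i (subst (_< i) (dies-unique j l d dl) j<i)
          cover : Dec (suc l ≤ i) → i ∈ used 0 ++ used (suc l)
          cover (yes l<i) = ∈-++⁺ʳ (used 0) (∈used (suc l) i<top (l<i , (λ v∈ → late (deaths-∈ (suc l) i v∈)) , a))
          cover (no l≮i)  = ∈-++⁺ˡ (∈used 0 i<top (z≤n , (λ v∈ → early l≮i (deaths-∈ 0 i v∈)) , a))

      activeLevels : Σ[ js ∈ List ℕ ] (length js ≤ 6 * suc k × ActiveIn js)
      activeLevels = decide (any? (λ l → dies? l v) (downFrom top))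
        where
          decide : Dec (Any (λ l → Dies l v) (downFrom top)) → Σ[ js ∈ List ℕ ] (length js ≤ 6 * suc k × ActiveIn js)
          decide (no ¬d) = used 0 , ≤-trans (used-bound 0) (*-monoˡ-≤ (suc k) (m≤m+n 3 3)) ,
            λ {i} → immortal (λ (l , d) → ¬d (lose (∈-downFrom⁺ (dies<top l d)) d)) {i}
          decide (yes d) = both (find d)
            where
              both : ∃[ l ] l ∈ downFrom top × Dies l v → Σ[ js ∈ List ℕ ] (length js ≤ 6 * suc k × ActiveIn js)
              both (l , _ , dl) = used 0 ++ used (suc l) ,
                ≤-trans (≤-reflexive (length-++ (used 0))) (≤-trans (+-mono-≤ (used-bound 0) (used-bound (suc l)))
                  (≤-reflexive (sym (*-distribʳ-+ (suc k) 3 3)))) , λ {i} → mortal l dl {i}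

      neighbours : List X
      neighbours = concatMap (λ i → concatMap (rep i) (crossing i (anc i v))) (proj₁ activeLevels)

      neighbours-bound : length neighbours ≤ 6 * suc k * (Λ * suc k)
      neighbours-bound = begin
        length neighbours ≡⟨ length-concatMap _ (proj₁ activeLevels) ⟩
        ∑ (λ i → length (concatMap (rep i) (crossing i (anc i v)))) (proj₁ activeLevels)
          ≤⟨ ∑-≤-const (Λ * suc k) (proj₁ activeLevels) (λ {i} _ → row i) ⟩
        length (proj₁ activeLevels) * (Λ * suc k) ≤⟨ *-monoˡ-≤ (Λ * suc k) (proj₁ (proj₂ activeLevels)) ⟩
        6 * suc k * (Λ * suc k) ∎
        where
          open ≤-Reasoning
          row : ∀ i → length (concatMap (rep i) (crossing i (anc i v))) ≤ Λ * suc k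
          row i = begin
            length (concatMap (rep i) (crossing i (anc i v))) ≡⟨ length-concatMap (rep i) (crossing i (anc i v)) ⟩
            ∑ (length ∘ rep i) (crossing i (anc i v)) ≤⟨ ∑-≤-const (suc k) (crossing i (anc i v)) (λ {q} _ → length-rep i q) ⟩
            length (crossing i (anc i v)) * suc k ≤⟨ *-monoˡ-≤ (suc k) (crossing-bound i (anc i v)) ⟩
            Λ * suc k ∎

      private
        adjacent : ∀ i {p q y} → i < top → Cross i p q → v ∈ rep i p → y ∈ rep i q → y ∈ neighbours
        adjacent i {p} {q} {y} i<top cr v∈ y∈ = go (rep-anc i (proj₁ cr) v∈)
          where
            go : anc i v ≡ p → y ∈ neighbours
            go refl = ∈-concatMap (λ i → concatMap (rep i) (crossing i (anc i v)))
               (proj₂ (proj₂ activeLevels) i<top (v∈ , ∈⇒0<length q∈)) (∈-concatMap (rep i) q∈ y∈)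
              where q∈ = ∈-filter⁺ (cross? i p) (∈points q) cr

      ∈neighbours : ∀ {y} → Linked ftEdges v y → y ∈ neighbours
      ∈neighbours {y} (m , inj₁ e∈) = go (ftEdges-∈ e∈)
        where go : FTEdge (v , y , m) → y ∈ neighbours
              go (ftEdge j i i≤j j<top w q cr x∈ y∈ _) = adjacent i (≤-<-trans i≤j j<top) cr x∈ y∈
      ∈neighbours {y} (m , inj₂ e∈) = go (ftEdges-∈ e∈)
        where go : FTEdge (y , v , m) → y ∈ neighbours
              go (ftEdge j i i≤j j<top w q cr x∈ y∈ _) = adjacent i (≤-<-trans i≤j j<top) (cross-sym i cr) y∈ x∈

  -- Weight-balanced trees and heaps on a spine.

  module Hopping {n : ℕ} (𝓢 : Scale n) where

    open Nets 𝓢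

    -- A vertex together with the level at which it enters a spine.
    Item : Set
    Item = X × ℕ

    vx : Item → X
    vx = proj₁

    -- The bound on the diameter of a cluster of that level from `Le-cluster`.
    ℓ : Item → ℕ
    ℓ a = 4 * B ^ proj₂ a

    Link : Set
    Link = Item × Item

    -- With this budget the length of a link is the sum of what its two ends pay, so a bound on
    -- charges with `φ = ℓ` is a bound on total length.
    LeI : Item → Item → Set
    LeI a b = Le (vx a) (vx b) (ℓ a + ℓ b)

    both : (Item → ℕ) → Link → ℕ
    both φ (a , b) = φ a + φ b

    -- A route with an upper bound on its cost in units and on its hops, free of the metric and the
    -- graph; `toPath` realises it later.
    data Conn (E : List Link) : X → X → ℕ → ℕ → Set where
      nil  : ∀ {x} → Conn E x x 0 0
      edge : ∀ {a b} → (a , b) ∈ E → LeI a b → Conn E (vx a) (vx b) (ℓ a + ℓ b) 1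
      rev  : ∀ {x y c h} → Conn E x y c h → Conn E y x c h
      _▸_  : ∀ {x y z c h c′ h′} → Conn E x y c h → Conn E y z c′ h′ → Conn E x z (c + c′) (h + h′)
      weak : ∀ {x y c h c′ h′} → c ≤ c′ → h ≤ h′ → Conn E x y c h → Conn E x y c′ h′

    Conn-⊆ : ∀ {E E′} → (∀ {e} → e ∈ E → e ∈ E′) → ∀ {x y c h} → Conn E x y c h → Conn E′ x y c h
    Conn-⊆ f nil          = nil
    Conn-⊆ f (edge e le)  = edge (f e) le
    Conn-⊆ f (rev p)      = rev (Conn-⊆ f p)
    Conn-⊆ f (p ▸ q)      = Conn-⊆ f p ▸ Conn-⊆ f q
    Conn-⊆ f (weak c h p) = weak c h (Conn-⊆ f p)

    Spine : Set
    Spine = List (Item × ℕ)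

    wt : Spine → ℕ
    wt = ∑ proj₂

    ∑ⁱ : (Item → ℕ) → Spine → ℕ
    ∑ⁱ φ = ∑ (φ ∘ proj₁)

    -- A weighted median. `a` is the weight already passed on the left, and the scan stops at the
    -- first item with at most half of the total to its right.
    median : ∀ a x xs → 2 * a ≤ a + wt (x ∷ xs) →
      ∃[ l ] ∃[ m ] ∃[ r ] x ∷ xs ≡ l ++ m ∷ r × 2 * (a + wt l) ≤ a + wt (x ∷ xs) × 2 * wt r ≤ a + wt (x ∷ xs)
    median a x xs h with 2 * wt xs ≤? a + wt (x ∷ xs)
    ... | yes h′ = [] , x , xs , refl , ≤-trans (≤-reflexive (cong (2 *_) (+-identityʳ a))) h , h′
    median a x [] h | no ¬h = ⊥-elim (¬h z≤n)
    median a x@(_ , w) (y ∷ ys) h | no ¬h = go (median (a + w) y ys h₁)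
      where
        S = wt (y ∷ ys)
        assoc : a + w + S ≡ a + (w + S)
        assoc = +-assoc a w S
        h₁ : 2 * (a + w) ≤ a + w + S
        h₁ = begin
          2 * (a + w)      ≡⟨ lem (a + w) ⟩
          (a + w) + (a + w) ≤⟨ +-monoʳ-≤ (a + w) (+-cancelʳ-≤ S (a + w) S (begin
            a + w + S     ≡⟨ assoc ⟩
            a + (w + S)   ≤⟨ <⇒≤ (≰⇒> ¬h) ⟩
            2 * S         ≡⟨ lem S ⟩
            S + S ∎)) ⟩
          a + w + S ∎
          where open ≤-Reasoning
                lem : ∀ z → 2 * z ≡ z + z
                lem = solve-∀
        go : ∃[ l ] ∃[ m ] ∃[ r ] y ∷ ys ≡ l ++ m ∷ r × 2 * (a + w + wt l) ≤ a + w + S × 2 * wt r ≤ a + w + S →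
             ∃[ l ] ∃[ m ] ∃[ r ] x ∷ y ∷ ys ≡ l ++ m ∷ r × 2 * (a + wt l) ≤ a + (w + S) × 2 * wt r ≤ a + (w + S)
        go (l , m , r , e , p , q) = x ∷ l , m , r , cong (x ∷_) e ,
          subst₂ _≤_ (cong (2 *_) (+-assoc a w (wt l))) assoc p , ≤-trans q (≤-reflexive assoc)

    2^-suc : ∀ h w → 2 ^ (h + 1) * w ≡ 2 * (2 ^ h * w)
    2^-suc h w = trans (cong (λ z → 2 ^ z * w) (+-comm h 1)) (*-assoc 2 (2 ^ h) w)

    module _ (Good : Item → Set) (good-Le : ∀ {a b} → Good a → Good b → LeI a b) where

      -- A weight-balanced search tree: 2 ^ depth * weight ≤ total weight, so depths
      -- telescope when such trees are stacked along the heavy paths.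
      record Rooted (xs : Spine) : Set where
        field
          root   : Item
          edges  : List Link
          root∈  : Good root
          Le-all : ∀ {a b} → (a , b) ∈ edges → LeI a b
          -- Every item ends at most three links and the root at most two; the remaining unit of the
          -- root is reserved for a link to something above it.
          charge : ∀ φ → ∑ (both φ) edges + φ root ≤ 3 * ∑ⁱ φ xs
          reach  : ∀ {y w} → (y , w) ∈ xs → ∃[ h ] ∃[ c ]
                   2 ^ h * w ≤ wt xs × c + ℓ root ≤ 2 * ∑ⁱ ℓ xs × Conn edges (vx y) (vx root) c h

      -- The extra link from the root of `l` up to `x` is one more hop, hence the factor 2 before
      -- `wt l`; `fork` repays it, since each side has at most half of the total weight.
      record Hang (x : Item) (l : Spine) : Set where
        field
          edges  : List Link
          Le-all : ∀ {a b} → (a , b) ∈ edges → LeI a b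
          charge : ∀ φ → ∑ (both φ) edges ≤ 3 * ∑ⁱ φ l + φ x
          reach  : ∀ {y w} → (y , w) ∈ l → ∃[ h ] ∃[ c ]
                   2 ^ h * w ≤ 2 * wt l × c ≤ 2 * ∑ⁱ ℓ l + ℓ x × Conn edges (vx y) (vx x) c h

      hang-root : ∀ {x l} → Good x → Rooted l → Hang x l
      hang-root {x} {l} gx R = record
        { edges = (m , x) ∷ R.edges ; Le-all = Le-all ; charge = charge ; reach = λ {y} {w} y∈ → extend {y} {w} (R.reach y∈) }
        where
          module R = Rooted R
          m = R.root
          le = good-Le R.root∈ gx
          Le-all : ∀ {a b} → (a , b) ∈ (m , x) ∷ R.edges → LeI a b
          Le-all (here refl) = le
          Le-all (there p)   = R.Le-all p
          open ≤-Reasoning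
          charge : ∀ φ → φ m + φ x + ∑ (both φ) R.edges ≤ 3 * ∑ⁱ φ l + φ x
          charge φ = begin
            φ m + φ x + ∑ (both φ) R.edges ≡⟨ lem (φ m) (φ x) (∑ (both φ) R.edges) ⟩
            ∑ (both φ) R.edges + φ m + φ x ≤⟨ +-monoˡ-≤ (φ x) (R.charge φ) ⟩
            3 * ∑ⁱ φ l + φ x ∎
            where lem : ∀ m x e → m + x + e ≡ e + m + x
                  lem = solve-∀
          extend : ∀ {y w} →
            ∃[ h ] ∃[ c ] 2 ^ h * w ≤ wt l × c + ℓ m ≤ 2 * ∑ⁱ ℓ l × Conn R.edges (vx y) (vx m) c h →
            ∃[ h ] ∃[ c ] 2 ^ h * w ≤ 2 * wt l × c ≤ 2 * ∑ⁱ ℓ l + ℓ x × Conn ((m , x) ∷ R.edges) (vx y) (vx x) c h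
          extend {w = w} (h , c , hw , cb , p) = h + 1 , c + (ℓ m + ℓ x) ,
            ≤-trans (≤-reflexive (2^-suc h w)) (*-monoʳ-≤ 2 hw) ,
            ≤-trans (≤-reflexive (sym (+-assoc c (ℓ m) (ℓ x)))) (+-monoˡ-≤ (ℓ x) cb) ,
            (Conn-⊆ there p ▸ edge (here refl) le)

      fork : ∀ m wm l r → Good m → 2 * wt l ≤ wt (l ++ (m , wm) ∷ r) → 2 * wt r ≤ wt (l ++ (m , wm) ∷ r) →
        Hang m l → Hang m r → Rooted (l ++ (m , wm) ∷ r)
      fork m wm l r gm l≤ r≤ L R = record
        { root = m ; edges = L.edges ++ R.edges ; root∈ = gm
        ; Le-all = λ p → Le-all (∈-++⁻ L.edges p) ; charge = charge ; reach = λ p → reach (∈-++⁻ l p) }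
        where
          module L = Hang L
          module R = Hang R
          xs = l ++ (m , wm) ∷ r
          Le-all : ∀ {a b} → (a , b) ∈ L.edges ⊎ (a , b) ∈ R.edges → LeI a b
          Le-all (inj₁ q) = L.Le-all q
          Le-all (inj₂ q) = R.Le-all q
          sumxs : ∀ φ → ∑ⁱ φ xs ≡ ∑ⁱ φ l + (φ m + ∑ⁱ φ r)
          sumxs φ = ∑-++ (φ ∘ proj₁) l ((m , wm) ∷ r)
          open ≤-Reasoning
          charge : ∀ φ → ∑ (both φ) (L.edges ++ R.edges) + φ m ≤ 3 * ∑ⁱ φ xs
          charge φ = begin
            ∑ (both φ) (L.edges ++ R.edges) + φ m ≡⟨ cong (_+ φ m) (∑-++ (both φ) L.edges R.edges) ⟩
            ∑ (both φ) L.edges + ∑ (both φ) R.edges + φ m ≤⟨ +-monoˡ-≤ (φ m) (+-mono-≤ (L.charge φ) (R.charge φ)) ⟩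
            3 * ∑ⁱ φ l + φ m + (3 * ∑ⁱ φ r + φ m) + φ m ≡⟨ lem (φ m) (∑ⁱ φ l) (∑ⁱ φ r) ⟩
            3 * (∑ⁱ φ l + (φ m + ∑ⁱ φ r)) ≡⟨ cong (3 *_) (sym (sumxs φ)) ⟩
            3 * ∑ⁱ φ xs ∎
            where lem : ∀ m s t → 3 * s + m + (3 * t + m) + m ≡ 3 * (s + (m + t))
                  lem = solve-∀
          Goal : Item → ℕ → Set
          Goal y w = ∃[ h ] ∃[ c ] 2 ^ h * w ≤ wt xs × c + ℓ m ≤ 2 * ∑ⁱ ℓ xs × Conn (L.edges ++ R.edges) (vx y) (vx m) c h
          below : ∀ {y w} (s : Spine) (E : List Link) → (∀ {f} → f ∈ E → f ∈ L.edges ++ R.edges) → 2 * wt s ≤ wt xs →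
            ∑ⁱ ℓ s + ℓ m ≤ ∑ⁱ ℓ xs →
            (∃[ h ] ∃[ c ] 2 ^ h * w ≤ 2 * wt s × c ≤ 2 * ∑ⁱ ℓ s + ℓ m × Conn E (vx y) (vx m) c h) → Goal y w
          below s E E⊆ s≤ ℓ≤ (h , c , hw , cb , p) = h , c , ≤-trans hw s≤ ,
            ≤-trans (+-monoˡ-≤ (ℓ m) cb) (≤-trans (≤-reflexive (lem (∑ⁱ ℓ s) (ℓ m))) (*-monoʳ-≤ 2 ℓ≤)) , Conn-⊆ E⊆ p
            where lem : ∀ s m → 2 * s + m + m ≡ 2 * (s + m)
                  lem = solve-∀
          mr≤ : ℓ m + ∑ⁱ ℓ r ≤ ∑ⁱ ℓ xs
          mr≤ = ≤-trans (m≤n+m _ (∑ⁱ ℓ l)) (≤-reflexive (sym (sumxs ℓ)))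
          reach : ∀ {y w} → (y , w) ∈ l ⊎ (y , w) ∈ (m , wm) ∷ r → Goal y w
          reach {y} {w} (inj₁ p) = below {y} {w} l L.edges ∈-++⁺ˡ l≤
            (≤-trans (+-monoʳ-≤ (∑ⁱ ℓ l) (m≤m+n (ℓ m) _)) (≤-reflexive (sym (sumxs ℓ)))) (L.reach p)
          reach {y} {w} (inj₂ (there p)) = below {y} {w} r R.edges (∈-++⁺ʳ L.edges) r≤
            (≤-trans (≤-reflexive (+-comm (∑ⁱ ℓ r) (ℓ m))) mr≤) (R.reach p)
          reach (inj₂ (here refl)) = 0 , 0 ,
            ≤-trans (≤-reflexive (+-identityʳ wm))
              (≤-trans (m≤m+n wm (wt r)) (≤-trans (m≤n+m _ (wt l)) (≤-reflexive (sym (∑-++ proj₂ l ((m , wm) ∷ r)))))) ,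
            ≤-trans (≤-trans (m≤m+n (ℓ m) _) mr≤) (m≤m+n (∑ⁱ ℓ xs) _) , nil

      mutual

        -- The parts on either side of the median are not structurally smaller, so the recursion
        -- runs on a bound for the length.
        rooted : ∀ fuel y ys → length ys < fuel → (∀ {z w} → (z , w) ∈ y ∷ ys → Good z) → Rooted (y ∷ ys)
        rooted (suc fuel) y ys (s≤s len≤) gl = split (median 0 y ys z≤n)
          where
            split : ∃[ l ] ∃[ m ] ∃[ r ] y ∷ ys ≡ l ++ m ∷ r × 2 * wt l ≤ wt (y ∷ ys) × 2 * wt r ≤ wt (y ∷ ys) →
                    Rooted (y ∷ ys)
            split (l , (m , wm) , r , e , l≤ , r≤) = subst Rooted (sym e)
              (fork m wm l r gm (subst (λ z → 2 * wt l ≤ wt z) e l≤) (subst (λ z → 2 * wt r ≤ wt z) e r≤)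
                (hang fuel m l (≤-trans (m≤m+n (length l) (length r)) lr≤) gm (λ p → gl (subst (_ ∈_) (sym e) (∈-++⁺ˡ p))))
                (hang fuel m r (≤-trans (m≤n+m (length r) (length l)) lr≤) gm
                  (λ p → gl (subst (_ ∈_) (sym e) (∈-++⁺ʳ l (there p))))))
              where
                gm : Good m
                gm = gl (subst (_ ∈_) (sym e) (∈-++⁺ʳ l (here refl)))
                lr≤ : length l + length r ≤ fuel
                lr≤ = ≤-pred (≤-trans (≤-reflexive (sym (trans (cong length e) (trans (length-++ l) (+-suc _ _))))) (s≤s len≤))

        hang : ∀ fuel x l → length l ≤ fuel → Good x → (∀ {y w} → (y , w) ∈ l → Good y) → Hang x l
        hang fuel x []       _    gx gl = record { edges = [] ; Le-all = λ () ; charge = λ φ → z≤n ; reach = λ () }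
        hang fuel x (y ∷ ys) len≤ gx gl = hang-root gx (rooted fuel y ys len≤ gl)

    -- A binary heap by order of arrival. Lists are latest first and nth counts from
    -- the end, so the heap of a tail is part of the heap of the list. The argument z
    -- is a junk value.
    nth : Item → List Item → ℕ → Item
    nth z []       j = z
    nth z (y ∷ ys) j with j ≟ length ys
    ... | yes _ = y
    ... | no  _ = nth z ys j

    nth-last : ∀ z y ys → nth z (y ∷ ys) (length ys) ≡ y
    nth-last z y ys with length ys ≟ length ys
    ... | yes _ = refl
    ... | no ¬e = ⊥-elim (¬e refl)

    nth-tail : ∀ z y ys {j} → j < length ys → nth z (y ∷ ys) j ≡ nth z ys j
    nth-tail z y ys {j} j< with j ≟ length ys
    ... | yes refl = ⊥-elim (<-irrefl refl j<)
    ... | no _ = refl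

    nth-∈ : ∀ z ys {j} → j < length ys → nth z ys j ∈ ys
    nth-∈ z (y ∷ ys) {j} j< with j ≟ length ys
    ... | yes _ = here refl
    ... | no ¬e = there (nth-∈ z ys (≤∧≢⇒< (≤-pred j<) ¬e))

    ∈-nth : ∀ z ys {y} → y ∈ ys → ∃[ j ] j < length ys × nth z ys j ≡ y
    ∈-nth z (y ∷ ys) (here refl) = length ys , ≤-refl , nth-last z y ys
    ∈-nth z (y ∷ ys) (there p) with ∈-nth z ys p
    ... | j , j< , e = j , m≤n⇒m≤1+n j< , trans (nth-tail z y ys j<) e

    -- An item arriving on top of `y ∷ ys` has index `suc (length ys)` counted from zero; the parent
    -- of index `j` in a binary heap is half of `j ∸ 1`.
    parent : Item → List Item → Item
    parent z []       = z
    parent z (y ∷ ys) = nth z (y ∷ ys) ⌊ length ys /2⌋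

    heap : Item → List Item → List Link
    heap z []           = []
    heap z (x ∷ [])     = []
    heap z (x ∷ y ∷ ys) = (x , parent z (y ∷ ys)) ∷ heap z (y ∷ ys)

    parent-index : ∀ (ys : List Item) → ⌊ length ys /2⌋ < suc (length ys)
    parent-index ys = s≤s (⌊n/2⌋≤n (length ys))

    heap-Le : (Good : Item → Set) → (∀ {a b} → Good a → Good b → LeI a b) → ∀ z xs → (∀ {a} → a ∈ xs → Good a) →
      ∀ {a b} → (a , b) ∈ heap z xs → LeI a b
    heap-Le Good le z (x ∷ y ∷ ys) g (here refl) = le (g (here refl)) (g (there (nth-∈ z (y ∷ ys) (parent-index ys))))
    heap-Le Good le z (x ∷ y ∷ ys) g (there p)   = heap-Le Good le z (y ∷ ys) (g ∘ there) p

    module _ (φ : Item → ℕ) (z : Item) where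

      private
        upto : List Item → ℕ → ℕ
        upto xs zero    = 0
        upto xs (suc m) = upto xs m + φ (nth z xs m)

        upto-tail : ∀ x xs m → m ≤ length xs → upto (x ∷ xs) m ≡ upto xs m
        upto-tail x xs zero    h = refl
        upto-tail x xs (suc m) h = cong₂ _+_ (upto-tail x xs m (<⇒≤ h)) (cong φ (nth-tail z x xs h))

        upto≤ : ∀ xs m → m ≤ length xs → upto xs m ≤ ∑ φ xs
        upto≤ [] zero h = z≤n
        upto≤ (x ∷ xs) m h with m≤n⇒m<n∨m≡n h
        ... | inj₁ m< = ≤-trans (≤-reflexive (upto-tail x xs m (≤-pred m<))) (≤-trans (upto≤ xs m (≤-pred m<)) (m≤n+m _ (φ x)))
        ... | inj₂ refl = ≤-trans (+-mono-≤ (≤-trans (≤-reflexive (upto-tail x xs (length xs) ≤-refl)) (upto≤ xs (length xs) ≤-refl))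
                                            (≤-reflexive (cong φ (nth-last z x xs))))
                            (≤-reflexive (+-comm (∑ φ xs) (φ x)))

        -- The odd indices have as parents an initial segment of the arrivals, each once, and so do
        -- the even ones. This accounts for the two prefix sums, which exchange roles with every new
        -- item.
        parents : ∀ x xs → ∑ (both φ) (heap z (x ∷ xs)) ≤
          ∑ φ (x ∷ xs) + (upto (x ∷ xs) ⌊ suc (length xs) /2⌋ + upto (x ∷ xs) ⌊ length xs /2⌋)
        parents x [] = z≤n
        parents x (y ∷ ys) = begin
          φ x + φ q + ∑ (both φ) (heap z (y ∷ ys))
            ≤⟨ +-monoʳ-≤ (φ x + φ q) (parents y ys) ⟩
          φ x + φ q + (s + (upto (y ∷ ys) b + upto (y ∷ ys) a)) ≡⟨ lem (φ x) (φ q) s (upto (y ∷ ys) b) (upto (y ∷ ys) a) ⟩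
          φ x + s + (upto (y ∷ ys) (suc a) + upto (y ∷ ys) b)
            ≡⟨ cong (φ x + s +_) (sym (cong₂ _+_ (upto-tail x (y ∷ ys) (suc a) (parent-index ys))
                                            (upto-tail x (y ∷ ys) b (⌊n/2⌋≤n (suc (length ys)))))) ⟩
          φ x + s + (upto (x ∷ y ∷ ys) (suc a) + upto (x ∷ y ∷ ys) b) ∎
          where
            open ≤-Reasoning
            a = ⌊ length ys /2⌋
            b = ⌊ suc (length ys) /2⌋
            q = nth z (y ∷ ys) a
            s = ∑ φ (y ∷ ys)
            lem : ∀ x q s jb ja → x + q + (s + (jb + ja)) ≡ x + s + (ja + q + jb)
            lem = solve-∀

      heap-charge : ∀ xs → ∑ (both φ) (heap z xs) ≤ 3 * ∑ φ xs
      heap-charge [] = z≤n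
      heap-charge (x ∷ xs) = ≤-trans (parents x xs) (≤-trans
        (+-monoʳ-≤ (∑ φ (x ∷ xs)) (+-mono-≤ (upto≤ (x ∷ xs) _ (⌊n/2⌋≤n (suc (length xs))))
                                              (upto≤ (x ∷ xs) _ (≤-trans (⌊n/2⌋≤n (length xs)) (n≤1+n _)))))
        (≤-reflexive (lem (∑ φ (x ∷ xs)))))
        where lem : ∀ s → s + (s + s) ≡ 3 * s
              lem = solve-∀

    ⌊n/2⌋+⌊n/2⌋≤n : ∀ m → ⌊ m /2⌋ + ⌊ m /2⌋ ≤ m
    ⌊n/2⌋+⌊n/2⌋≤n zero          = z≤n
    ⌊n/2⌋+⌊n/2⌋≤n (suc zero)    = z≤n
    ⌊n/2⌋+⌊n/2⌋≤n (suc (suc m)) = s≤s (≤-trans (≤-reflexive (+-suc _ _)) (s≤s (⌊n/2⌋+⌊n/2⌋≤n m)))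

    module _ (Good : Item → Set) (le : ∀ {a b} → Good a → Good b → LeI a b) (z : Item) where

      -- Passing to the parent at least halves `suc j`, which bounds the depth. The summand
      -- `ℓ (nth z xs j)` keeps this end free to pay for one more link.
      HeapPath : List Item → ℕ → Set
      HeapPath xs j = ∃[ h ] ∃[ c ] 2 ^ h ≤ suc j × c + ℓ (nth z xs j) ≤ 2 * ∑ ℓ xs ×
        Conn (heap z xs) (vx (nth z xs j)) (vx (nth z xs 0)) c h

      heap-path : ∀ xs → (∀ {a} → a ∈ xs → Good a) → ∀ j → j < length xs → HeapPath xs j
      heap-path (x ∷ []) g zero _ = 0 , 0 , ≤-refl , ≤-trans (m≤m+n (ℓ x) 0) (m≤m+n (ℓ x + 0) _) , nil
      heap-path (x ∷ []) g (suc j) (s≤s ())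
      heap-path (x ∷ y ∷ ys) g j j< = step (m≤n⇒m<n∨m≡n (≤-pred j<)) (heap-path (y ∷ ys) (g ∘ there))
        where
          open ≤-Reasoning
          a = ⌊ length ys /2⌋
          q = nth z (y ∷ ys) a
          s = ∑ ℓ (y ∷ ys)
          first : nth z (x ∷ y ∷ ys) 0 ≡ nth z (y ∷ ys) 0
          first = nth-tail z x (y ∷ ys) (s≤s z≤n)
          raise : j < length (y ∷ ys) → HeapPath (y ∷ ys) j → HeapPath (x ∷ y ∷ ys) j
          raise j<′ (h , c , hb , cb , p) = h , c , hb ,
            (begin
              c + ℓ (nth z (x ∷ y ∷ ys) j) ≡⟨ cong (λ t → c + ℓ t) (nth-tail z x (y ∷ ys) j<′) ⟩
              c + ℓ (nth z (y ∷ ys) j) ≤⟨ cb ⟩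
              2 * s ≤⟨ *-monoʳ-≤ 2 (m≤n+m s (ℓ x)) ⟩
              2 * (ℓ x + s) ∎) ,
            subst₂ (λ u v → Conn (heap z (x ∷ y ∷ ys)) (vx u) (vx v) c h)
              (sym (nth-tail z x (y ∷ ys) j<′)) (sym first) (Conn-⊆ there p)
          climb : HeapPath (y ∷ ys) a → HeapPath (x ∷ y ∷ ys) (length (y ∷ ys))
          climb (h , c , hb , cb , p) = 1 + h , ℓ x + ℓ q + c ,
            (begin
              2 * 2 ^ h ≤⟨ *-monoʳ-≤ 2 hb ⟩
              2 * suc a ≡⟨ lem₁ a ⟩
              suc (suc (a + a)) ≤⟨ s≤s (s≤s (⌊n/2⌋+⌊n/2⌋≤n (length ys))) ⟩
              suc (length (y ∷ ys)) ∎) ,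
            (begin
              ℓ x + ℓ q + c + ℓ (nth z (x ∷ y ∷ ys) (length (y ∷ ys)))
                ≡⟨ cong (λ t → ℓ x + ℓ q + c + ℓ t) (nth-last z x (y ∷ ys)) ⟩
              ℓ x + ℓ q + c + ℓ x ≡⟨ lem₂ (ℓ x) (ℓ q) c ⟩
              2 * ℓ x + (c + ℓ q) ≤⟨ +-monoʳ-≤ (2 * ℓ x) cb ⟩
              2 * ℓ x + 2 * s ≡⟨ sym (*-distribˡ-+ 2 (ℓ x) s) ⟩
              2 * (ℓ x + s) ∎) ,
            subst₂ (λ u v → Conn (heap z (x ∷ y ∷ ys)) (vx u) (vx v) (ℓ x + ℓ q + c) (1 + h))
              (sym (nth-last z x (y ∷ ys))) (sym first)
              (edge (here refl) (le (g (here refl)) (g (there (nth-∈ z (y ∷ ys) (parent-index ys))))) ▸ Conn-⊆ there p)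
            where
              lem₁ : ∀ a → 2 * suc a ≡ suc (suc (a + a))
              lem₁ = solve-∀
              lem₂ : ∀ x q c → x + q + c + x ≡ 2 * x + (c + q)
              lem₂ = solve-∀
          step : j < length (y ∷ ys) ⊎ j ≡ length (y ∷ ys) →
            (∀ j → j < length (y ∷ ys) → HeapPath (y ∷ ys) j) → HeapPath (x ∷ y ∷ ys) j
          step (inj₁ j<′) ih = raise j<′ (ih j j<′)
          step (inj₂ e)   ih = subst (HeapPath (x ∷ y ∷ ys)) (sym e) (climb (ih a (parent-index ys)))

  unique-ind : ∀ {n} (y : Fin n) m (cs : List (Fin n)) → Unique cs → ∑ (λ c → ind (y Fin.≟ c) m) cs ≤ m
  unique-ind y m [] u = z≤n
  unique-ind y m (c ∷ cs) (c∉ ∷ u) with y Fin.≟ c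
  ... | no _     = unique-ind y m cs u
  ... | yes refl = ≤-reflexive (trans (cong (m +_) (zero-sum cs c∉)) (+-identityʳ m))
    where
      zero-sum : ∀ ds → All (λ d → y ≢ d) ds → ∑ (λ d → ind (y Fin.≟ d) m) ds ≡ 0
      zero-sum [] _ = refl
      zero-sum (d ∷ ds) (y≢d ∷ a) = trans (cong (_+ ∑ (λ d → ind (y Fin.≟ d) m) ds) (ind-no (y Fin.≟ d) y≢d m)) (zero-sum ds a)

  ∑-ind-filter : {A : Set} {P : Pred A _} (P? : Decidable P) (m : ℕ) (xs : List A) →
    ∑ (λ x → ind (P? x) m) xs ≡ length (filter P? xs) * m
  ∑-ind-filter P? m [] = refl
  ∑-ind-filter P? m (x ∷ xs) with P? x
  ... | yes _ = cong (m +_) (∑-ind-filter P? m xs)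
  ... | no _  = ∑-ind-filter P? m xs

  unique-↭ : {A : Set} {xs ys : List A} → xs ↭ ys → Unique xs → Unique ys
  unique-↭ {A} p u = PermS.Unique-resp-↭ (setoid A) (↭⇒↭ₛ p) u

  -- Hop structures of clusters, built along the heavy paths of the cluster tree.

  module Clusters {n : ℕ} (𝓢 : Scale n) (o : Fin n)
    (Hb : ℕ) (Hb-spec : ∀ h → 2 ^ h ≤ n * n * n → h ≤ Hb) where

    open Nets 𝓢
    open Hopping 𝓢

    csum : ℕ → X → (X → ℕ) → ℕ
    csum i p g = ∑ (λ x → ind (anc i x Fin.≟ p) (g x)) points

    -- After exchanging the two sums, each point counts for at most one child, because it has a
    -- single ancestor of level `i`.
    csum-children : ∀ i p cs → Unique cs → (∀ {c} → c ∈ cs → Alive i c × anc (suc i) c ≡ p) →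
      ∀ g → ∑ (λ c → csum i c g) cs ≤ csum (suc i) p g
    csum-children i p cs u kid g = begin
      ∑ (λ c → csum i c g) cs ≡⟨ ∑-swap (λ c x → ind (anc i x Fin.≟ c) (g x)) cs points ⟩
      ∑ (λ x → ∑ (λ c → ind (anc i x Fin.≟ c) (g x)) cs) points ≤⟨ ∑-mono points (λ {x} _ → pointwise x (anc (suc i) x Fin.≟ p)) ⟩
      csum (suc i) p g ∎
      where
        open ≤-Reasoning
        pointwise : ∀ x (d : Dec (anc (suc i) x ≡ p)) → ∑ (λ c → ind (anc i x Fin.≟ c) (g x)) cs ≤ ind d (g x)
        pointwise x (yes _) = unique-ind (anc i x) (g x) cs u
        pointwise x (no ¬e) = ≤-trans (∑-≤-const 0 cs (λ {c} c∈ → ≤-reflexive (ind-no (anc i x Fin.≟ c) (λ e →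
          ¬e (trans (trans (cong (π i) e) (cong (π i) (sym (proj₁ (kid c∈))))) (proj₂ (kid c∈)))) (g x)))) (≤-reflexive (*-zeroʳ (length cs)))

    csum-∈ : ∀ i p g {x} → anc i x ≡ p → g x ≤ csum i p g
    csum-∈ i p g {x} e = ≤-trans (≤-reflexive (sym (ind-yes (anc i x Fin.≟ p) e (g x))))
      (∑-∈ (λ x → ind (anc i x Fin.≟ p) (g x)) (∈points x))

    csum-+ : ∀ i p g g′ → csum i p (λ x → g x + g′ x) ≡ csum i p g + csum i p g′
    csum-+ i p g g′ = trans (∑-cong points (λ x → ind-+ (anc i x Fin.≟ p) (g x) (g′ x))) (∑-+ _ _ points)

    csum-≤ : ∀ i p g → csum i p g ≤ ∑ g points
    csum-≤ i p g = ∑-mono points (λ {x} _ → ind-≤ (anc i x Fin.≟ p) (g x))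

    -- A vertex is charged once as a leaf and once for the level of its death.
    tally : (Item → ℕ) → ℕ → X → ℕ
    tally φ zero    x = φ (x , 0)
    tally φ (suc i) x = tally φ i x + ind (dies? i x) (φ (x , suc i))

    csum-tally : ∀ i p cs → Unique cs → (∀ {c} → c ∈ cs → Alive i c × anc (suc i) c ≡ p) → ∀ φ →
      ∑ (λ c → csum i c (tally φ i)) cs ≤ csum (suc i) p (tally φ (suc i))
    csum-tally i p cs u kid φ = ≤-trans (csum-children i p cs u kid (tally φ i))
      (∑-mono points (λ {x} _ → ind-mono (anc (suc i) x Fin.≟ p) (m≤m+n (tally φ i x) _)))

    -- The tallies of the children stop at level `i`, so the contribution of the death of `f` is
    -- still unspent and can finance a new item.
    csum-tally-new : ∀ i p cs → Unique cs → (∀ {c} → c ∈ cs → Alive i c × anc (suc i) c ≡ p) → ∀ φ →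
      ∀ {f} → Dies i f → anc (suc i) f ≡ p →
      ∑ (λ c → csum i c (tally φ i)) cs + φ (f , suc i) ≤ csum (suc i) p (tally φ (suc i))
    csum-tally-new i p cs u kid φ {f} d e = begin
      ∑ (λ c → csum i c (tally φ i)) cs + φ (f , suc i)
        ≤⟨ +-mono-≤ (csum-children i p cs u kid (tally φ i))
             (≤-trans (≤-reflexive (sym (ind-yes (dies? i f) d (φ (f , suc i)))))
                      (csum-∈ (suc i) p (λ x → ind (dies? i x) (φ (x , suc i))) e)) ⟩
      csum (suc i) p (tally φ i) + csum (suc i) p (λ x → ind (dies? i x) (φ (x , suc i)))
        ≡⟨ sym (csum-+ (suc i) p (tally φ i) (λ x → ind (dies? i x) (φ (x , suc i)))) ⟩
      csum (suc i) p (tally φ (suc i)) ∎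
      where open ≤-Reasoning

    z : Item
    z = o , 0

    -- What one item may have to pay: 3 for the heap, 3 for the balanced tree, and at most `Λ` links
    -- to the roots of light children.
    K : ℕ
    K = 6 + Λ

    -- The spine is the heavy path of the cluster, with one item per branching node,
    -- latest first; its weight is the number of points in the light children. The
    -- vertex of the item is the centre of a child that dies there.
    record PreCluster (i : ℕ) (p : X) : Set where
      field
        hd    : Item × ℕ
        tl    : Spine
        edges : List Link

      spine : Spine
      spine = hd ∷ tl

      items : List Item
      items = map proj₁ spine

      W : ℕ
      W = wt spine

      -- The heap is present while the heavy path is still growing. The balanced tree is added by
      -- `close`, once the cluster has become a light child.
      opened : List Link
      opened = edges ++ heap z items

      field
        in-cluster : ∀ {a} → a ∈ items → anc i (vx a) ≡ p
        spine-Le   : ∀ {a b} → a ∈ items → b ∈ items → LeI a b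
        length≤W   : length spine ≤ W
        -- A geometric sum, since the items of a spine have distinct levels. A traversal of the
        -- whole spine thus costs only the scale of the cluster.
        sumℓ       : ∑ⁱ ℓ spine ≤ 8 * B ^ i
        W≤         : W ≤ csum i p (λ _ → 1)
        edges-Le   : ∀ {a b} → (a , b) ∈ edges → LeI a b
        -- Six per spine item are kept in reserve: `opened` spends three on the heap and `close` the
        -- other three on the tree.
        charge     : ∀ φ → ∑ (both φ) edges + 6 * ∑ⁱ φ spine ≤ K * csum i p (tally φ i)
        -- Every point reaches the spine at the item where its light child was attached. The bound
        -- `W * w` telescopes with the tree bound `2 ^ h′ * w ≤ W` to `W * W`.
        attach     : ∀ x → anc i x ≡ p → ∃[ a ] ∃[ w ] ∃[ h ]
                     (a , w) ∈ spine × 2 ^ h ≤ W * w × Conn edges x (vx a) (5 * B ^ i) h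

      W≤n : W ≤ n
      W≤n = ≤-trans W≤ (≤-trans (csum-≤ i p (λ _ → 1)) (≤-reflexive
        (trans (∑-const 1 points) (trans (*-identityʳ _) (length-tabulate id)))))

      opened-Le : ∀ {a b} → (a , b) ∈ opened → LeI a b
      opened-Le p∈ with ∈-++⁻ edges p∈
      ... | inj₁ q = edges-Le q
      ... | inj₂ q = heap-Le (_∈ items) spine-Le z items id q

      opened-charge : ∀ φ → ∑ (both φ) opened + 3 * ∑ⁱ φ spine ≤ K * csum i p (tally φ i)
      opened-charge φ = begin
        ∑ (both φ) opened + 3 * ∑ⁱ φ spine ≡⟨ cong (_+ 3 * ∑ⁱ φ spine) (∑-++ (both φ) edges (heap z items)) ⟩
        ∑ (both φ) edges + ∑ (both φ) (heap z items) + 3 * ∑ⁱ φ spine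
          ≤⟨ +-monoˡ-≤ (3 * ∑ⁱ φ spine) (+-monoʳ-≤ (∑ (both φ) edges) (heap-charge φ z items)) ⟩
        ∑ (both φ) edges + 3 * ∑ φ items + 3 * ∑ⁱ φ spine
          ≡⟨ cong (λ t → ∑ (both φ) edges + 3 * t + 3 * ∑ⁱ φ spine) (∑-map φ proj₁ spine) ⟩
        ∑ (both φ) edges + 3 * ∑ⁱ φ spine + 3 * ∑ⁱ φ spine ≡⟨ lem (∑ (both φ) edges) (∑ⁱ φ spine) ⟩
        ∑ (both φ) edges + 6 * ∑ⁱ φ spine ≤⟨ charge φ ⟩
        K * csum i p (tally φ i) ∎
        where open ≤-Reasoning
              lem : ∀ e s → e + 3 * s + 3 * s ≡ e + 6 * s
              lem = solve-∀

      w≤W : ∀ {a w} → (a , w) ∈ spine → w ≤ W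
      w≤W = ∑-∈ proj₂

      spine-cost : ∀ {c} → c ≤ 2 * ∑ⁱ ℓ spine → 5 * B ^ i + c ≤ 21 * B ^ i
      spine-cost {c} h = begin
        5 * B ^ i + c ≤⟨ +-monoʳ-≤ (5 * B ^ i) (≤-trans h (*-monoʳ-≤ 2 sumℓ)) ⟩
        5 * B ^ i + 2 * (8 * B ^ i) ≡⟨ lem (B ^ i) ⟩
        21 * B ^ i ∎
        where open ≤-Reasoning
              lem : ∀ b → 5 * b + 2 * (8 * b) ≡ 21 * b
              lem = solve-∀

      -- The oldest item is the meeting point. The cost is 5 for reaching the spine plus twice 8 for
      -- the heap, and the hops are bounded by a product of three weights, whence the `n * n * n` in
      -- `Hb-spec`.
      toBottom : ∀ x → anc i x ≡ p → Conn opened x (vx (nth z items 0)) (21 * B ^ i) Hb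
      toBottom x e = go (attach x e)
        where
          open ≤-Reasoning
          go : ∃[ a ] ∃[ w ] ∃[ h ] (a , w) ∈ spine × 2 ^ h ≤ W * w × Conn edges x (vx a) (5 * B ^ i) h →
               Conn opened x (vx (nth z items 0)) (21 * B ^ i) Hb
          go (a , w , h , a∈ , hb , c) = climb (∈-nth z items (∈-map⁺ proj₁ a∈))
            where
              climb : ∃[ j ] j < length items × nth z items j ≡ a → Conn opened x (vx (nth z items 0)) (21 * B ^ i) Hb
              climb (j , j< , e′) = join (heap-path (_∈ items) spine-Le z items id j j<)
                where
                  join : HeapPath (_∈ items) spine-Le z items j → Conn opened x (vx (nth z items 0)) (21 * B ^ i) Hb
                  join (h′ , c′ , hb′ , cb′ , q) = weak (spine-cost (≤-trans (m≤m+n c′ _) (≤-trans cb′ (≤-reflexive (cong (2 *_) (∑-map ℓ proj₁ spine)))))) (Hb-spec (h + h′) hops)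
                    (Conn-⊆ ∈-++⁺ˡ c ▸ subst (λ t → Conn opened (vx t) (vx (nth z items 0)) c′ h′) e′ (Conn-⊆ (∈-++⁺ʳ edges) q))
                    where
                      hops : 2 ^ (h + h′) ≤ n * n * n
                      hops = begin
                        2 ^ (h + h′) ≡⟨ ^-distribˡ-+-* 2 h h′ ⟩
                        2 ^ h * 2 ^ h′ ≤⟨ *-mono-≤ hb (≤-trans hb′ (≤-trans j< (≤-trans (≤-reflexive (length-map proj₁ spine)) length≤W))) ⟩
                        W * w * W ≤⟨ *-mono-≤ (*-mono-≤ W≤n (≤-trans (w≤W a∈) W≤n)) W≤n ⟩
                        n * n * n ∎

      within : ∀ {x y} → anc i x ≡ p → anc i y ≡ p → Conn opened x y (42 * B ^ i) (2 * Hb)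
      within {x} {y} ex ey = weak (≤-reflexive (lem₁ (B ^ i))) (≤-reflexive (lem₂ Hb)) (toBottom x ex ▸ rev (toBottom y ey))
        where lem₁ : ∀ b → 21 * b + 21 * b ≡ 42 * b
              lem₁ = solve-∀
              lem₂ : ∀ b → b + b ≡ 2 * b
              lem₂ = solve-∀

    -- All levels `j` up to `i` are kept, each at its own cost scale, because the final route
    -- between two points stays inside small clusters around its ends. Here 42 is two routes
    -- `toBottom`.
    Within : List Link → ℕ → X → Set
    Within E i p = ∀ j → j ≤ i → ∀ {x y} → anc i x ≡ p → anc j x ≡ anc j y → Conn E x y (42 * B ^ j) (2 * Hb)

    Cluster : ℕ → X → Set
    Cluster i p = Σ[ C ∈ PreCluster i p ] Within (PreCluster.opened C) i p

    record Closed (i : ℕ) (p : X) : Set where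
      field
        W      : ℕ
        root   : Item
        edges  : List Link
        1≤W    : 1 ≤ W
        root-cluster : anc i (vx root) ≡ p
        ℓroot  : ℓ root ≤ 8 * B ^ i
        W≤     : W ≤ csum i p (λ _ → 1)
        edges-Le : ∀ {a b} → (a , b) ∈ edges → LeI a b
        charge : ∀ φ → φ root + ∑ (both φ) edges ≤ K * csum i p (tally φ i)
        reach  : ∀ x → anc i x ≡ p → ∃[ h ] 2 ^ h ≤ W * W × Conn edges x (vx root) (21 * B ^ i) h
        within : Within edges i p

    close : ∀ {i p} → Cluster i p → Closed i p
    close {i} {p} (C , wi) = record
      { W = W ; root = R.root ; edges = opened ++ R.edges
      ; 1≤W = ≤-trans (s≤s z≤n) length≤W
      ; root-cluster = in-cluster R.root∈
      ; ℓroot = ≤-trans (∑-∈ ℓ R.root∈) (≤-trans (≤-reflexive (∑-map ℓ proj₁ spine)) sumℓ)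
      ; W≤ = W≤
      ; edges-Le = λ p∈ → le (∈-++⁻ opened p∈)
      ; charge = closed-charge
      ; reach = λ x e → toRoot x (attach x e)
      ; within = λ j j≤i ex ey → Conn-⊆ ∈-++⁺ˡ (wi j j≤i ex ey)
      }
      where
        open PreCluster C
        open ≤-Reasoning
        module R = Rooted (rooted (_∈ items) spine-Le (suc (length tl)) hd tl ≤-refl (∈-map⁺ proj₁))
        le : ∀ {a b} → (a , b) ∈ opened ⊎ (a , b) ∈ R.edges → LeI a b
        le (inj₁ q) = opened-Le q
        le (inj₂ q) = R.Le-all q
        closed-charge : ∀ φ → φ R.root + ∑ (both φ) (opened ++ R.edges) ≤ K * csum i p (tally φ i)
        closed-charge φ = begin
          φ R.root + ∑ (both φ) (opened ++ R.edges) ≡⟨ cong (φ R.root +_) (∑-++ (both φ) opened R.edges) ⟩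
          φ R.root + (∑ (both φ) opened + ∑ (both φ) R.edges) ≡⟨ lem (φ R.root) (∑ (both φ) opened) (∑ (both φ) R.edges) ⟩
          ∑ (both φ) opened + (∑ (both φ) R.edges + φ R.root) ≤⟨ +-monoʳ-≤ (∑ (both φ) opened) (R.charge φ) ⟩
          ∑ (both φ) opened + 3 * ∑ⁱ φ spine ≤⟨ opened-charge φ ⟩
          K * csum i p (tally φ i) ∎
          where lem : ∀ r o e → r + (o + e) ≡ o + (e + r)
                lem = solve-∀
        toRoot : ∀ x → ∃[ a ] ∃[ w ] ∃[ h ] (a , w) ∈ spine × 2 ^ h ≤ W * w × Conn edges x (vx a) (5 * B ^ i) h →
          ∃[ h ] 2 ^ h ≤ W * W × Conn (opened ++ R.edges) x (vx R.root) (21 * B ^ i) h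
        toRoot x (a , w , h , a∈ , hb , c) = go (R.reach a∈)
          where
            go : ∃[ h′ ] ∃[ c′ ] 2 ^ h′ * w ≤ W × c′ + ℓ R.root ≤ 2 * ∑ⁱ ℓ spine × Conn R.edges (vx a) (vx R.root) c′ h′ →
                 ∃[ h ] 2 ^ h ≤ W * W × Conn (opened ++ R.edges) x (vx R.root) (21 * B ^ i) h
            go (h′ , c′ , hb′ , cb , q) = h + h′ ,
              (begin
                2 ^ (h + h′) ≡⟨ ^-distribˡ-+-* 2 h h′ ⟩
                2 ^ h * 2 ^ h′ ≤⟨ *-monoˡ-≤ (2 ^ h′) hb ⟩
                W * w * 2 ^ h′ ≡⟨ trans (*-assoc W w (2 ^ h′)) (cong (W *_) (*-comm w (2 ^ h′))) ⟩
                W * (2 ^ h′ * w) ≤⟨ *-monoʳ-≤ W hb′ ⟩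
                W * W ∎) ,
              weak (spine-cost (≤-trans (m≤m+n c′ _) cb)) ≤-refl
                (Conn-⊆ (∈-++⁺ˡ ∘ ∈-++⁺ˡ) c ▸ Conn-⊆ (∈-++⁺ʳ opened) q)

    leaf : ∀ x → Cluster 0 x
    leaf x = C , wi
      where
        6≤K : 6 ≤ K
        6≤K = m≤m+n 6 Λ
        refl-Le : LeI (x , 0) (x , 0)
        refl-Le = Le-mono z≤n (Le-refl x)
        open ≤-Reasoning
        C : PreCluster 0 x
        C = record
          { hd = (x , 0) , 1 ; tl = [] ; edges = []
          ; in-cluster = λ { (here refl) → refl }
          ; spine-Le = λ { (here refl) (here refl) → refl-Le }
          ; length≤W = ≤-refl ; sumℓ = m≤m+n 4 4
          ; W≤ = csum-∈ 0 x (λ _ → 1) {x} refl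
          ; edges-Le = λ ()
          ; charge = λ φ → begin
              6 * (φ (x , 0) + 0) ≡⟨ cong (6 *_) (+-identityʳ (φ (x , 0))) ⟩
              6 * φ (x , 0) ≤⟨ *-mono-≤ 6≤K (csum-∈ 0 x (tally φ 0) {x} refl) ⟩
              K * csum 0 x (tally φ 0) ∎
          ; attach = λ y e → (x , 0) , 1 , 0 , here refl , ≤-refl , subst (λ t → Conn [] t x (5 * B ^ 0) 0) (sym e) (weak z≤n ≤-refl nil)
          }
        wi : Within (PreCluster.opened C) 0 x
        wi zero _ {a} ex ey = subst (λ t → Conn [] a t (42 * B ^ 0) (2 * Hb)) ey (weak z≤n z≤n nil)

    within-suc : ∀ i {p} (C : PreCluster (suc i) p) →
      (∀ j → j ≤ i → ∀ {x y} → anc (suc i) x ≡ p → anc j x ≡ anc j y → Conn (PreCluster.opened C) x y (42 * B ^ j) (2 * Hb)) →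
      Within (PreCluster.opened C) (suc i) p
    within-suc i C w j j≤ {x} {y} ex ey with m≤n⇒m<n∨m≡n j≤
    ... | inj₁ j<  = w j (≤-pred j<) ex ey
    ... | inj₂ refl = PreCluster.within C ex (trans (sym ey) ex)

    -- An only child adds no item, which keeps spines as short as the number of branchings, however
    -- many levels there are.
    skip : ∀ i p → Alive (suc i) p → (∀ x → anc (suc i) x ≡ p → anc i x ≡ p) → Cluster i p → Cluster (suc i) p
    skip i p ap only (C , wi) = C′ , within-suc i C′ (λ j j≤ ex ey → wi j j≤ (only _ ex) ey)
      where
        open PreCluster C
        open ≤-Reasoning
        ap′ : Alive i p
        ap′ = alive-pred i ap
        kid : ∀ {c} → c ∈ p ∷ [] → Alive i c × anc (suc i) c ≡ p
        kid (here refl) = ap′ , ap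
        up : ∀ {y} → anc i y ≡ p → anc (suc i) y ≡ p
        up e = trans (cong (π i) (trans e (sym ap′))) ap
        C′ : PreCluster (suc i) p
        C′ = record
          { hd = hd ; tl = tl ; edges = edges
          ; in-cluster = up ∘ in-cluster
          ; spine-Le = spine-Le ; length≤W = length≤W
          ; sumℓ = ≤-trans sumℓ (*B^-step 8 {8} i (m≤m+n 8 248))
          ; W≤ = ≤-trans W≤ (≤-trans (m≤m+n _ 0) (csum-children i p (p ∷ []) ([] ∷ []) kid (λ _ → 1)))
          ; edges-Le = edges-Le
          ; charge = λ φ → ≤-trans (charge φ) (*-monoʳ-≤ K (≤-trans (m≤m+n _ 0) (csum-tally i p (p ∷ []) ([] ∷ []) kid φ)))
          ; attach = λ x e → let (a , w , h , a∈ , hb , c) = attach x (only x e)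
                              in a , w , h , a∈ , hb , weak (*B^-step 5 {5} i (m≤m+n 5 155)) ≤-refl c
          }

    Kid : ℕ → Set
    Kid i = ∃ (Cluster i)

    module Join (i : ℕ) (p f : X) (dies : Dies i f) (ef : anc (suc i) f ≡ p)
      (heavy : Kid i) (light : List (∃ (Closed i)))
      (1≤light : 1 ≤ length light) (light≤Λ : length light ≤ Λ)
      (lighter : ∀ {L} → L ∈ light → Closed.W (proj₂ L) ≤ PreCluster.W (proj₁ (proj₂ heavy)))
      (unique : Unique (proj₁ heavy ∷ map proj₁ light))
      (kid : ∀ {c} → c ∈ proj₁ heavy ∷ map proj₁ light → Alive i c × anc (suc i) c ≡ p)
      (cover : ∀ x → anc (suc i) x ≡ p → anc i x ≡ proj₁ heavy ⊎ (∃[ L ] L ∈ light × anc i x ≡ proj₁ L)) where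

      h : X
      h = proj₁ heavy

      module H = PreCluster (proj₁ (proj₂ heavy))

      -- A vertex dies once, so this is its only item above level 0.
      F : Item
      F = f , suc i

      wl : ∃ (Closed i) → ℕ
      wl L = Closed.W (proj₂ L)

      star : ∃ (Closed i) → List Link
      star (c , L) = (F , Closed.root L) ∷ Closed.edges L

      stars : List Link
      stars = concatMap star light

      w : ℕ
      w = ∑ wl light

      up : ∀ {c y} → c ∈ h ∷ map proj₁ light → anc i y ≡ c → anc (suc i) y ≡ p
      up c∈ e = trans (cong (π i) (trans e (sym (proj₁ (kid c∈))))) (proj₂ (kid c∈))

      F-Le : ∀ {y m} → anc (suc i) y ≡ p → Le f y (ℓ F + m)
      F-Le {y} {m} e = Le-mono (m≤m+n (ℓ F) m) (Le-cluster (suc i) (trans ef (sym e)))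

      star-Le : ∀ {L} → L ∈ light → ∀ {a b} → (a , b) ∈ star L → LeI a b
      star-Le {c , L} L∈ (here refl) = F-Le (up (there (∈-map⁺ proj₁ L∈)) (Closed.root-cluster L))
      star-Le {c , L} L∈ (there q) = Closed.edges-Le L q

      spine-Le : ∀ {a b} → a ∈ F ∷ H.items → b ∈ F ∷ H.items → LeI a b
      spine-Le (here refl) (here refl) = F-Le ef
      spine-Le (here refl) (there q)   = F-Le (up (here refl) (H.in-cluster q))
      spine-Le {a} (there q) (here refl) = subst (Le (vx a) f) (+-comm (ℓ F) (ℓ a)) (Le-sym (F-Le (up (here refl) (H.in-cluster q))))
      spine-Le (there q) (there r)     = H.spine-Le q r

      open ≤-Reasoning

      -- The death of `f` provides `K * φ F`: 6 go into the reserve of the new item and `Λ` pay its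
      -- ends of the star links. The other ends are prepaid by the `φ root` in `Closed.charge`.
      charge : ∀ φ → ∑ (both φ) (H.edges ++ stars) + 6 * (φ F + ∑ⁱ φ H.spine) ≤ K * csum (suc i) p (tally φ (suc i))
      charge φ = begin
        ∑ (both φ) (H.edges ++ stars) + 6 * (φ F + s)
          ≡⟨ cong (_+ 6 * (φ F + s)) (∑-++ (both φ) H.edges stars) ⟩
        ∑ (both φ) H.edges + ∑ (both φ) stars + 6 * (φ F + s)
          ≤⟨ +-monoˡ-≤ (6 * (φ F + s)) (+-monoʳ-≤ (∑ (both φ) H.edges) stars≤) ⟩
        ∑ (both φ) H.edges + (Λ * φ F + K * S) + 6 * (φ F + s) ≡⟨ lem₁ (∑ (both φ) H.edges) Λ (φ F) (K * S) s ⟩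
        (∑ (both φ) H.edges + 6 * s) + (K * S + (6 + Λ) * φ F) ≤⟨ +-monoˡ-≤ (K * S + K * φ F) (H.charge φ) ⟩
        K * csum i h (tally φ i) + (K * S + K * φ F) ≡⟨ lem₂ K (csum i h (tally φ i)) S (φ F) ⟩
        K * (csum i h (tally φ i) + S + φ F) ≤⟨ *-monoʳ-≤ K (csum-tally-new i p (h ∷ map proj₁ light) unique kid φ dies ef) ⟩
        K * csum (suc i) p (tally φ (suc i)) ∎
        where
          s = ∑ⁱ φ H.spine
          S = ∑ (λ c → csum i c (tally φ i)) (map proj₁ light)
          lem₁ : ∀ e l f k s → e + (l * f + k) + 6 * (f + s) ≡ (e + 6 * s) + (k + (6 + l) * f)
          lem₁ = solve-∀
          lem₂ : ∀ k a s f → k * a + (k * s + k * f) ≡ k * (a + s + f)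
          lem₂ = solve-∀
          one : ∀ (L : ∃ (Closed i)) → ∑ (both φ) (star L) ≤ φ F + K * csum i (proj₁ L) (tally φ i)
          one (c , L) = ≤-trans (≤-reflexive (+-assoc (φ F) _ _)) (+-monoʳ-≤ (φ F) (Closed.charge L φ))
          stars≤ : ∑ (both φ) stars ≤ Λ * φ F + K * S
          stars≤ = begin
            ∑ (both φ) stars ≡⟨ ∑-concatMap (both φ) star light ⟩
            ∑ (λ L → ∑ (both φ) (star L)) light ≤⟨ ∑-mono light (λ {L} _ → one L) ⟩
            ∑ (λ L → φ F + K * csum i (proj₁ L) (tally φ i)) light ≡⟨ ∑-+ (λ _ → φ F) (λ L → K * csum i (proj₁ L) (tally φ i)) light ⟩
            ∑ (λ _ → φ F) light + ∑ (λ L → K * csum i (proj₁ L) (tally φ i)) light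
              ≡⟨ cong₂ _+_ (∑-const (φ F) light) (trans (∑-* K (λ L → csum i (proj₁ L) (tally φ i)) light)
                   (cong (K *_) (sym (∑-map (λ c → csum i c (tally φ i)) proj₁ light)))) ⟩
            length light * φ F + K * S ≤⟨ +-monoˡ-≤ (K * S) (*-monoˡ-≤ (φ F) light≤Λ) ⟩
            Λ * φ F + K * S ∎

      sumℓ : ℓ F + ∑ⁱ ℓ H.spine ≤ 8 * B ^ suc i
      sumℓ = begin
        4 * B ^ suc i + ∑ⁱ ℓ H.spine ≤⟨ +-monoʳ-≤ (4 * B ^ suc i) (≤-trans H.sumℓ (*B^-step 8 {4} i (m≤m+n 8 120))) ⟩
        4 * B ^ suc i + 4 * B ^ suc i ≡⟨ sym (*-distribʳ-+ (B ^ suc i) 4 4) ⟩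
        8 * B ^ suc i ∎

      1≤w : 1 ≤ w
      1≤w = begin
        1 ≤⟨ 1≤light ⟩
        length light ≡⟨ sym (trans (∑-const 1 light) (*-identityʳ _)) ⟩
        ∑ (λ _ → 1) light ≤⟨ ∑-mono light (λ {L} _ → Closed.1≤W (proj₂ L)) ⟩
        w ∎

      W≤ : w + H.W ≤ csum (suc i) p (λ _ → 1)
      W≤ = begin
        w + H.W ≤⟨ +-mono-≤ (∑-mono light (λ {L} _ → Closed.W≤ (proj₂ L))) H.W≤ ⟩
        ∑ (λ L → csum i (proj₁ L) (λ _ → 1)) light + csum i h (λ _ → 1)
          ≡⟨ cong (_+ csum i h (λ _ → 1)) (sym (∑-map (λ c → csum i c (λ _ → 1)) proj₁ light)) ⟩
        ∑ (λ c → csum i c (λ _ → 1)) (map proj₁ light) + csum i h (λ _ → 1) ≡⟨ +-comm _ (csum i h (λ _ → 1)) ⟩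
        csum i h (λ _ → 1) + ∑ (λ c → csum i c (λ _ → 1)) (map proj₁ light)
          ≤⟨ csum-children i p (h ∷ map proj₁ light) unique kid (λ _ → 1) ⟩
        csum (suc i) p (λ _ → 1) ∎

      Attached : X → Set
      Attached x = ∃[ a ] ∃[ w′ ] ∃[ e ] (a , w′) ∈ (F , w) ∷ H.spine × 2 ^ e ≤ (w + H.W) * w′ ×
                   Conn (H.edges ++ stars) x (vx a) (5 * B ^ suc i) e

      attach : ∀ x → anc i x ≡ h ⊎ (∃[ L ] L ∈ light × anc i x ≡ proj₁ L) → Attached x
      attach x (inj₁ e) with H.attach x e
      ... | a , w′ , k , a∈ , hb , c = a , w′ , k , there a∈ , ≤-trans hb (*-monoˡ-≤ w′ (m≤n+m H.W w)) ,
            weak (*B^-step 5 {5} i (m≤m+n 5 155)) ≤-refl (Conn-⊆ ∈-++⁺ˡ c)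
      attach x (inj₂ ((c , L) , L∈ , e)) with Closed.reach L x e
      ... | k , hb , q = F , w , k + 1 , here refl , hops , weak cost ≤-refl
            (Conn-⊆ (λ r → ∈-++⁺ʳ H.edges (∈-concatMap star L∈ (there r))) q ▸
             rev (edge (∈-++⁺ʳ H.edges (∈-concatMap star L∈ (here refl))) (star-Le L∈ (here refl))))
        where
          WL = Closed.W L
          WL≤w : WL ≤ w
          WL≤w = ∑-∈ wl L∈
          -- The extra hop doubles `WL * WL`. One copy of `WL` is at most `w`, and the other is at
          -- most `H.W` because the child is light.
          hops : 2 ^ (k + 1) ≤ (w + H.W) * w
          hops = begin
            2 ^ (k + 1) ≡⟨ ^-distribˡ-+-* 2 k 1 ⟩
            2 ^ k * 2 ≤⟨ *-monoˡ-≤ 2 hb ⟩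
            WL * WL * 2 ≡⟨ lem WL ⟩
            (WL + WL) * WL ≤⟨ *-mono-≤ (+-mono-≤ WL≤w (lighter L∈)) WL≤w ⟩
            (w + H.W) * w ∎
            where lem : ∀ a → a * a * 2 ≡ (a + a) * a
                  lem = solve-∀
          -- The 29 units of scale `B ^ i` vanish into a single `B ^ suc i`; this is where `B` has
          -- to be at least 29.
          cost : 21 * B ^ i + (ℓ F + ℓ (Closed.root L)) ≤ 5 * B ^ suc i
          cost = begin
            21 * B ^ i + (ℓ F + ℓ (Closed.root L)) ≤⟨ +-monoʳ-≤ (21 * B ^ i) (+-monoʳ-≤ (ℓ F) (Closed.ℓroot L)) ⟩
            21 * B ^ i + (4 * B ^ suc i + 8 * B ^ i) ≡⟨ lem (B ^ i) (B ^ suc i) ⟩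
            29 * B ^ i + 4 * B ^ suc i ≤⟨ +-monoˡ-≤ (4 * B ^ suc i) (*B^-step 29 {1} i (m≤m+n 29 3)) ⟩
            1 * B ^ suc i + 4 * B ^ suc i ≡⟨ sym (*-distribʳ-+ (B ^ suc i) 1 4) ⟩
            5 * B ^ suc i ∎
            where lem : ∀ b c → 21 * b + (4 * c + 8 * b) ≡ 29 * b + 4 * c
                  lem = solve-∀

      in-cluster : ∀ {a} → a ∈ F ∷ H.items → anc (suc i) (vx a) ≡ p
      in-cluster (here refl) = ef
      in-cluster (there q)   = up (here refl) (H.in-cluster q)

      edges-Le : ∀ {a b} → (a , b) ∈ H.edges ++ stars → LeI a b
      edges-Le q with ∈-++⁻ H.edges q
      ... | inj₁ r = H.edges-Le r
      ... | inj₂ r with ∈-concatMap⁻ star light r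
      ...   | L , L∈ , s = star-Le L∈ s

      joined : PreCluster (suc i) p
      joined = record
        { hd = F , w ; tl = H.spine ; edges = H.edges ++ stars
        ; in-cluster = in-cluster ; spine-Le = spine-Le
        ; length≤W = +-mono-≤ 1≤w H.length≤W
        ; sumℓ = sumℓ ; W≤ = W≤ ; edges-Le = edges-Le ; charge = charge
        ; attach = λ x e → attach x (cover x e)
        }

      open PreCluster joined using (opened)

      heavy-⊆ : ∀ {e} → e ∈ H.opened → e ∈ opened
      heavy-⊆ e∈ with ∈-++⁻ H.edges e∈
      ... | inj₁ q = ∈-++⁺ˡ (∈-++⁺ˡ q)
      ... | inj₂ q = ∈-++⁺ʳ (H.edges ++ stars) (there q)

      deep : ∀ j → j ≤ i → ∀ {x y} → anc i x ≡ h ⊎ (∃[ L ] L ∈ light × anc i x ≡ proj₁ L) → anc j x ≡ anc j y →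
        Conn opened x y (42 * B ^ j) (2 * Hb)
      deep j j≤ (inj₁ e) ey = Conn-⊆ heavy-⊆ (proj₂ (proj₂ heavy) j j≤ e ey)
      deep j j≤ (inj₂ ((c , L) , L∈ , e)) ey =
        Conn-⊆ (λ q → ∈-++⁺ˡ (∈-++⁺ʳ H.edges (∈-concatMap star L∈ (there q)))) (Closed.within L j j≤ e ey)

      join : Cluster (suc i) p
      join = joined , within-suc i joined (λ j j≤ ex ey → deep j j≤ (cover _ ex) ey)

    module Build (i : ℕ) (cluster : ∀ c → Alive i c → Cluster i c) (p : X) (ap : Alive (suc i) p) where

      kid? : ∀ c → Dec (Alive i c × anc (suc i) c ≡ p)
      kid? c = alive? i c ×-dec (anc (suc i) c Fin.≟ p)

      centres : List X
      centres = filter kid? points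

      ∈centres : ∀ {c} → Alive i c → anc (suc i) c ≡ p → c ∈ centres
      ∈centres a e = ∈-filter⁺ kid? (∈points _) (a , e)

      centres-∈ : ∀ {c} → c ∈ centres → Alive i c × anc (suc i) c ≡ p
      centres-∈ = proj₂ ∘ ∈-filter⁻ kid? {xs = points}

      centres-unique : Unique centres
      centres-unique = Unique.filter⁺ kid? (Unique.allFin⁺ n)

      centres≤Λ : length centres ≤ Λ
      centres≤Λ = packing i p centres centres-unique
        (λ {c} c∈ → Le-mono (*B^-step 2 {2} (suc i) (m≤m+n 2 62))
          (Le-sym (subst (λ t → Le c t (2 * B ^ suc i)) (proj₂ (centres-∈ c∈)) (Le-anc (suc i) c))))
        (λ c∈ c′∈ → alive-sep i (proj₁ (centres-∈ c∈)) (proj₁ (centres-∈ c′∈)))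

      kids : ∀ cs → (∀ {c} → c ∈ cs → Alive i c) → List (Kid i)
      kids []       a = []
      kids (c ∷ cs) a = (c , cluster c (a (here refl))) ∷ kids cs (a ∘ there)

      map-kids : ∀ cs (a : ∀ {c} → c ∈ cs → Alive i c) → map proj₁ (kids cs a) ≡ cs
      map-kids []       a = refl
      map-kids (c ∷ cs) a = cong (c ∷_) (map-kids cs (a ∘ there))

      ks : List (Kid i)
      ks = kids centres (proj₁ ∘ centres-∈)

      weightOf : Kid i → ℕ
      weightOf k = PreCluster.W (proj₁ (proj₂ k))

      closeKid : Kid i → ∃ (Closed i)
      closeKid (c , C) = c , close C

      module _ (m : Kid i) (rest : List (Kid i)) (perm : ks ↭ m ∷ rest) (max : All (λ k → weightOf k ≤ weightOf m) rest) where

        perm′ : centres ↭ map proj₁ (m ∷ rest)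
        perm′ = subst (_↭ map proj₁ (m ∷ rest)) (map-kids centres _) (map⁺ proj₁ perm)

        unique : Unique (map proj₁ (m ∷ rest))
        unique = unique-↭ perm′ centres-unique

        kid : ∀ {c} → c ∈ map proj₁ (m ∷ rest) → Alive i c × anc (suc i) c ≡ p
        kid c∈ = centres-∈ (∈-resp-↭ (↭-sym perm′) c∈)

        ∈kids : ∀ {c} → Alive i c → anc (suc i) c ≡ p → c ∈ map proj₁ (m ∷ rest)
        ∈kids a e = ∈-resp-↭ perm′ (∈centres a e)

        length-rest : length rest ≤ Λ
        length-rest = ≤-trans (n≤1+n _) (≤-trans (≤-reflexive
          (trans (sym (length-map proj₁ (m ∷ rest))) (sym (↭-length perm′)))) centres≤Λ)

        light : List (∃ (Closed i))
        light = map closeKid rest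

        map-light : map proj₁ light ≡ map proj₁ rest
        map-light = sym (map-∘ rest)

        cover : ∀ x → anc (suc i) x ≡ p → anc i x ≡ proj₁ m ⊎ (∃[ L ] L ∈ light × anc i x ≡ proj₁ L)
        cover x e with ∈kids (alive-anc i x) (trans (anc-anc i x) e)
        ... | here e′ = inj₁ e′
        ... | there q with ∈-map⁻ proj₁ q
        ...   | k , k∈ , e′ = inj₂ (closeKid k , ∈-map⁺ closeKid k∈ , e′)

        lighter : ∀ {L} → L ∈ light → Closed.W (proj₂ L) ≤ weightOf m
        lighter L∈ with ∈-map⁻ closeKid L∈
        ... | k , k∈ , refl = All.lookup max k∈

        joinAt : ∀ f → f ∈ map proj₁ (m ∷ rest) → f ≢ p → 1 ≤ length rest → Cluster (suc i) p
        joinAt f f∈ f≢p 1≤ = Join.join i p f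
          (proj₁ (kid f∈) , λ a → f≢p (trans (sym a) (proj₂ (kid f∈)))) (proj₂ (kid f∈))
          m light (≤-trans 1≤ (≤-reflexive (sym (length-map closeKid rest))))
          (≤-trans (≤-reflexive (length-map closeKid rest)) length-rest)
          lighter (subst (λ t → Unique (proj₁ m ∷ t)) (sym map-light) unique)
          (λ c∈ → kid (subst (λ t → _ ∈ proj₁ m ∷ t) map-light c∈)) cover

      -- A child whose centre is not `p` dies at this level and can lend its vertex. If the heavy
      -- child is centred at `p`, any light one serves. A single child is centred at `p` itself,
      -- since `p` is its own ancestor.
      fresh : ∀ m rest → ks ↭ m ∷ rest → All (λ k → weightOf k ≤ weightOf m) rest → Cluster (suc i) p
      fresh m [] perm max = skip i p ap (λ x e → trans (only x e) m≡p) (subst (Cluster i) m≡p (proj₂ m))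
        where
          only : ∀ x → anc (suc i) x ≡ p → anc i x ≡ proj₁ m
          only x e with cover m [] perm max x e
          ... | inj₁ e′ = e′
          m≡p : proj₁ m ≡ p
          m≡p = trans (sym (only p ap)) (alive-pred i ap)
      fresh m (r ∷ rs) perm max with proj₁ m Fin.≟ p
      ... | no m≢p = joinAt m (r ∷ rs) perm max (proj₁ m) (here refl) m≢p (s≤s z≤n)
      ... | yes m≡p = joinAt m (r ∷ rs) perm max (proj₁ r) (there (here refl)) (λ r≡p → distinct (unique m (r ∷ rs) perm max) (trans m≡p (sym r≡p))) (s≤s z≤n)
        where distinct : ∀ {a b} {cs : List X} → Unique (a ∷ b ∷ cs) → a ≢ b
              distinct ((a≢b ∷ _) ∷ _) = a≢b

      build : Cluster (suc i) p
      build = go ks refl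
        where
          go : ∀ ls → ls ≡ ks → Cluster (suc i) p
          go [] e = ⊥-elim (empty (subst (p ∈_) (sym (trans (cong (map proj₁) e) (map-kids centres _))) (∈centres (alive-pred i ap) ap)))
            where empty : p ∈ [] → ⊥
                  empty ()
          go (k ∷ ls) e with pickMax weightOf k ls
          ... | m , rest , perm , max = fresh m rest (subst (_↭ m ∷ rest) e perm) max

    cluster : ∀ i p → Alive i p → Cluster i p
    cluster zero    p a = leaf p
    cluster (suc i) p a = Build.build i (cluster i) p a

  -- The union of the fault-tolerant edges and the hop links.

  module Construction {n : ℕ} (𝓢 : Scale n) (o : Fin n) (k : ℕ)
    (Hb : ℕ) (Hb-spec : ∀ h → 2 ^ h ≤ n * n * n → h ≤ Hb) where

    open Nets 𝓢
    open FaultTolerance 𝓢 k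
    open Hopping 𝓢
    open Clusters 𝓢 o Hb Hb-spec

    r : X
    r = anc top o

    anc-top : ∀ x → anc top x ≡ r
    anc-top x = alive-sep top (alive-anc top x) (alive-anc top o) (Le-top _ _)

    whole : Cluster top r
    whole = cluster top r (alive-anc top o)

    open PreCluster (proj₁ whole) public using (opened; opened-Le; opened-charge)

    toEdge : Link → Edge
    toEdge (a , b) = vx a , vx b , ℓ a + ℓ b

    edges : List Edge
    edges = ftEdges ++ map toEdge opened

    edges-Le : ∀ {x y m} → (x , y , m) ∈ edges → Le x y m
    edges-Le e∈ with ∈-++⁻ ftEdges e∈
    ... | inj₁ q = ftEdges-Le q
    ... | inj₂ q with ∈-map⁻ toEdge q
    ...   | (a , b) , l∈ , refl = opened-Le l∈

    Linked-⊆ : ∀ {E E′} → (∀ {e} → e ∈ E → e ∈ E′) → ∀ {x y} → Linked E x y → Linked E′ x y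
    Linked-⊆ f (m , inj₁ p) = m , inj₁ (f p)
    Linked-⊆ f (m , inj₂ p) = m , inj₂ (f p)

    opened-total : ∀ φ → ∑ (both φ) opened ≤ K * ∑ (tally φ top) points
    opened-total φ = ≤-trans (≤-trans (m≤m+n _ _) (opened-charge φ)) (*-monoʳ-≤ K (csum-≤ top r (tally φ top)))

    -- The leaves give `4 * n`. A death at level `i` gives an item of level `suc i`, hence the
    -- additional factor `B`.
    tally-ℓ : ∀ i → ∑ (tally ℓ i) points ≡ n * 4 + 4 * B * ΦUpTo i
    tally-ℓ zero = trans (∑-const 4 points) (trans (cong (_* 4) (length-tabulate {n = n} id))
      (sym (trans (cong (n * 4 +_) (*-zeroʳ (4 * B))) (+-identityʳ _))))
    tally-ℓ (suc i) = begin
      ∑ (tally ℓ (suc i)) points ≡⟨ ∑-+ (tally ℓ i) (λ x → ind (dies? i x) (4 * B ^ suc i)) points ⟩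
      ∑ (tally ℓ i) points + ∑ (λ x → ind (dies? i x) (4 * B ^ suc i)) points
        ≡⟨ cong₂ _+_ (tally-ℓ i) (∑-ind-filter (dies? i) (4 * B ^ suc i) points) ⟩
      n * 4 + 4 * B * ΦUpTo i + length (dying i) * (4 * (B * B ^ i)) ≡⟨ lem (n * 4) B (ΦUpTo i) (length (dying i)) (B ^ i) ⟩
      n * 4 + 4 * B * ΦUpTo (suc i) ∎
      where open ≡-Reasoning
            lem : ∀ n b f d p → n + 4 * b * f + d * (4 * (b * p)) ≡ n + 4 * b * (d * p + f)
            lem = solve-∀

    edges-weight : ∑ len edges ≤ 9 * (B * B) * (Λ * (suc k * suc k)) * Φ + K * (n * 4 + 4 * B * Φ)
    edges-weight = begin
      ∑ len edges ≡⟨ ∑-++ len ftEdges (map toEdge opened) ⟩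
      ∑ len ftEdges + ∑ len (map toEdge opened) ≡⟨ cong (∑ len ftEdges +_) (∑-map len toEdge opened) ⟩
      ∑ len ftEdges + ∑ (both ℓ) opened ≤⟨ +-mono-≤ ftWeight (opened-total ℓ) ⟩
      9 * (B * B) * (Λ * (suc k * suc k)) * Φ + K * ∑ (tally ℓ top) points
        ≡⟨ cong (λ t → 9 * (B * B) * (Λ * (suc k * suc k)) * Φ + K * t) (tally-ℓ top) ⟩
      9 * (B * B) * (Λ * (suc k * suc k)) * Φ + K * (n * 4 + 4 * B * Φ) ∎
      where open ≤-Reasoning

    module _ (v : X) where

      -- The second instance of `φ`: `both at-v` counts how often `v` is an end of a link, so the
      -- charge bound becomes a degree bound.
      at-v : Item → ℕ
      at-v a = ind (vx a Fin.≟ v) 1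

      dead : ∀ {P : Set} → Dec P → ℕ
      dead (yes _) = 0
      dead (no _)  = 1

      -- Once for the leaf, and once more only after the death of `v`; recording whether it has
      -- happened makes the induction go through.
      tally-v : ∀ i x → tally at-v i x ≤ ind (x Fin.≟ v) (1 + dead (alive? i x))
      tally-v zero x = ind-mono (x Fin.≟ v) (m≤m+n 1 _)
      tally-v (suc i) x = ≤-trans (+-monoˡ-≤ _ (tally-v i x)) (step (x Fin.≟ v) (alive? i x) (alive? (suc i) x))
        where
          step : ∀ (e : Dec (x ≡ v)) (a : Dec (Alive i x)) (a′ : Dec (Alive (suc i) x)) →
            ind e (1 + dead a) + ind (a ×-dec ¬? a′) (ind e 1) ≤ ind e (1 + dead a′)
          step (no _)  (yes _) (yes _)  = z≤n
          step (no _)  (yes _) (no _)   = z≤n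
          step (no _)  (no _)  (yes _)  = z≤n
          step (no _)  (no _)  (no _)   = z≤n
          step (yes _) (yes _) (yes _)  = ≤-refl
          step (yes _) (yes _) (no _)   = ≤-refl
          step (yes _) (no ¬a) (yes a′) = ⊥-elim (¬a (alive-pred i a′))
          step (yes _) (no _)  (no _)   = ≤-refl

      incident : ∑ (both at-v) opened ≤ K * 2
      incident = ≤-trans (opened-total at-v) (*-monoʳ-≤ K (begin
        ∑ (tally at-v top) points ≤⟨ ∑-mono points (λ {x} _ → ≤-trans (tally-v top x) (ind-mono (x Fin.≟ v) (s≤s (dead≤1 (alive? top x))))) ⟩
        ∑ (λ x → ind (x Fin.≟ v) 2) points ≡⟨ ∑-cong points (λ x → flip (x Fin.≟ v) (v Fin.≟ x)) ⟩
        ∑ (λ x → ind (v Fin.≟ x) 2) points ≤⟨ unique-ind v 2 points (Unique.allFin⁺ n) ⟩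
        2 ∎))
        where
          open ≤-Reasoning
          dead≤1 : ∀ {P : Set} (d : Dec P) → dead d ≤ 1
          dead≤1 (yes _) = z≤n
          dead≤1 (no _)  = ≤-refl
          flip : ∀ {x} (d : Dec (x ≡ v)) (d′ : Dec (v ≡ x)) → ind d 2 ≡ ind d′ 2
          flip (yes _) (yes _) = refl
          flip (yes e) (no ¬e) = ⊥-elim (¬e (sym e))
          flip (no ¬e) (yes e) = ⊥-elim (¬e (sym e))
          flip (no _)  (no _)  = refl

      other : ∀ {a : X} → Dec (a ≡ v) → X → List X
      other (yes _) y = y ∷ []
      other (no _)  y = []

      others : Link → List X
      others (a , b) = other (vx a Fin.≟ v) (vx b) ++ other (vx b Fin.≟ v) (vx a)

      length-other : ∀ {a : X} (d : Dec (a ≡ v)) y → length (other d y) ≡ ind d 1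
      length-other (yes _) y = refl
      length-other (no _)  y = refl

      ∈other : ∀ {a : X} (d : Dec (a ≡ v)) → a ≡ v → ∀ y → y ∈ other d y
      ∈other (yes _) e y = here refl
      ∈other (no ¬e) e y = ⊥-elim (¬e e)

      open Neighbours v using (neighbours; neighbours-bound; ∈neighbours)

      around : List X
      around = neighbours ++ concatMap others opened

      around-bound : length around ≤ 6 * suc k * (Λ * suc k) + K * 2
      around-bound = ≤-trans (≤-reflexive (length-++ neighbours)) (+-mono-≤ neighbours-bound (begin
        length (concatMap others opened) ≡⟨ length-concatMap others opened ⟩
        ∑ (length ∘ others) opened ≡⟨ ∑-cong opened (λ (a , b) → trans (length-++ (other (vx a Fin.≟ v) (vx b)))
            (cong₂ _+_ (length-other (vx a Fin.≟ v) (vx b)) (length-other (vx b Fin.≟ v) (vx a)))) ⟩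
        ∑ (both at-v) opened ≤⟨ incident ⟩
        K * 2 ∎))
        where open ≤-Reasoning

      private
        hop-around : ∀ {x y m} → (x , y , m) ∈ map toEdge opened → (x ≡ v → y ∈ concatMap others opened) × (y ≡ v → x ∈ concatMap others opened)
        hop-around e∈ with ∈-map⁻ toEdge e∈
        ... | (a , b) , l∈ , refl =
          (λ e → ∈-concatMap others l∈ (∈-++⁺ˡ (∈other (vx a Fin.≟ v) e (vx b)))) ,
          (λ e → ∈-concatMap others l∈ (∈-++⁺ʳ (other (vx a Fin.≟ v) (vx b)) (∈other (vx b Fin.≟ v) e (vx a))))

      ∈around : ∀ {y} → Linked edges v y → y ∈ around
      ∈around (m , inj₁ p) with ∈-++⁻ ftEdges p
      ... | inj₁ q = ∈-++⁺ˡ (∈neighbours (m , inj₁ q))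
      ... | inj₂ q = ∈-++⁺ʳ neighbours (proj₁ (hop-around q) refl)
      ∈around (m , inj₂ p) with ∈-++⁻ ftEdges p
      ... | inj₁ q = ∈-++⁺ˡ (∈neighbours (m , inj₂ q))
      ... | inj₂ q = ∈-++⁺ʳ neighbours (proj₂ (hop-around q) refl)

    bridge : ∀ (S : Subset n) → ∣ S ∣ ≤ k → ∀ i {x y} → x ∉ˢ S → y ∉ˢ S →
      ¬ Le x y (B ^ suc i) → Le x y (B ^ (2 + i)) →
      Bridged edges S i x y
    bridge S S≤k i x∉ y∉ far near with ftEdges-bridge S S≤k i x∉ y∉ far near
    ... | x′ , y′ , a , b , c , d , l = x′ , y′ , a , b , c , d , Linked-⊆ ∈-++⁺ˡ l

    hop-within : ∀ j → j ≤ top → ∀ {x y} → anc j x ≡ anc j y → Conn opened x y (42 * B ^ j) (2 * Hb)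
    hop-within j j≤ e = proj₂ whole j j≤ (anc-top _) e

    opened-linked : ∀ {a b} → (a , b) ∈ opened → Linked edges (vx a) (vx b)
    opened-linked {a} {b} l∈ = ℓ a + ℓ b , inj₁ (∈-++⁺ʳ ftEdges (∈-map⁺ toEdge l∈))

open Combinatorics

-- Arithmetic of a complete ordered field, real powers and logarithms.

module OrderedField (𝓡 : CompleteOrderedField) where

  open CompleteOrderedField 𝓡 renaming (Carrier to ℝ) public
  open CommutativeRing commutativeRing public
    using (+-assoc; +-comm; +-identityˡ; +-identityʳ; *-assoc; *-comm; *-identityˡ; *-identityʳ;
           distribˡ; distribʳ; zeroˡ; zeroʳ; -‿inverseˡ; -‿inverseʳ; semiring; commutativeSemiring)
  open IsDecTotalOrder isDecTotalOrder public using (_≟_) renaming (refl to ≤-refl; reflexive to ≤-reflexive; trans to ≤-trans; antisym to ≤-antisym; total to ≤-total)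
  open SemiringSolver commutativeSemiring public using (solve; _:=_; _:+_; _:*_; con)
  open RingProperties (CommutativeRing.ring commutativeRing) public using (-‿involutive; -‿distribˡ-*)
  open Mult semiring public using (×-homo-+; ×1-homo-*)
  open Exp semiring public using (^-homo-*; ^-assocʳ)
  open CommExp commutativeSemiring public using (^-distrib-*)

  <⇒≤ : ∀ {a b} → a < b → a ≤ b
  <⇒≤ = proj₁

  ≰⇒> : ∀ {a b} → ¬ a ≤ b → b < a
  ≰⇒> {a} {b} a≰b with ≤-total a b
  ... | inj₁ a≤b = ⊥-elim (a≰b a≤b)
  ... | inj₂ b≤a = b≤a , λ e → a≰b (≤-reflexive (sym e))

  <⇒≱ : ∀ {a b} → a < b → ¬ b ≤ a
  <⇒≱ (a≤b , a≢b) b≤a = a≢b (≤-antisym a≤b b≤a)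

  ≤-by-contradiction : ∀ {a b} → (b < a → a ≤ b) → a ≤ b
  ≤-by-contradiction {a} {b} f with a ≤? b
  ... | yes a≤b = a≤b
  ... | no a≰b  = f (≰⇒> a≰b)

  +-monoˡ-≤ : ∀ c {a b} → a ≤ b → a + c ≤ b + c
  +-monoˡ-≤ c {a} {b} h = subst₂ _≤_ (+-comm c a) (+-comm c b) (+-monoʳ-≤ c h)

  +-mono-≤ : ∀ {a b c d} → a ≤ b → c ≤ d → a + c ≤ b + d
  +-mono-≤ {b = b} {c = c} h h′ = ≤-trans (+-monoˡ-≤ c h) (+-monoʳ-≤ b h′)

  +-cancelˡ-≤ : ∀ c {a b} → c + a ≤ c + b → a ≤ b
  +-cancelˡ-≤ c {a} {b} h = subst₂ _≤_ (lem a) (lem b) (+-monoʳ-≤ (- c) h)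
    where lem : ∀ x → - c + (c + x) ≡ x
          lem x = trans (sym (+-assoc (- c) c x)) (trans (cong (_+ x) (-‿inverseˡ c)) (+-identityˡ x))

  +-cancelʳ-≤ : ∀ c {a b} → a + c ≤ b + c → a ≤ b
  +-cancelʳ-≤ c {a} {b} h = +-cancelˡ-≤ c (subst₂ _≤_ (+-comm a c) (+-comm b c) h)

  x≤x+y : ∀ x {y} → 0# ≤ y → x ≤ x + y
  x≤x+y x {y} h = subst (_≤ x + y) (+-identityʳ x) (+-monoʳ-≤ x h)

  +-nonNegative : ∀ {x y} → 0# ≤ x → 0# ≤ y → 0# ≤ x + y
  +-nonNegative h h′ = ≤-trans h (x≤x+y _ h′)

  *-monoʳ-≤ : ∀ {c} → 0# ≤ c → ∀ {a b} → a ≤ b → c * a ≤ c * b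
  *-monoʳ-≤ {c} 0≤c {a} {b} h = subst₂ _≤_ (+-identityˡ (c * a)) e (+-monoˡ-≤ (c * a) (*-nonNegative 0≤c 0≤b-a))
    where
      0≤b-a : 0# ≤ b + - a
      0≤b-a = subst (_≤ b + - a) (-‿inverseʳ a) (+-monoˡ-≤ (- a) h)
      e : c * (b + - a) + c * a ≡ c * b
      e = trans (sym (distribˡ c (b + - a) a)) (cong (c *_)
            (trans (+-assoc b (- a) a) (trans (cong (b +_) (-‿inverseˡ a)) (+-identityʳ b))))

  *-monoˡ-≤ : ∀ {c} → 0# ≤ c → ∀ {a b} → a ≤ b → a * c ≤ b * c
  *-monoˡ-≤ {c} h {a} {b} h′ = subst₂ _≤_ (*-comm c a) (*-comm c b) (*-monoʳ-≤ h h′)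

  *-mono-≤ : ∀ {a b c d} → 0# ≤ a → 0# ≤ d → a ≤ b → c ≤ d → a * c ≤ b * d
  *-mono-≤ 0≤a 0≤d h h′ = ≤-trans (*-monoʳ-≤ 0≤a h′) (*-monoˡ-≤ 0≤d h)

  0<⇒≢0 : ∀ {x} → 0# < x → x ≢ 0#
  0<⇒≢0 (_ , ne) e = ne (sym e)

  *-⁻¹ˡ : ∀ {x} → 0# < x → x ⁻¹ * x ≡ 1#
  *-⁻¹ˡ {x} h = trans (*-comm (x ⁻¹) x) (⁻¹-inverse x (0<⇒≢0 h))

  *-⁻¹ʳ : ∀ {x} → 0# < x → x * x ⁻¹ ≡ 1#
  *-⁻¹ʳ {x} h = ⁻¹-inverse x (0<⇒≢0 h)

  cancel-≡ : ∀ {c} → 0# < c → ∀ {a b} → c * a ≡ c * b → a ≡ b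
  cancel-≡ {c} 0<c {a} {b} e = trans (sym (lem a)) (trans (cong (c ⁻¹ *_) e) (lem b))
    where lem : ∀ x → c ⁻¹ * (c * x) ≡ x
          lem x = trans (sym (*-assoc (c ⁻¹) c x)) (trans (cong (_* x) (*-⁻¹ˡ 0<c)) (*-identityˡ x))

  *-cancelˡ-≤ : ∀ {c} → 0# < c → ∀ {a b} → c * a ≤ c * b → a ≤ b
  *-cancelˡ-≤ 0<c {a} {b} h with ≤-total a b
  ... | inj₁ a≤b = a≤b
  ... | inj₂ b≤a = ≤-reflexive (cancel-≡ 0<c (≤-antisym h (*-monoʳ-≤ (<⇒≤ 0<c) b≤a)))

  *-cancelʳ-≤ : ∀ {c} → 0# < c → ∀ {a b} → a * c ≤ b * c → a ≤ b
  *-cancelʳ-≤ {c} 0<c {a} {b} h = *-cancelˡ-≤ 0<c (subst₂ _≤_ (*-comm a c) (*-comm b c) h)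

  0≤1 : 0# ≤ 1#
  0≤1 with ≤-total 0# 1#
  ... | inj₁ h = h
  ... | inj₂ h = ⊥-elim (0≢1 (≤-antisym (subst (0# ≤_) sq (*-nonNegative 0≤-1 0≤-1)) h))
    where
      0≤-1 : 0# ≤ - 1#
      0≤-1 = subst₂ _≤_ (-‿inverseˡ 1#) (+-identityʳ (- 1#)) (+-monoʳ-≤ (- 1#) h)
      sq : - 1# * - 1# ≡ 1#
      sq = trans (sym (-‿distribˡ-* 1# (- 1#))) (trans (cong -_ (*-identityˡ (- 1#))) (-‿involutive 1#))

  0<1 : 0# < 1#
  0<1 = 0≤1 , 0≢1

  <-≤-trans : ∀ {a b c} → a < b → b ≤ c → a < c
  <-≤-trans h@(a≤b , _) b≤c = ≤-trans a≤b b≤c , λ { refl → <⇒≱ h b≤c }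

  ≤-<-trans : ∀ {a b c} → a ≤ b → b < c → a < c
  ≤-<-trans a≤b h@(b≤c , _) = ≤-trans a≤b b≤c , λ { refl → <⇒≱ h a≤b }

  *-pos : ∀ {x y} → 0# < x → 0# < y → 0# < x * y
  *-pos {x} {y} 0<x 0<y = *-nonNegative (<⇒≤ 0<x) (<⇒≤ 0<y) ,
    λ e → 0<⇒≢0 0<y (cancel-≡ 0<x (trans (sym e) (sym (zeroʳ x))))

  ⁻¹-pos : ∀ {x} → 0# < x → 0# < x ⁻¹
  ⁻¹-pos {x} 0<x with 0# ≤? x ⁻¹
  ... | yes h = h , λ e → 0≢1 (trans (sym (zeroʳ x)) (trans (cong (x *_) e) (*-⁻¹ʳ 0<x)))
  ... | no h = ⊥-elim (<⇒≱ 0<1 (subst₂ _≤_ (*-⁻¹ʳ 0<x) (zeroʳ x) (*-monoʳ-≤ (<⇒≤ 0<x) (<⇒≤ (≰⇒> h)))))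

  fromℕ-+ : ∀ a b → fromℕ (a ℕ.+ b) ≡ fromℕ a + fromℕ b
  fromℕ-+ a b = ×-homo-+ 1# a b

  fromℕ-* : ∀ a b → fromℕ (a ℕ.* b) ≡ fromℕ a * fromℕ b
  fromℕ-* a b = ×1-homo-* a b

  fromℕ-1 : fromℕ 1 ≡ 1#
  fromℕ-1 = +-identityʳ 1#

  fromℕ-2 : fromℕ 2 ≡ 2#
  fromℕ-2 = cong (1# +_) (+-identityʳ 1#)

  0≤fromℕ : ∀ m → 0# ≤ fromℕ m
  0≤fromℕ zero    = ≤-refl
  0≤fromℕ (suc m) = +-nonNegative 0≤1 (0≤fromℕ m)

  fromℕ-mono : ∀ {a b} → a ℕ.≤ b → fromℕ a ≤ fromℕ b
  fromℕ-mono {b = b} z≤n = 0≤fromℕ b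
  fromℕ-mono (s≤s h)     = +-monoʳ-≤ 1# (fromℕ-mono h)

  0<fromℕ : ∀ {m} → 1 ℕ.≤ m → 0# < fromℕ m
  0<fromℕ h = <-≤-trans 0<1 (≤-trans (≤-reflexive (sym fromℕ-1)) (fromℕ-mono h))

  fromℕ-reflects : ∀ a b → fromℕ a ≤ fromℕ b → a ℕ.≤ b
  fromℕ-reflects zero    b       h = z≤n
  fromℕ-reflects (suc a) zero    h = ⊥-elim (<⇒≱ (0<fromℕ {suc a} (s≤s z≤n)) h)
  fromℕ-reflects (suc a) (suc b) h = s≤s (fromℕ-reflects a b (+-cancelˡ-≤ 1# h))

  fromℕ-^ : ∀ m e → fromℕ (m ℕ.^ e) ≡ fromℕ m ^ⁿ e
  fromℕ-^ m zero    = fromℕ-1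
  fromℕ-^ m (suc e) = trans (fromℕ-* m (m ℕ.^ e)) (cong (fromℕ m *_) (fromℕ-^ m e))

  ^ⁿ-nonneg : ∀ {a} → 0# ≤ a → ∀ e → 0# ≤ a ^ⁿ e
  ^ⁿ-nonneg h zero    = 0≤1
  ^ⁿ-nonneg h (suc e) = *-nonNegative h (^ⁿ-nonneg h e)

  ^ⁿ-pos : ∀ {a} → 0# < a → ∀ e → 0# < a ^ⁿ e
  ^ⁿ-pos h zero    = 0<1
  ^ⁿ-pos h (suc e) = *-pos h (^ⁿ-pos h e)

  ^ⁿ-monoˡ : ∀ {a b} → 0# ≤ a → a ≤ b → ∀ e → a ^ⁿ e ≤ b ^ⁿ e
  ^ⁿ-monoˡ 0≤a h zero    = ≤-refl
  ^ⁿ-monoˡ 0≤a h (suc e) = *-mono-≤ 0≤a (^ⁿ-nonneg (≤-trans 0≤a h) e) h (^ⁿ-monoˡ 0≤a h e)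

  1≤^ⁿ : ∀ {a} → 1# ≤ a → ∀ e → 1# ≤ a ^ⁿ e
  1≤^ⁿ h zero    = ≤-refl
  1≤^ⁿ h (suc e) = ≤-trans (≤-reflexive (sym (*-identityˡ 1#)))
    (*-mono-≤ 0≤1 (^ⁿ-nonneg (≤-trans 0≤1 h) e) h (1≤^ⁿ h e))

  ^ⁿ-monoʳ : ∀ {a} → 1# ≤ a → ∀ {e f} → e ℕ.≤ f → a ^ⁿ e ≤ a ^ⁿ f
  ^ⁿ-monoʳ h {f = f} z≤n = 1≤^ⁿ h f
  ^ⁿ-monoʳ h (s≤s e≤f)   = *-monoʳ-≤ (≤-trans 0≤1 h) (^ⁿ-monoʳ h e≤f)

  ^ⁿ-cancel : ∀ {a b} → 0# ≤ b → ∀ q → a ^ⁿ suc q ≤ b ^ⁿ suc q → a ≤ b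
  ^ⁿ-cancel {a} {b} 0≤b q h = ≤-by-contradiction λ b<a →
    let 0<a  = ≤-<-trans 0≤b b<a
        b^≤  = *-monoʳ-≤ 0≤b (^ⁿ-monoˡ 0≤b (<⇒≤ b<a) q)
    in *-cancelʳ-≤ (^ⁿ-pos 0<a q) (≤-trans h b^≤)

  -- By Bernoulli's inequality.
  ^ⁿ-unbounded : ∀ {b} → 1# < b → ∀ x → ∃[ m ] x ≤ b ^ⁿ m
  ^ⁿ-unbounded {b} 1<b x = go (archimedean (x * t ⁻¹))
    where
      t = b + - 1#
      b≡ : b ≡ 1# + t
      b≡ = trans (sym (+-identityʳ b)) (trans (cong (b +_) (sym (-‿inverseˡ 1#)))
             (trans (sym (+-assoc b (- 1#) 1#)) (+-comm t 1#)))
      0<t : 0# < t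
      0<t = subst (_≤ t) (-‿inverseʳ 1#) (+-monoˡ-≤ (- 1#) (<⇒≤ 1<b)) ,
            λ e → proj₂ 1<b (sym (trans b≡ (trans (cong (1# +_) (sym e)) (+-identityʳ 1#))))
      0≤t = <⇒≤ 0<t
      bern : ∀ m → 1# + fromℕ m * t ≤ b ^ⁿ m
      bern zero    = ≤-reflexive (trans (cong (1# +_) (zeroˡ t)) (+-identityʳ 1#))
      bern (suc m) = ≤-trans (x≤x+y _ (*-nonNegative (*-nonNegative (0≤fromℕ m) 0≤t) 0≤t))
        (≤-trans (≤-reflexive (lem (fromℕ m) t))
        (subst (λ z → (1# + t) * (1# + fromℕ m * t) ≤ z * b ^ⁿ m) (sym b≡)
          (*-monoʳ-≤ (+-nonNegative 0≤1 0≤t) (bern m))))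
        where lem : ∀ f t → 1# + (1# + f) * t + f * t * t ≡ (1# + t) * (1# + f * t)
              lem = solve 2 (λ f t → con 1 :+ (con 1 :+ f) :* t :+ f :* t :* t := (con 1 :+ t) :* (con 1 :+ f :* t)) refl
      go : ∃[ m ] x * t ⁻¹ ≤ fromℕ m → ∃[ m ] x ≤ b ^ⁿ m
      go (m , h) = m , ≤-trans (≤-reflexive (sym e)) (≤-trans (*-monoˡ-≤ 0≤t h)
        (≤-trans (≤-trans (x≤x+y _ 0≤1) (≤-reflexive (+-comm _ 1#))) (bern m)))
        where e : x * t ⁻¹ * t ≡ x
              e = trans (*-assoc x (t ⁻¹) t) (trans (cong (x *_) (*-⁻¹ˡ 0<t)) (*-identityʳ x))

  0≤2 : 0# ≤ 2#
  0≤2 = +-nonNegative 0≤1 0≤1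

  1≤2 : 1# ≤ 2#
  1≤2 = x≤x+y 1# 0≤1

  0<2 : 0# < 2#
  0<2 = <-≤-trans 0<1 1≤2

  1<2 : 1# < 2#
  1<2 = 1≤2 , λ e → 0≢1 (cancel e)
    where cancel : 1# ≡ 1# + 1# → 0# ≡ 1#
          cancel e = ≤-antisym 0≤1 (+-cancelˡ-≤ 1# (≤-reflexive (trans (sym e) (sym (+-identityʳ 1#)))))

  2^-fromℕ : ∀ e → fromℕ (2 ℕ.^ e) ≡ 2# ^ⁿ e
  2^-fromℕ e = trans (fromℕ-^ 2 e) (cong (_^ⁿ e) fromℕ-2)

  -- The condition on the exponents is one between natural numbers, `p ≤ m * suc q + r`. After
  -- cancelling `b ^ⁿ r` it compares powers with exponent `suc q`, and a root can be taken.
  BelowPower-bound : ∀ {b} → 1# ≤ b → ∀ {s} m → s ≤ fromℕ m → UpperBound (BelowPower b s) (b ^ⁿ m)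
  BelowPower-bound {b} 1≤b {s} m s≤m y (0≤y , p , r , q , h , h′) =
    ^ⁿ-cancel (^ⁿ-nonneg 0≤b m) q (*-cancelʳ-≤ (^ⁿ-pos 0<b r) (≤-trans h′
      (≤-trans (^ⁿ-monoʳ 1≤b p≤) (≤-reflexive e))))
    where
      0≤b = ≤-trans 0≤1 1≤b
      0<b = <-≤-trans 0<1 1≤b
      p≤ : p ℕ.≤ m ℕ.* suc q ℕ.+ r
      p≤ = fromℕ-reflects p _ (≤-trans h (≤-trans (+-monoˡ-≤ (fromℕ r) (*-monoʳ-≤ (0≤fromℕ (suc q)) s≤m))
        (≤-reflexive (sym (trans (fromℕ-+ (m ℕ.* suc q) r) (cong (_+ fromℕ r) (trans (fromℕ-* m (suc q)) (*-comm _ _))))))))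
      e : b ^ⁿ (m ℕ.* suc q ℕ.+ r) ≡ (b ^ⁿ m) ^ⁿ suc q * b ^ⁿ r
      e = trans (^-homo-* b (m ℕ.* suc q) r) (cong (_* b ^ⁿ r) (sym (^-assocʳ b m (suc q))))

  BelowPower-inhabited : ∀ {b} → 1# ≤ b → ∀ s → ∃ (BelowPower b s)
  BelowPower-inhabited {b} 1≤b s = go (archimedean (- s))
    where
      go : ∃[ r ] - s ≤ fromℕ r → ∃ (BelowPower b s)
      go (r , h) = 0# , ≤-refl , 0 , r , 0 ,
        subst₂ _≤_ (-‿inverseʳ s) (cong (_+ fromℕ r) (sym (trans (cong (_* s) fromℕ-1) (*-identityˡ s)))) (+-monoʳ-≤ s h) ,
        ≤-trans (≤-reflexive (trans (cong (_* b ^ⁿ r) (zeroˡ 1#)) (zeroˡ _))) 0≤1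

  BelowPower-bounded : ∀ {b} → 1# ≤ b → ∀ s → ∃ (UpperBound (BelowPower b s))
  BelowPower-bounded 1≤b s with archimedean s
  ... | m , h = _ , BelowPower-bound 1≤b m h

  ^-big : ∀ {b} → 1# ≤ b → ∀ s → b ^ s ≡ ⨆ (BelowPower b s)
  ^-big {b} 1≤b s with 1# ≤? b
  ... | yes _ = refl
  ... | no ¬h = ⊥-elim (¬h 1≤b)

  ^-small : ∀ {b} → b < 1# → ∀ s → b ^ (- s) ≡ ⨆ (BelowPower (b ⁻¹) s)
  ^-small {b} b<1 s with 1# ≤? b
  ... | yes h = ⊥-elim (<⇒≱ b<1 h)
  ... | no _  = cong (λ t → ⨆ (BelowPower (b ⁻¹) t)) (-‿involutive s)

  ^-upper : ∀ {b} → 1# ≤ b → ∀ {s} m → s ≤ fromℕ m → b ^ s ≤ b ^ⁿ m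
  ^-upper {b} 1≤b {s} m h = subst (_≤ b ^ⁿ m) (sym (^-big 1≤b s))
    (⨆-least (BelowPower b s) (BelowPower-inhabited 1≤b s) (b ^ⁿ m) (BelowPower-bound 1≤b m h))

  ⨆-lower : ∀ {b} → 1# ≤ b → ∀ {s} m → fromℕ m ≤ s → b ^ⁿ m ≤ ⨆ (BelowPower b s)
  ⨆-lower {b} 1≤b {s} m h = ⨆-upper (BelowPower b s) (BelowPower-inhabited 1≤b s) (BelowPower-bounded 1≤b s) (b ^ⁿ m)
    (^ⁿ-nonneg (≤-trans 0≤1 1≤b) m , m , 0 , 0 ,
     ≤-trans h (≤-reflexive (sym (trans (+-identityʳ _) (trans (cong (_* s) fromℕ-1) (*-identityˡ s))))) ,
     ≤-reflexive (trans (*-identityʳ _) (*-identityʳ _)))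

  ^-lower : ∀ {b} → 1# ≤ b → ∀ {s} m → fromℕ m ≤ s → b ^ⁿ m ≤ b ^ s
  ^-lower {b} 1≤b {s} m h = subst (b ^ⁿ m ≤_) (sym (^-big 1≤b s)) (⨆-lower 1≤b m h)

  -- 3/2 bounds the square root of 2.
  2^-below-half : ∀ {s} → s + s ≤ 1# → 2# ^ s * 2# ≤ fromℕ 3
  2^-below-half {s} h = ≤-trans (*-monoˡ-≤ 0≤2 below) (≤-reflexive (trans (*-assoc (fromℕ 3) (2# ⁻¹) 2#)
      (trans (cong (fromℕ 3 *_) (*-⁻¹ˡ 0<2)) (*-identityʳ _))))
    where
      u = fromℕ 3 * 2# ⁻¹
      0≤u : 0# ≤ u
      0≤u = *-nonNegative (0≤fromℕ 3) (<⇒≤ (⁻¹-pos 0<2))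
      4u² : (2# * 2#) * (u * u) ≡ fromℕ 9
      4u² = trans (lem 2# (fromℕ 3) (2# ⁻¹)) (trans (cong₂ (λ a b → fromℕ 3 * a * (fromℕ 3 * b)) (*-⁻¹ˡ 0<2) (*-⁻¹ˡ 0<2))
              (trans (cong₂ _*_ (*-identityʳ (fromℕ 3)) (*-identityʳ (fromℕ 3))) (sym (fromℕ-* 3 3))))
        where lem : ∀ t a i → (t * t) * (a * i * (a * i)) ≡ a * (i * t) * (a * (i * t))
              lem = solve 3 (λ t a i → (t :* t) :* (a :* i :* (a :* i)) := a :* (i :* t) :* (a :* (i :* t))) refl
      8≡ : (2# * 2#) * 2# ≡ fromℕ 8
      8≡ = sym (trans (fromℕ-* 4 2) (cong₂ _*_ (trans (fromℕ-* 2 2) (cong₂ _*_ fromℕ-2 fromℕ-2)) fromℕ-2))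
      2≤u² : 2# ≤ u ^ⁿ 2
      2≤u² = *-cancelˡ-≤ (*-pos 0<2 0<2) (≤-trans (≤-reflexive 8≡) (≤-trans (fromℕ-mono (ℕ.n≤1+n 8))
               (≤-reflexive (trans (sym 4u²) (cong (λ z → 2# * 2# * (u * z)) (sym (*-identityʳ u)))))))
      below : 2# ^ s ≤ u
      below = subst (_≤ u) (sym (^-big 1≤2 s)) (⨆-least (BelowPower 2# s) (BelowPower-inhabited 1≤2 s) u ub)
        where
          ub : UpperBound (BelowPower 2# s) u
          -- The square of `y` lies below a rational power of 2 with exponent at most `s + s`, hence
          -- below 2. Squaring both conditions on `y` avoids irrational exponents.
          ub y (0≤y , p , r , q , hp , hy) = ^ⁿ-cancel 0≤u 1 (≤-trans y²≤2 2≤u²)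
            where
              Q = suc q
              pp : fromℕ (p ℕ.+ p) ≤ fromℕ (Q ℕ.+ (r ℕ.+ r))
              pp = ≤-trans (≤-reflexive (fromℕ-+ p p)) (≤-trans (+-mono-≤ hp hp)
                     (≤-trans (≤-reflexive (lem (fromℕ Q) s (fromℕ r)))
                     (≤-trans (+-monoˡ-≤ _ (*-monoʳ-≤ (0≤fromℕ Q) h))
                     (≤-reflexive (trans (cong (_+ (fromℕ r + fromℕ r)) (*-identityʳ (fromℕ Q)))
                       (sym (trans (fromℕ-+ Q (r ℕ.+ r)) (cong (fromℕ Q +_) (fromℕ-+ r r)))))))))
                where
                  lem : ∀ q s r → (q * s + r) + (q * s + r) ≡ q * (s + s) + (r + r)
                  lem = solve 3 (λ q s r → (q :* s :+ r) :+ (q :* s :+ r) := q :* (s :+ s) :+ (r :+ r)) refl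
              sq : (y ^ⁿ Q * 2# ^ⁿ r) * (y ^ⁿ Q * 2# ^ⁿ r) ≤ 2# ^ⁿ p * 2# ^ⁿ p
              sq = *-mono-≤ nn (^ⁿ-nonneg 0≤2 p) hy hy
                where nn = *-nonNegative (^ⁿ-nonneg 0≤y Q) (^ⁿ-nonneg 0≤2 r)
              y²^ : (y ^ⁿ 2) ^ⁿ Q * (2# ^ⁿ r * 2# ^ⁿ r) ≤ 2# ^ⁿ Q * (2# ^ⁿ r * 2# ^ⁿ r)
              y²^ = ≤-trans (≤-reflexive (trans (cong (_* (2# ^ⁿ r * 2# ^ⁿ r)) y²≡) (lem (y ^ⁿ Q) (2# ^ⁿ r)))) (≤-trans sq
                (≤-trans (≤-reflexive (sym (^-homo-* 2# p p))) (≤-trans (^ⁿ-monoʳ 1≤2 (fromℕ-reflects (p ℕ.+ p) (Q ℕ.+ (r ℕ.+ r)) pp))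
                  (≤-reflexive (trans (^-homo-* 2# Q (r ℕ.+ r)) (cong (2# ^ⁿ Q *_) (^-homo-* 2# r r)))))))
                where
                  y²≡ : (y ^ⁿ 2) ^ⁿ Q ≡ y ^ⁿ Q * y ^ⁿ Q
                  y²≡ = trans (cong (_^ⁿ Q) (cong (y *_) (*-identityʳ y))) (^-distrib-* y y Q)
                  lem : ∀ a b → a * a * (b * b) ≡ a * b * (a * b)
                  lem = solve 2 (λ a b → a :* a :* (b :* b) := a :* b :* (a :* b)) refl
              y²≤2 : y ^ⁿ 2 ≤ 2#
              y²≤2 = ^ⁿ-cancel 0≤2 q (*-cancelʳ-≤ (*-pos (^ⁿ-pos 0<2 r) (^ⁿ-pos 0<2 r)) y²^)

  -- Membership in a set bounds its supremum only if the set is bounded above; here `suc N` is an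
  -- upper bound, because `2 ^ suc N` exceeds `N`.
  log₂-lower : ∀ e N → 2 ℕ.^ e ℕ.≤ N → fromℕ e ≤ log₂ (fromℕ N)
  log₂-lower e N h = ⨆-upper (λ s → 2# ^ s ≤ fromℕ N) (fromℕ e , mem) (fromℕ (suc N) , bounded) (fromℕ e) mem
    where
      mem : 2# ^ fromℕ e ≤ fromℕ N
      mem = ≤-trans (^-upper 1≤2 e ≤-refl) (≤-trans (≤-reflexive (sym (2^-fromℕ e))) (fromℕ-mono h))
      bounded : UpperBound (λ s → 2# ^ s ≤ fromℕ N) (fromℕ (suc N))
      bounded s hs = ≤-by-contradiction λ N<s → ⊥-elim (ℕ.<-irrefl refl (ℕ.<-trans (ℕ.n<1+n N) (ℕ.<-≤-trans (n<2^n (suc N))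
        (fromℕ-reflects _ _ (≤-trans (≤-reflexive (2^-fromℕ (suc N))) (≤-trans (^-lower 1≤2 (suc N) (<⇒≤ N<s)) hs))))))

  module Units {s : ℝ} (0<s : 0# < s) where

    ⟦_⟧ : ℕ → ℝ
    ⟦ c ⟧ = fromℕ c * s

    ⟦⟧-mono : ∀ {c c′} → c ℕ.≤ c′ → ⟦ c ⟧ ≤ ⟦ c′ ⟧
    ⟦⟧-mono h = *-monoˡ-≤ (<⇒≤ 0<s) (fromℕ-mono h)

    ⟦⟧-+ : ∀ c c′ → ⟦ c ℕ.+ c′ ⟧ ≡ ⟦ c ⟧ + ⟦ c′ ⟧
    ⟦⟧-+ c c′ = trans (cong (_* s) (fromℕ-+ c c′)) (distribʳ s _ _)

    ⟦⟧-* : ∀ c c′ → ⟦ c ℕ.* c′ ⟧ ≡ fromℕ c * ⟦ c′ ⟧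
    ⟦⟧-* c c′ = trans (cong (_* s) (fromℕ-* c c′)) (*-assoc _ _ s)

    ⟦⟧-reflects : ∀ c c′ → ⟦ c ⟧ ≤ ⟦ c′ ⟧ → c ℕ.≤ c′
    ⟦⟧-reflects c c′ h = fromℕ-reflects c c′ (*-cancelʳ-≤ 0<s h)

    ⟦⟧-unbounded : ∀ r → ∃[ c ] r ≤ ⟦ c ⟧
    ⟦⟧-unbounded r with archimedean (r * s ⁻¹)
    ... | c , h = c , ≤-trans (≤-reflexive (sym (trans (*-assoc r (s ⁻¹) s) (trans (cong (r *_) (*-⁻¹ˡ 0<s)) (*-identityʳ r)))))
                          (*-monoˡ-≤ (<⇒≤ 0<s) h)

-- Graphs given by lists of pairs: degrees, weights and shortest paths.

bit : Bool → ℕ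
bit b = if b then 1 else 0

∣tabulate∣ : ∀ {m} (f : Fin m → Bool) → ∣ Vec.tabulate f ∣ ≡ ∑ (bit ∘ f) (allFin m)
∣tabulate∣ f = trans (count f) (trans (cong (∑ bit) (sym (map-tabulate id f))) (∑-map bit f (allFin _)))
  where
    count : ∀ {m} (f : Fin m → Bool) → ∣ Vec.tabulate f ∣ ≡ ∑ bit (tabulate f)
    count {zero}  f = refl
    count {suc m} f with f zero
    ... | true  = cong suc (count (f ∘ suc))
    ... | false = count (f ∘ suc)

foldr-⊔-≤ : ∀ {m} (f : Fin m → ℕ) c → (∀ x → f x ℕ.≤ c) → Vector.foldr ℕ._⊔_ 0 f ℕ.≤ c
foldr-⊔-≤ {zero}  f c h = z≤n
foldr-⊔-≤ {suc m} f c h = ℕ.⊔-lub (h zero) (foldr-⊔-≤ (f ∘ suc) c (h ∘ suc))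

module Graphs (𝓡 : CompleteOrderedField) where

  open OrderedField 𝓡
  open Spanners 𝓡

  degree-≤ : ∀ {n} (H : Graph n) x (ys : List (Fin n)) → (∀ {y} → Graph.Adj H x y → y ∈ ys) →
    Graph.degree H x ℕ.≤ List.length ys
  degree-≤ {n} H x ys h = begin
    ∣ Vec.tabulate (Graph.adj H x) ∣ ≡⟨ ∣tabulate∣ (Graph.adj H x) ⟩
    ∑ (bit ∘ Graph.adj H x) (allFin n) ≤⟨ ∑-mono (allFin n) (λ {y} _ → hit y (Graph.adj H x y) refl) ⟩
    ∑ (λ y → ∑ (λ z → ind (z Fin.≟ y) 1) ys) (allFin n) ≡⟨ ∑-swap (λ y z → ind (z Fin.≟ y) 1) (allFin n) ys ⟩
    ∑ (λ z → ∑ (λ y → ind (z Fin.≟ y) 1) (allFin n)) ys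
      ≤⟨ ∑-≤-const 1 ys (λ {z} _ → unique-ind z 1 (allFin n) (Unique.allFin⁺ n)) ⟩
    List.length ys ℕ.* 1 ≡⟨ ℕ.*-identityʳ _ ⟩
    List.length ys ∎
    where
      open ℕ.≤-Reasoning
      hit : ∀ y b → Graph.adj H x y ≡ b → bit b ℕ.≤ ∑ (λ z → ind (z Fin.≟ y) 1) ys
      hit y false e = z≤n
      hit y true  e = ℕ.≤-trans (ℕ.≤-reflexive (sym (ind-yes (y Fin.≟ y) refl 1))) (∑-∈ (λ z → ind (z Fin.≟ y) 1) (h e))

  module FromPairs {n : ℕ} where

    private X = Fin n

    open DecMembership (≡-dec (Fin._≟_ {n}) (Fin._≟_ {n})) using (_∈?_)

    Joined : List (X × X) → X → X → Set
    Joined P x y = x ≢ y × ((x , y) ∈ P ⊎ (y , x) ∈ P)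

    joined? : ∀ P x y → Dec (Joined P x y)
    joined? P x y = ¬? (x Fin.≟ y) ×-dec (((x , y) ∈? P) ⊎-dec ((y , x) ∈? P))

    joined-sym : ∀ {P x y} → Joined P x y → Joined P y x
    joined-sym (ne , inj₁ p) = ne ∘ sym , inj₂ p
    joined-sym (ne , inj₂ p) = ne ∘ sym , inj₁ p

    does-⇔ : {A B : Set} (a : Dec A) (b : Dec B) → (A → B) → (B → A) → ⌊ a ⌋ ≡ ⌊ b ⌋
    does-⇔ (yes _) (yes _) f g = refl
    does-⇔ (yes a) (no ¬b) f g = ⊥-elim (¬b (f a))
    does-⇔ (no ¬a) (yes b) f g = ⊥-elim (¬a (g b))
    does-⇔ (no _)  (no _)  f g = refl

    does-yes : {A : Set} (a : Dec A) → A → ⌊ a ⌋ ≡ true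
    does-yes (yes _) a = refl
    does-yes (no ¬a) a = ⊥-elim (¬a a)

    does-no : {A : Set} (a : Dec A) → ¬ A → ⌊ a ⌋ ≡ false
    does-no (yes a) ¬a = ⊥-elim (¬a a)
    does-no (no _)  ¬a = refl

    does⁻ : {A : Set} (a : Dec A) → ⌊ a ⌋ ≡ true → A
    does⁻ (yes a) _ = a

    graph : List (X × X) → Graph n
    graph P = record
      { adj = λ x y → ⌊ joined? P x y ⌋
      ; adj-sym = λ x y → does-⇔ (joined? P x y) (joined? P y x) joined-sym joined-sym
      ; adj-irrefl = λ x → does-no (joined? P x x) (λ (ne , _) → ne refl)
      }

    adj⁺ : ∀ P {x y} → Joined P x y → Graph.Adj (graph P) x y
    adj⁺ P {x} {y} = does-yes (joined? P x y)

    adj⁻ : ∀ P {x y} → Graph.Adj (graph P) x y → Joined P x y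
    adj⁻ P {x} {y} = does⁻ (joined? P x y)

  sum-mono : ∀ {m} {f g : Fin m → ℝ} → (∀ i → f i ≤ g i) → sum f ≤ sum g
  sum-mono {zero}  h = ≤-refl
  sum-mono {suc m} h = +-mono-≤ (h zero) (sum-mono (h ∘ suc))

  sum-+ : ∀ {m} (f g : Fin m → ℝ) → sum (λ i → f i + g i) ≡ sum f + sum g
  sum-+ {zero}  f g = sym (+-identityˡ 0#)
  sum-+ {suc m} f g = trans (cong (f zero + g zero +_) (sum-+ (f ∘ suc) (g ∘ suc)))
    (solve 4 (λ a b c d → a :+ b :+ (c :+ d) := (a :+ c) :+ (b :+ d)) refl (f zero) (g zero) _ _)

  sum-zero : ∀ {m} (f : Fin m → ℝ) → (∀ i → f i ≡ 0#) → sum f ≡ 0#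
  sum-zero {zero}  f h = refl
  sum-zero {suc m} f h = trans (cong₂ _+_ (h zero) (sum-zero (f ∘ suc) (h ∘ suc))) (+-identityˡ 0#)

  sum-single : ∀ {m} (f : Fin m → ℝ) i → (∀ j → j ≢ i → f j ≡ 0#) → sum f ≡ f i
  sum-single {suc m} f zero    h = trans (cong (f zero +_) (sum-zero (f ∘ suc) (λ j → h (suc j) (λ ())))) (+-identityʳ _)
  sum-single {suc m} f (suc i) h = trans (cong₂ _+_ (h zero (λ ())) (sum-single (f ∘ suc) i (λ j ne → h (suc j) (ne ∘ Fin.suc-injective))))
    (+-identityˡ _)

  sum-nonneg : ∀ {m} (f : Fin m → ℝ) → (∀ i → 0# ≤ f i) → 0# ≤ sum f
  sum-nonneg {zero}  f h = ≤-refl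
  sum-nonneg {suc m} f h = +-nonNegative (h zero) (sum-nonneg (f ∘ suc) (h ∘ suc))

  ∑ℝ : {A : Set} → (A → ℝ) → List A → ℝ
  ∑ℝ f []       = 0#
  ∑ℝ f (x ∷ xs) = f x + ∑ℝ f xs

  module Weights {n : ℕ} (M : Metric n) where

    open Metric M
    open FromPairs {n}

    private X = Fin n

    when : Bool → ℝ → ℝ
    when b x = if b then x else 0#

    entries : (X → X → Bool) → ℝ
    entries b = sum λ x → sum λ y → when (⌊ x Fin.<? y ⌋ ∧ b x y) (d x y)

    single : X → X → ℝ → X → X → ℝ
    single a c v x y = when ⌊ x Fin.≟ a ⌋ (when ⌊ y Fin.≟ c ⌋ v)

    sum-single₂ : ∀ a c v → sum (λ x → sum (λ y → single a c v x y)) ≡ v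
    sum-single₂ a c v = trans (sum-single _ a (λ x x≢a → sum-zero _ (λ y → cong (λ b → when b (when ⌊ y Fin.≟ c ⌋ v)) (does-no (x Fin.≟ a) x≢a))))
      (trans (sum-single _ c (λ y y≢c → trans (cong (when ⌊ a Fin.≟ a ⌋) (cong (λ b → when b v) (does-no (y Fin.≟ c) y≢c))) (when-0 ⌊ a Fin.≟ a ⌋)))
        (trans (cong (λ b → when b (when ⌊ c Fin.≟ c ⌋ v)) (does-yes (a Fin.≟ a) refl))
               (cong (λ b → when b v) (does-yes (c Fin.≟ c) refl))))
      where when-0 : ∀ b → when b 0# ≡ 0#
            when-0 true  = refl
            when-0 false = refl

    0≤when : ∀ b {x} → 0# ≤ x → 0# ≤ when b x
    0≤when true  h = h
    0≤when false h = ≤-refl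

    -- `weight` counts each edge only from its smaller end, so the additional pair is oriented
    -- before it is compared entry by entry.
    entries-step : ∀ b b′ a c → (∀ x y → b x y ≡ true → b′ x y ≡ true ⊎ (x ≡ a × y ≡ c) ⊎ (x ≡ c × y ≡ a)) →
      entries b ≤ d a c + entries b′
    entries-step b b′ a c h = case (a Fin.<? c)
      where
        go : ∀ l u → d l u ≡ d a c → (∀ x y → x Fin.< y → b x y ≡ true → b′ x y ≡ true ⊎ (x ≡ l × y ≡ u)) →
             entries b ≤ d a c + entries b′
        go l u e hit = ≤-trans
          (sum-mono λ x → ≤-trans (sum-mono λ y → cell x y (x Fin.<? y) (b x y) refl (b′ x y) refl)
            (≤-reflexive (sum-+ (λ y → single l u (d a c) x y) (λ y → when (⌊ x Fin.<? y ⌋ ∧ b′ x y) (d x y)))))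
          (≤-reflexive (trans (sum-+ (λ x → sum (λ y → single l u (d a c) x y)) (λ x → sum (λ y → when (⌊ x Fin.<? y ⌋ ∧ b′ x y) (d x y))))
            (cong (_+ entries b′) (sum-single₂ l u (d a c)))))
          where
            0≤single : ∀ x y → 0# ≤ single l u (d a c) x y
            0≤single x y = 0≤when ⌊ x Fin.≟ l ⌋ (0≤when ⌊ y Fin.≟ u ⌋ (d-nonneg a c))
            single≡ : single l u (d a c) l u ≡ d a c
            single≡ = trans (cong (λ t → when t (when ⌊ u Fin.≟ u ⌋ (d a c))) (does-yes (l Fin.≟ l) refl))
                            (cong (λ t → when t (d a c)) (does-yes (u Fin.≟ u) refl))
            cell : ∀ x y (lt : Dec (x Fin.< y)) bv → b x y ≡ bv → ∀ bv′ → b′ x y ≡ bv′ →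
              when (⌊ lt ⌋ ∧ bv) (d x y) ≤ single l u (d a c) x y + when (⌊ lt ⌋ ∧ bv′) (d x y)
            cell x y (no _)  bv eb bv′ eb′ = ≤-trans (0≤single x y) (x≤x+y _ ≤-refl)
            cell x y (yes _) false eb bv′ eb′ = +-nonNegative (0≤single x y) (0≤when bv′ (d-nonneg x y))
            cell x y (yes _) true eb true eb′ = ≤-trans (x≤x+y _ (0≤single x y)) (≤-reflexive (+-comm _ _))
            cell x y (yes lt) true eb false eb′ with hit x y lt eb
            ... | inj₁ t with () ← trans (sym eb′) t
            ... | inj₂ (refl , refl) = ≤-trans (≤-reflexive (trans e (sym single≡))) (x≤x+y _ ≤-refl)
        case : Dec (a Fin.< c) → entries b ≤ d a c + entries b′
        case (yes a<c) = go a c refl λ x y x<y t → sel x y x<y (h x y t)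
          where
            sel : ∀ x y → x Fin.< y → b′ x y ≡ true ⊎ (x ≡ a × y ≡ c) ⊎ (x ≡ c × y ≡ a) → b′ x y ≡ true ⊎ (x ≡ a × y ≡ c)
            sel x y x<y (inj₁ t) = inj₁ t
            sel x y x<y (inj₂ (inj₁ p)) = inj₂ p
            sel x y x<y (inj₂ (inj₂ (refl , refl))) = ⊥-elim (ℕ.<-asym x<y a<c)
        case (no a≮c) = go c a (d-sym c a) λ x y x<y t → sel x y x<y (h x y t)
          where
            sel : ∀ x y → x Fin.< y → b′ x y ≡ true ⊎ (x ≡ a × y ≡ c) ⊎ (x ≡ c × y ≡ a) → b′ x y ≡ true ⊎ (x ≡ c × y ≡ a)
            sel x y x<y (inj₁ t) = inj₁ t
            sel x y x<y (inj₂ (inj₁ (refl , refl))) = ⊥-elim (a≮c x<y)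
            sel x y x<y (inj₂ (inj₂ p)) = inj₂ p

    weight-≤ : ∀ P → weight M (graph P) ≤ ∑ℝ (λ (x , y) → d x y) P
    weight-≤ [] = ≤-reflexive (sum-zero _ λ x → sum-zero _ λ y → cell x y)
      where
        cell : ∀ x y → when (⌊ x Fin.<? y ⌋ ∧ ⌊ joined? [] x y ⌋) (d x y) ≡ 0#
        cell x y rewrite does-no (joined? [] x y) (λ { (_ , inj₁ ()) ; (_ , inj₂ ()) }) | Bool.∧-zeroʳ ⌊ x Fin.<? y ⌋ = refl
    weight-≤ ((a , c) ∷ P) = ≤-trans (entries-step _ (λ x y → ⌊ joined? P x y ⌋) a c split) (+-monoʳ-≤ (d a c) (weight-≤ P))
      where
        split : ∀ x y → ⌊ joined? ((a , c) ∷ P) x y ⌋ ≡ true → ⌊ joined? P x y ⌋ ≡ true ⊎ (x ≡ a × y ≡ c) ⊎ (x ≡ c × y ≡ a)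
        split x y t with does⁻ (joined? ((a , c) ∷ P) x y) t
        ... | ne , inj₁ (here refl) = inj₂ (inj₁ (refl , refl))
        ... | ne , inj₂ (here refl) = inj₂ (inj₂ (refl , refl))
        ... | ne , inj₁ (there p) = inj₁ (does-yes (joined? P x y) (ne , inj₁ p))
        ... | ne , inj₂ (there p) = inj₁ (does-yes (joined? P x y) (ne , inj₂ p))

  module Paths {n : ℕ} (M : Metric n) where

    open Metric M

    private X = Fin n

    module _ {H : Graph n} {U : Subset n} where

      start∈ : ∀ {x y} → Path H U x y → x ∈ˢ U
      start∈ (stop p)     = p
      start∈ (step p _ _) = p

      _⊕_ : ∀ {x y z} → Path H U x y → Path H U y z → Path H U x z
      stop _     ⊕ q = q
      step u a p ⊕ q = step u a (p ⊕ q)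

      length-⊕ : ∀ {x y z} (p : Path H U x y) (q : Path H U y z) → length M (p ⊕ q) ≡ length M p + length M q
      length-⊕ (stop _) q = sym (+-identityˡ _)
      length-⊕ (step {x} {y} _ _ p) q = trans (cong (d x y +_) (length-⊕ p q)) (sym (+-assoc (d x y) _ _))

      hops-⊕ : ∀ {x y z} (p : Path H U x y) (q : Path H U y z) → hops (p ⊕ q) ≡ hops p ℕ.+ hops q
      hops-⊕ (stop _) q = refl
      hops-⊕ (step _ _ p) q = cong suc (hops-⊕ p q)

      reverse : ∀ {x y} (p : Path H U x y) → Σ[ q ∈ Path H U y x ] length M q ≡ length M p × hops q ≡ hops p
      reverse (stop u) = stop u , refl , refl
      reverse (step {x} {y} u a p) with reverse p
      ... | q , e , e′ = q ⊕ back ,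
            trans (length-⊕ q back) (trans (cong₂ _+_ e (trans (+-identityʳ _) (d-sym y x))) (+-comm _ _)) ,
            trans (hops-⊕ q back) (trans (cong (ℕ._+ 1) e′) (ℕ.+-comm _ 1))
        where back = step (start∈ p) (trans (Graph.adj-sym H y x) a) (stop u)

      adj⇒≢ : ∀ {x y} → Graph.Adj H x y → x ≢ y
      adj⇒≢ {x} a refl with () ← trans (sym a) (Graph.adj-irrefl H x)

      hops-length : ∀ {m} → (∀ {x y} → x ≢ y → m ≤ d x y) → ∀ {x y} (p : Path H U x y) → fromℕ (hops p) * m ≤ length M p
      hops-length {m} h (stop _) = ≤-reflexive (zeroˡ m)
      hops-length {m} h (step _ a p) = ≤-trans (≤-reflexive (trans (distribʳ m 1# _) (cong (_+ fromℕ (hops p) * m) (*-identityˡ m))))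
        (+-mono-≤ (h (adj⇒≢ a)) (hops-length h p))

    ShortPath : Graph n → Subset n → X → X → ℝ → ℕ → Set
    ShortPath H U x y ℓ h = Σ[ p ∈ Path H U x y ] length M p ≤ ℓ × hops p ℕ.≤ h

    module _ {H : Graph n} {U : Subset n} where

      join : ∀ {x y z ℓ ℓ′ h h′} → ShortPath H U x y ℓ h → ShortPath H U y z ℓ′ h′ → ShortPath H U x z (ℓ + ℓ′) (h ℕ.+ h′)
      join (p , l , h) (q , l′ , h′) = p ⊕ q , ≤-trans (≤-reflexive (length-⊕ p q)) (+-mono-≤ l l′) ,
        ℕ.≤-trans (ℕ.≤-reflexive (hops-⊕ p q)) (ℕ.+-mono-≤ h h′)

      flip : ∀ {x y ℓ h} → ShortPath H U x y ℓ h → ShortPath H U y x ℓ h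
      flip (p , l , h) with reverse p
      ... | q , e , e′ = q , ≤-trans (≤-reflexive e) l , ℕ.≤-trans (ℕ.≤-reflexive e′) h

      relax : ∀ {x y ℓ ℓ′ h h′} → ℓ ≤ ℓ′ → h ℕ.≤ h′ → ShortPath H U x y ℓ h → ShortPath H U x y ℓ′ h′
      relax l≤ h≤ (p , l , h) = p , ≤-trans l l≤ , ℕ.≤-trans h h≤

    module _ (H : Graph n) (U : Subset n) where

      stops : ∀ x y → Dec (x ≡ y) → Dec (x ∈ˢ U) → List (Path H U x y)
      stops x .x (yes refl) (yes u) = stop u ∷ []
      stops x y  _          _       = []

      steps : ∀ {x y z} → Dec (x ∈ˢ U) → Dec (Graph.Adj H x z) → List (Path H U z y) → List (Path H U x y)
      steps (yes u) (yes a) ps = map (step u a) ps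
      steps _       _       ps = []

      paths : ℕ → ∀ x y → List (Path H U x y)
      paths zero    x y = stops x y (x Fin.≟ y) (x Subset.∈? U)
      paths (suc h) x y = stops x y (x Fin.≟ y) (x Subset.∈? U) ++
        concatMap (λ z → steps (x Subset.∈? U) (Graph.adj H x z Bool.≟ true) (paths h z y)) (allFin n)

      stops-hops : ∀ x y e u {p} → p ∈ stops x y e u → hops p ≡ 0
      stops-hops x .x (yes refl) (yes u) (here refl) = refl
      stops-hops x y (no _) u ()

      paths-hops : ∀ h x y {p} → p ∈ paths h x y → hops p ℕ.≤ h
      paths-hops zero x y p∈ = ℕ.≤-reflexive (stops-hops x y (x Fin.≟ y) (x Subset.∈? U) p∈)
      paths-hops (suc h) x y {p} p∈ with ∈-++⁻ (stops x y (x Fin.≟ y) (x Subset.∈? U)) p∈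
      ... | inj₁ q = ℕ.≤-trans (ℕ.≤-reflexive (stops-hops x y (x Fin.≟ y) (x Subset.∈? U) q)) z≤n
      ... | inj₂ q with ∈-concatMap⁻ (λ z → steps (x Subset.∈? U) (Graph.adj H x z Bool.≟ true) (paths h z y)) (allFin n) q
      ...   | z , _ , r = go (x Subset.∈? U) (Graph.adj H x z Bool.≟ true) r
        where
          go : ∀ u a → p ∈ steps u a (paths h z y) → hops p ℕ.≤ suc h
          go (yes u) (yes a) s with ∈-map⁻ (step u a) s
          ... | q , q∈ , refl = s≤s (paths-hops h z y q∈)

      stops-complete : ∀ {x} e u → x ∈ˢ U → ∃[ c ] c ∈ stops x x e u × length M c ≡ 0#
      stops-complete (yes refl) (yes u) _ = stop u , here refl , refl
      stops-complete (yes refl) (no ¬u) u = ⊥-elim (¬u u)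
      stops-complete (no ¬e)    _       _ = ⊥-elim (¬e refl)

      paths-complete : ∀ h {x y} (p : Path H U x y) → hops p ℕ.≤ h → ∃[ c ] c ∈ paths h x y × length M c ≡ length M p
      paths-complete zero {x} (stop u) _ = stops-complete (x Fin.≟ x) (x Subset.∈? U) u
      paths-complete (suc h) {x} (stop u) _ with stops-complete (x Fin.≟ x) (x Subset.∈? U) u
      ... | c , c∈ , e = c , ∈-++⁺ˡ c∈ , e
      paths-complete (suc h) {x} {y} (step {y = z} u a p) (s≤s hp) with paths-complete h p hp
      ... | c , c∈ , e with go (x Subset.∈? U) (Graph.adj H x z Bool.≟ true)
        where
          go : ∀ u′ a′ → ∃[ c′ ] c′ ∈ steps u′ a′ (paths h z y) × length M c′ ≡ d x z + length M p
          go (yes u′) (yes a′) = step u′ a′ c , ∈-map⁺ (step u′ a′) c∈ , cong (d x z +_) e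
          go (yes _) (no ¬a) = ⊥-elim (¬a a)
          go (no ¬u) _ = ⊥-elim (¬u u)
      ...   | c′ , c′∈ , e′ = c′ , ∈-++⁺ʳ (stops x y (x Fin.≟ y) (x Subset.∈? U)) (∈-concatMap _ (∈-allFin z) c′∈) , e′

    minimal : {A : Set} (f : A → ℝ) → ∀ x xs → ∃[ m ] m ∈ x ∷ xs × (∀ {y} → y ∈ x ∷ xs → f m ≤ f y)
    minimal f x [] = x , here refl , λ { (here refl) → ≤-refl }
    minimal f x (y ∷ ys) with minimal f y ys
    ... | m , m∈ , min with f x ≤? f m
    ...   | yes h = x , here refl , λ { (here refl) → ≤-refl ; (there p) → ≤-trans h (min p) }
    ...   | no h  = m , there m∈ , λ { (here refl) → <⇒≤ (≰⇒> h) ; (there p) → min p }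

    -- Paths may repeat vertices, so there can be infinitely many. Every edge has length at least
    -- `m`, so beyond `h` hops a path is no shorter than `p`, and a minimum over the finitely many
    -- others suffices.
    shortest : ∀ {m} → 0# < m → (∀ {x y} → x ≢ y → m ≤ d x y) → ∀ {H : Graph n} {U x y} (p : Path H U x y) →
      ∃[ δ ] IsGraphDistance M H U x y δ × δ ≤ length M p
    shortest {m} 0<m far {H} {U} {x} {y} p = go (archimedean (length M p * m ⁻¹))
      where
        go : ∃[ h ] length M p * m ⁻¹ ≤ fromℕ h → ∃[ δ ] IsGraphDistance M H U x y δ × δ ≤ length M p
        go (h , hb) = choose (paths-complete H U h p hops≤)
          where
            bound : length M p ≤ fromℕ h * m
            bound = ≤-trans (≤-reflexive (sym (trans (*-assoc _ (m ⁻¹) m) (trans (cong (length M p *_) (*-⁻¹ˡ 0<m)) (*-identityʳ _)))))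
                            (*-monoˡ-≤ (<⇒≤ 0<m) hb)
            hops≤ : hops p ℕ.≤ h
            hops≤ = fromℕ-reflects _ _ (*-cancelʳ-≤ 0<m (≤-trans (hops-length far p) bound))
            choose : ∃[ c ] c ∈ paths H U h x y × length M c ≡ length M p → ∃[ δ ] IsGraphDistance M H U x y δ × δ ≤ length M p
            choose (c , c∈ , e) = pick (paths H U h x y) refl c∈
              where
                pick : ∀ ps → ps ≡ paths H U h x y → c ∈ ps → ∃[ δ ] IsGraphDistance M H U x y δ × δ ≤ length M p
                pick (p₀ ∷ ps) ps≡ c∈′ with minimal (length M) p₀ ps
                ... | b , b∈ , min = length M b , ((b , refl) , all) , b≤p
                  where
                    b≤p : length M b ≤ length M p
                    b≤p = ≤-trans (min c∈′) (≤-reflexive e)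
                    all : ∀ q → length M b ≤ length M q
                    all q with hops q ℕ.≤? h
                    ... | no q>h = ≤-trans b≤p (≤-trans bound (≤-trans (*-monoˡ-≤ (<⇒≤ 0<m) (fromℕ-mono (ℕ.<⇒≤ (ℕ.≰⇒> q>h)))) (hops-length far q)))
                    ... | yes q≤h with paths-complete H U h q q≤h
                    ...   | c′ , c′∈ , e′ = ≤-trans (min (subst (c′ ∈_) (sym ps≡) c′∈)) (≤-reflexive e′)

    distance : ∀ {m} → 0# < m → (∀ {x y} → x ≢ y → m ≤ d x y) → ∀ {H : Graph n} {U x y ℓ} →
      Σ[ p ∈ Path H U x y ] length M p ≤ ℓ → ∃[ δ ] IsGraphDistance M H U x y δ × δ ≤ ℓ
    distance 0<m far (p , l) with shortest 0<m far p
    ... | δ , isδ , δ≤ = δ , isδ , ≤-trans δ≤ l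

    shortPath? : ∀ (H : Graph n) U x y ℓ D → Dec (ShortPath H U x y ℓ D)
    shortPath? H U x y ℓ D with any? (λ p → length M p ≤? ℓ) (paths H U D x y)
    ... | yes a with find a
    ...   | p , p∈ , h = yes (p , h , paths-hops H U D x y p∈)
    shortPath? H U x y ℓ D | no ¬a = no λ (p , h , hb) → let (c , c∈ , e) = paths-complete H U D p hb
                                                          in ¬a (lose c∈ (≤-trans (≤-reflexive e) h))

    hopDiameter : ∀ t (H : Graph n) D → HopBound M t H D → ∃[ D′ ] IsHopDiameter M t H D′ × D′ ℕ.≤ D
    hopDiameter t H D hb with least (λ D → Fin.all? λ x → Fin.all? λ y → shortPath? H ⊤ x y (t * d x y) D) D hb
    ... | D′ , hb′ , min = D′ , (hb′ , min) , min D hb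

unique-⊆-length : ∀ {n} (xs ys : List (Fin n)) → Unique xs → (∀ {x} → x ∈ xs → x ∈ ys) →
  List.length xs ℕ.≤ List.length ys
unique-⊆-length xs ys u h = begin
  List.length xs ≡⟨ sym (trans (∑-const 1 xs) (ℕ.*-identityʳ _)) ⟩
  ∑ (λ _ → 1) xs ≤⟨ ∑-mono xs (λ {x} x∈ → ℕ.≤-trans (ℕ.≤-reflexive (sym (ind-yes (x Fin.≟ x) refl 1)))
                      (∑-∈ (λ y → ind (y Fin.≟ x) 1) (h x∈))) ⟩
  ∑ (λ x → ∑ (λ y → ind (y Fin.≟ x) 1) ys) xs ≡⟨ ∑-swap (λ x y → ind (y Fin.≟ x) 1) xs ys ⟩
  ∑ (λ y → ∑ (λ x → ind (y Fin.≟ x) 1) xs) ys ≤⟨ ∑-≤-const 1 ys (λ {y} _ → unique-ind y 1 xs u) ⟩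
  List.length ys ℕ.* 1 ≡⟨ ℕ.*-identityʳ _ ⟩
  List.length ys ∎
  where open ℕ.≤-Reasoning

-- Tours through a connected graph and the weight of separated points.

module Tours (𝓡 : CompleteOrderedField) where

  open OrderedField 𝓡
  open Spanners 𝓡
  open Graphs 𝓡

  module _ {n : ℕ} (M : Metric n) (T : Graph n) where

    open Metric M
    open Weights M using (when; 0≤when)
    open FromPairs {n} using (does-⇔)
    open DecMembership (Fin._≟_ {n}) using (_∈?_)

    private X = Fin n

    e : X → X → ℝ
    e x y = when (Graph.adj T x y) (d x y)

    e-sym : ∀ x y → e x y ≡ e y x
    e-sym x y = cong₂ when (Graph.adj-sym T x y) (d-sym x y)

    0≤e : ∀ x y → 0# ≤ e x y
    0≤e x y = 0≤when (Graph.adj T x y) (d-nonneg x y)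

    ∑ℝ-↭ : (f : X → ℝ) → ∀ {xs ys} → xs ↭ ys → ∑ℝ f xs ≡ ∑ℝ f ys
    ∑ℝ-↭ f Perm.refl = refl
    ∑ℝ-↭ f (prep x p) = cong (f x +_) (∑ℝ-↭ f p)
    ∑ℝ-↭ f (swap {xs} {ys} x y p) = trans (cong (λ t → f x + (f y + t)) (∑ℝ-↭ f p))
      (solve 3 (λ a b c → a :+ (b :+ c) := b :+ (a :+ c)) refl (f x) (f y) (∑ℝ f ys))
    ∑ℝ-↭ f (Perm.trans p q) = trans (∑ℝ-↭ f p) (∑ℝ-↭ f q)

    ∑ℝ-∈ : ∀ x {y ys} → y ∈ ys → e x y ≤ ∑ℝ (e x) ys
    ∑ℝ-∈ x {ys = y ∷ ys} (here refl) = x≤x+y _ (0≤∑ ys)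
      where 0≤∑ : ∀ zs → 0# ≤ ∑ℝ (e x) zs
            0≤∑ []       = ≤-refl
            0≤∑ (z ∷ zs) = +-nonNegative (0≤e x z) (0≤∑ zs)
    ∑ℝ-∈ x {ys = z ∷ ys} (there p) = ≤-trans (∑ℝ-∈ x p) (≤-trans (x≤x+y _ (0≤e x z)) (≤-reflexive (+-comm _ _)))

    -- For a list without repetitions, the weight of the subgraph of `T` induced on it.
    inner : List X → ℝ
    inner []       = 0#
    inner (x ∷ xs) = ∑ℝ (e x) xs + inner xs

    inner-↭ : ∀ {xs ys} → xs ↭ ys → inner xs ≡ inner ys
    inner-↭ Perm.refl = refl
    inner-↭ (prep x p) = cong₂ _+_ (∑ℝ-↭ (e x) p) (inner-↭ p)
    inner-↭ (swap {xs} {ys} x y p) = trans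
      (cong₂ (λ a b → (e x y + a) + b) (∑ℝ-↭ (e x) p) (cong₂ _+_ (∑ℝ-↭ (e y) p) (inner-↭ p)))
      (trans (cong (λ t → (t + ∑ℝ (e x) ys) + (∑ℝ (e y) ys + inner ys)) (e-sym x y))
        (solve 4 (λ a b c f → (a :+ b) :+ (c :+ f) := (a :+ c) :+ (b :+ f)) refl (e y x) (∑ℝ (e x) ys) (∑ℝ (e y) ys) (inner ys)))
    inner-↭ (Perm.trans p q) = trans (inner-↭ p) (inner-↭ q)

    inner-tabulate : ∀ {m} (f : Fin m → X) →
      inner (tabulate f) ≡ sum (λ x → sum (λ y → when ⌊ x Fin.<? y ⌋ (e (f x) (f y))))
    inner-tabulate {zero}  f = refl
    inner-tabulate {suc m} f = cong₂ _+_
      (trans (row (f ∘ suc)) (sym (+-identityˡ _)))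
      (trans (inner-tabulate (f ∘ suc)) (sum-cong {m} {λ x → sum (λ y → when ⌊ x Fin.<? y ⌋ (e (f (suc x)) (f (suc y))))}
        (λ x → sym (trans (+-identityˡ _) (sum-cong {m} {λ y → when ⌊ suc x Fin.<? suc y ⌋ (e (f (suc x)) (f (suc y)))}
          (λ y → cong (λ b → when b (e (f (suc x)) (f (suc y)))) (does-⇔ (suc x Fin.<? suc y) (x Fin.<? y) ℕ.≤-pred s≤s)))))))
      where
        row : ∀ {m} (g : Fin m → X) → ∑ℝ (e (f zero)) (tabulate g) ≡ sum (λ y → e (f zero) (g y))
        row {zero}  g = refl
        row {suc m} g = cong (e (f zero) (g zero) +_) (row (g ∘ suc))
        sum-cong : ∀ {m} {g h : Fin m → ℝ} → (∀ x → g x ≡ h x) → sum g ≡ sum h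
        sum-cong {zero}  eq = refl
        sum-cong {suc m} eq = cong₂ _+_ (eq zero) (sum-cong (eq ∘ suc))

    inner-all : inner (allFin n) ≤ weight M T
    inner-all = ≤-trans (≤-reflexive (inner-tabulate id)) (sum-mono λ x → sum-mono λ y → cell ⌊ x Fin.<? y ⌋ (Graph.adj T x y))
      where cell : ∀ a b {v} → when a (when b v) ≤ when (a ∧ b) v
            cell true  b = ≤-refl
            cell false b = ≤-refl

    tour : X → List X → ℝ
    tour x []       = 0#
    tour x (y ∷ ys) = d x y + tour y ys

    insert : ∀ {u} → X → ∀ x xs → u ∈ x ∷ xs → List X
    insert v x xs       (here _)  = v ∷ xs
    insert v x (y ∷ ys) (there p) = y ∷ insert v y ys p

    insert-↭ : ∀ {u} v x xs (p : u ∈ x ∷ xs) → x ∷ insert v x xs p ↭ v ∷ x ∷ xs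
    insert-↭ v x xs       (here _)  = swap x v ↭-refl
    insert-↭ v x (y ∷ ys) (there p) = ↭-trans (prep x (insert-↭ v y ys p)) (swap x v ↭-refl)

    -- The vertex `v` is visited right after `u`; by the triangle inequality this costs no more than
    -- going from `u` to `v` and back.
    insert-tour : ∀ {u} v x xs (p : u ∈ x ∷ xs) → tour x (insert v x xs p) ≤ tour x xs + (d v u + d v u)
    insert-tour v x [] (here refl) = ≤-trans (≤-reflexive (trans (+-identityʳ _) (d-sym x v)))
      (≤-trans (x≤x+y _ (d-nonneg v x)) (≤-reflexive (sym (+-identityˡ _))))
    insert-tour v x (z ∷ zs) (here refl) = ≤-trans
      (+-mono-≤ (≤-reflexive (d-sym x v)) (+-monoˡ-≤ (tour z zs) (d-triangle v x z)))
      (≤-reflexive (solve 3 (λ a b t → a :+ ((a :+ b) :+ t) := (b :+ t) :+ (a :+ a)) refl (d v x) (d x z) (tour z zs)))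
    insert-tour v x (y ∷ ys) (there p) = ≤-trans (+-monoʳ-≤ (d x y) (insert-tour v y ys p)) (≤-reflexive (sym (+-assoc _ _ _)))

    record Tour : Set where
      field
        x₀     : X
        xs     : List X
        unique : Unique (x₀ ∷ xs)
        short  : tour x₀ xs ≤ inner (x₀ ∷ xs) + inner (x₀ ∷ xs)

      support : List X
      support = x₀ ∷ xs

    open Tour

    -- The tour grows by at most twice the edge from `u` to `v`, and `inner` gains at least that
    -- edge, so the factor 2 persists.
    extend : ∀ t {u v} → u ∈ support t → v ∉ support t → Graph.Adj T u v →
      Σ[ t′ ∈ Tour ] v ∈ support t′ × (∀ {x} → x ∈ support t → x ∈ support t′)
    extend t {u} {v} u∈ v∉ a = record { x₀ = x₀ t ; xs = ins ; unique = unique-↭ (↭-sym perm) (All.tabulate (λ {x} x∈ v≡x → v∉ (subst (_∈ support t) (sym v≡x) x∈)) ∷ unique t) ; short = short′ } ,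
      ∈-resp-↭ (↭-sym perm) (here refl) , λ x∈ → ∈-resp-↭ (↭-sym perm) (there x∈)
      where
        ins = insert v (x₀ t) (xs t) u∈
        perm : x₀ t ∷ ins ↭ v ∷ support t
        perm = insert-↭ v (x₀ t) (xs t) u∈
        I = inner (support t)
        dvu≤ : d v u ≤ ∑ℝ (e v) (support t)
        dvu≤ = ≤-trans (≤-reflexive (sym (cong (λ b → when b (d v u)) (trans (Graph.adj-sym T v u) a)))) (∑ℝ-∈ v u∈)
        grow : I + d v u ≤ inner (x₀ t ∷ ins)
        grow = ≤-trans (+-monoʳ-≤ I dvu≤) (≤-reflexive (trans (+-comm I _) (sym (inner-↭ perm))))
        short′ : tour (x₀ t) ins ≤ inner (x₀ t ∷ ins) + inner (x₀ t ∷ ins)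
        short′ = ≤-trans (insert-tour v (x₀ t) (xs t) u∈) (≤-trans (+-monoˡ-≤ _ (short t))
          (≤-trans (≤-reflexive (solve 2 (λ i w → (i :+ i) :+ (w :+ w) := (i :+ w) :+ (i :+ w)) refl I (d v u))) (+-mono-≤ grow grow)))

    Extension : Tour → X → Set
    Extension t y = Σ[ t′ ∈ Tour ] y ∈ support t′ × (∀ {x} → x ∈ support t → x ∈ support t′)

    follow : ∀ {u y} → Path T ⊤ u y → ∀ t → u ∈ support t → Extension t y
    follow (stop _) t u∈ = t , u∈ , id
    follow (step {y = v} _ a p) t u∈ with v ∈? support t
    ... | yes v∈ = follow p t v∈
    ... | no v∉ with extend t u∈ v∉ a
    ...   | t′ , v∈ , sub with follow p t′ v∈
    ...     | t″ , y∈ , sub′ = t″ , y∈ , sub′ ∘ sub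

    module _ (connected : Connected T) (o : X) where

      complete : ∀ ys → Σ[ t ∈ Tour ] (∀ {y} → y ∈ ys → y ∈ support t)
      complete [] = record { x₀ = o ; xs = [] ; unique = [] ∷ [] ; short = ≤-reflexive (sym (trans (cong₂ _+_ z z) z)) } , λ ()
        where z : 0# + 0# ≡ 0#
              z = +-identityˡ 0#
      complete (y ∷ ys) with complete ys
      ... | t , all with follow (connected (x₀ t) y) t (here refl)
      ...   | t′ , y∈ , sub = t′ , λ { (here refl) → y∈ ; (there p) → sub (all p) }

      grandTour : Σ[ t ∈ Tour ] (∀ x → x ∈ support t) × tour (x₀ t) (xs t) ≤ weight M T + weight M T
      grandTour with complete (allFin n)
      ... | t , all = t , (λ x → all (∈-allFin x)) , ≤-trans (short t) (+-mono-≤ le le)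
        where
          perm : support t ↭ allFin n
          perm = ∼bag⇒↭ (unique∧set⇒bag (unique t) (Unique.allFin⁺ n) (λ {x} → mk⇔ (λ _ → ∈-allFin x) (λ _ → all (∈-allFin x))))
          le : inner (support t) ≤ weight M T
          le = ≤-trans (≤-reflexive (inner-↭ perm)) inner-all

      tour-nonneg : ∀ x xs → 0# ≤ tour x xs
      tour-nonneg x []       = ≤-refl
      tour-nonneg x (y ∷ ys) = +-nonNegative (d-nonneg x y) (tour-nonneg y ys)

      tour-⊆ : ∀ x {ys xs} → ys ⊆ xs → tour x ys ≤ tour x xs
      tour-⊆ x {xs = xs} [] = ≤-refl
      tour-⊆ x (_∷_ {y} refl s) = +-monoʳ-≤ (d x y) (tour-⊆ y s)
      tour-⊆ x {[]} {y ∷ xs} (.y ∷ʳ s) = tour-nonneg x (y ∷ xs)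
      tour-⊆ x {z ∷ zs} {y ∷ xs} (.y ∷ʳ s) = ≤-trans (+-monoˡ-≤ (tour z zs) (d-triangle x y z))
        (≤-trans (≤-reflexive (+-assoc (d x y) (d y z) (tour z zs))) (+-monoʳ-≤ (d x y) (tour-⊆ y s)))

      tour-far : ∀ {s} x ys → Unique (x ∷ ys) → (∀ {a b} → a ∈ x ∷ ys → b ∈ x ∷ ys → a ≢ b → s ≤ d a b) →
        fromℕ (List.length ys) * s ≤ tour x ys
      tour-far {s} x [] u h = ≤-reflexive (zeroˡ s)
      tour-far {s} x (y ∷ ys) ((x≢y ∷ _) ∷ u) h =
        ≤-trans (≤-reflexive (trans (distribʳ s 1# _) (cong (_+ fromℕ (List.length ys) * s) (*-identityˡ s))))
          (+-mono-≤ (h (here refl) (there (here refl)) x≢y) (tour-far y ys u (λ a∈ b∈ → h (there a∈) (there b∈))))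

      -- Shortcutting the grand tour to the given points leaves at least one leg for each entry of
      -- `zs`, and each leg has length at least `s`.
      far-weight : ∀ {s} → 0# ≤ s → ∀ z zs → Unique (z ∷ zs) → (∀ {a b} → a ∈ z ∷ zs → b ∈ z ∷ zs → a ≢ b → s ≤ d a b) →
        fromℕ (List.length zs) * s ≤ weight M T + weight M T
      far-weight {s} 0≤s z zs u far with grandTour
      ... | t , all , short′ = go (filter (_∈? (z ∷ zs)) (support t)) refl
        where
          F = filter (_∈? (z ∷ zs)) (support t)
          len : List.length (z ∷ zs) ℕ.≤ List.length F
          len = unique-⊆-length (z ∷ zs) F u (λ {x} x∈ → ∈-filter⁺ (_∈? (z ∷ zs)) (all x) x∈)
          F-∈ : ∀ {x} → x ∈ F → x ∈ z ∷ zs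
          F-∈ = proj₂ ∘ ∈-filter⁻ (_∈? (z ∷ zs)) {xs = support t}
          from-start : ∀ {ys} → ys ⊆ support t → ∀ {y ys′} → ys ≡ y ∷ ys′ → tour y ys′ ≤ tour (x₀ t) (xs t)
          from-start (_∷_ {y} refl s) refl = tour-⊆ y s
          from-start (_ ∷ʳ s) {y} {ys′} refl = ≤-trans (≤-trans (x≤x+y _ (d-nonneg (x₀ t) y)) (≤-reflexive (+-comm _ _))) (tour-⊆ (x₀ t) s)
          go : ∀ ys → ys ≡ F → fromℕ (List.length zs) * s ≤ weight M T + weight M T
          go [] eq with () ← subst (λ l → List.length (z ∷ zs) ℕ.≤ List.length l) (sym eq) len
          go (y ∷ ys) eq = ≤-trans (*-monoˡ-≤ 0≤s (fromℕ-mono (ℕ.≤-pred (subst (λ l → List.length (z ∷ zs) ℕ.≤ List.length l) (sym eq) len))))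
            (≤-trans (tour-far y ys (subst Unique (sym eq) (Unique.filter⁺ (_∈? (z ∷ zs)) (unique t)))
                       (λ a∈ b∈ → far (F-∈ (subst (_ ∈_) eq a∈)) (F-∈ (subst (_ ∈_) eq b∈))))
            (≤-trans (from-start (filter-⊆ (_∈? (z ∷ zs)) (support t)) (sym eq)) short′))

      d≤weight : ∀ x y → d x y ≤ weight M T + weight M T
      d≤weight x y with x Fin.≟ y
      ... | yes refl = ≤-trans (≤-reflexive (d-refl x)) (+-nonNegative w w)
        where w : 0# ≤ weight M T
              w = sum-nonneg _ λ a → sum-nonneg _ λ b → 0≤when (⌊ a Fin.<? b ⌋ ∧ Graph.adj T a b) (d-nonneg a b)
      ... | no x≢y = ≤-trans (≤-reflexive (sym (trans (cong (_* d x y) fromℕ-1) (*-identityˡ _))))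
            (far-weight (d-nonneg x y) x (y ∷ []) ((x≢y ∷ []) ∷ [] ∷ []) far)
        where
          far : ∀ {a b} → a ∈ x ∷ y ∷ [] → b ∈ x ∷ y ∷ [] → a ≢ b → d x y ≤ d a b
          far (here refl) (here refl) ne = ⊥-elim (ne refl)
          far (here refl) (there (here refl)) ne = ≤-refl
          far (there (here refl)) (here refl) ne = ≤-reflexive (d-sym x y)
          far (there (here refl)) (there (here refl)) ne = ⊥-elim (ne refl)

length-cover : {A B : Set} {P : A → B → Set} (P? : ∀ t q → Dec (P t q)) (ts : List A) (qs : List B) →
  (∀ {q} → q ∈ qs → ∃[ t ] t ∈ ts × P t q) → List.length qs ℕ.≤ ∑ (λ t → List.length (filter (P? t) qs)) ts
length-cover P? ts [] h = z≤n
length-cover {P = P} P? ts (q ∷ qs) h = begin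
  suc (List.length qs) ≤⟨ ℕ.+-mono-≤ one (length-cover P? ts qs (h ∘ there)) ⟩
  ∑ (λ t → ind (P? t q) 1) ts ℕ.+ ∑ (λ t → List.length (filter (P? t) qs)) ts ≡⟨ sym (∑-+ (λ t → ind (P? t q) 1) _ ts) ⟩
  ∑ (λ t → ind (P? t q) 1 ℕ.+ List.length (filter (P? t) qs)) ts ≡⟨ ∑-cong ts cons ⟩
  ∑ (λ t → List.length (filter (P? t) (q ∷ qs))) ts ∎
  where
    open ℕ.≤-Reasoning
    cons : ∀ t → ind (P? t q) 1 ℕ.+ List.length (filter (P? t) qs) ≡ List.length (filter (P? t) (q ∷ qs))
    cons t with P? t q
    ... | yes _ = refl
    ... | no _  = refl
    one : 1 ℕ.≤ ∑ (λ t → ind (P? t q) 1) ts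
    one with h (here refl)
    ... | t , t∈ , p = ℕ.≤-trans (ℕ.≤-reflexive (sym (ind-yes (P? t q) p 1))) (∑-∈ (λ t → ind (P? t q) 1) t∈)

-- From the doubling dimension to a scale with bounded packing.

module Doubling (𝓡 : CompleteOrderedField) {n : ℕ} (M : Spanners.Metric 𝓡 n) where

  open OrderedField 𝓡
  open Spanners 𝓡
  open Graphs 𝓡
  open Metric M
  open Paths M using (minimal)

  private X = Fin n

  0<d : ∀ {x y} → x ≢ y → 0# < d x y
  0<d {x} {y} x≢y = d-nonneg x y , λ e → x≢y (d-sep x y (sym e))

  record Closest : Set where
    field
      a b : X
      a≢b : a ≢ b
      closest : ∀ {x y} → x ≢ y → d a b ≤ d x y

  closestPair : ∀ {u v : X} → u ≢ v → Closest
  closestPair {u} {v} u≢v = go pairs refl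
    where
      distinct? : (p : X × X) → Dec (proj₁ p ≢ proj₂ p)
      distinct? (x , y) = ¬? (x Fin.≟ y)
      pairs = filter distinct? (cartesianProduct (allFin n) (allFin n))
      ∈pairs : ∀ {x y} → x ≢ y → (x , y) ∈ pairs
      ∈pairs {x} {y} ne = ∈-filter⁺ distinct? (∈-cartesianProduct⁺ (∈-allFin x) (∈-allFin y)) ne
      go : ∀ ps → ps ≡ pairs → Closest
      go [] e with () ← subst ((u , v) ∈_) (sym e) (∈pairs u≢v)
      go (p ∷ ps) e with minimal (λ (x , y) → d x y) p ps
      ... | (a , b) , ab∈ , min = record
        { a = a ; b = b
        ; a≢b = proj₂ (∈-filter⁻ distinct? {xs = cartesianProduct (allFin n) (allFin n)} (subst ((a , b) ∈_) e ab∈))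
        ; closest = λ ne → min (subst (_ ∈_) (sym e) (∈pairs ne)) }

  module _ (C : Closest) {dim : ℝ} (doubling : IsDoubling M dim) where

    open Closest C

    μ : ℝ
    μ = d a b

    0<μ : 0# < μ
    0<μ = 0<d a≢b

    half< : ∀ {r} → 0# < r → r * 2# ⁻¹ < r
    half< {r} 0<r = ≰⇒> λ h → <⇒≱ 0<r (+-cancelˡ-≤ r (≤-trans (≤-reflexive (sym r+r)) (≤-trans
        (≤-trans (*-monoˡ-≤ 0≤2 h) (≤-reflexive (trans (*-assoc r (2# ⁻¹) 2#) (trans (cong (r *_) (*-⁻¹ˡ 0<2)) (*-identityʳ r)))))
        (≤-reflexive (sym (+-identityʳ r))))))
      where r+r : r * 2# ≡ r + r
            r+r = solve 1 (λ r → r :* con 2 := r :+ r) refl r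

    -- A ball of radius μ / 2 is a single point, so the ball of radius μ about a
    -- needs two of them.
    1≤2dim : 1# ≤ dim + dim
    1≤2dim = ≤-by-contradiction λ 2dim<1 → ⊥-elim (contra (2^-below-half (<⇒≤ 2dim<1)) (doubling a μ 0<μ))
      where
        point : ∀ c {x} → d c x ≤ μ * 2# ⁻¹ → c ≡ x
        point c {x} h with c Fin.≟ x
        ... | yes e = e
        ... | no ne = ⊥-elim (<⇒≱ (half< 0<μ) (≤-trans (closest ne) h))
        contra : 2# ^ dim * 2# ≤ fromℕ 3 →
          (∃[ m ] fromℕ m ≤ 2# ^ dim × (Σ[ c ∈ (Fin m → X) ] (∀ y → d a y ≤ μ → ∃[ j ] d (c j) y ≤ μ * 2# ⁻¹))) → ⊥
        contra small (m , m≤ , c , cov) = count m (fromℕ-reflects (m ℕ.* 2) 3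
            (≤-trans (≤-reflexive (trans (fromℕ-* m 2) (cong (fromℕ m *_) fromℕ-2))) (≤-trans (*-monoˡ-≤ 0≤2 m≤) small))) c cov
          where
            count : ∀ m → m ℕ.* 2 ℕ.≤ 3 → (c : Fin m → X) → (∀ y → d a y ≤ μ → ∃[ j ] d (c j) y ≤ μ * 2# ⁻¹) → ⊥
            count zero _ c cov with () ← proj₁ (cov b ≤-refl)
            count (suc zero) _ c cov with cov a (≤-trans (≤-reflexive (d-refl a)) (<⇒≤ 0<μ)) | cov b ≤-refl
            ... | zero , h | zero , h′ = a≢b (trans (sym (point (c zero) h)) (point (c zero) h′))
            count (suc (suc m)) (s≤s (s≤s (s≤s ()))) c cov

    -- The rounded dimension is at most `1# + dim`, and `1#` is at most `dim + dim`; rounding thus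
    -- costs a constant factor and not an additive constant.
    ceil : ∃[ D ] 1 ℕ.≤ D × dim ≤ fromℕ D × fromℕ D ≤ fromℕ 3 * dim
    ceil with archimedean dim
    ... | m , h with least (λ D → dim ≤? fromℕ D) m h
    ...   | zero , hD , _ = ⊥-elim (<⇒≱ 0<1 (≤-trans 1≤2dim (≤-trans (+-mono-≤ hD hD) (≤-reflexive (+-identityˡ 0#)))))
    ...   | suc D , hD , min = suc D , s≤s z≤n , hD ,
            ≤-trans (+-mono-≤ 1≤2dim (<⇒≤ (≰⇒> (λ h′ → ℕ.<-irrefl refl (min D h′)))))
                    (≤-reflexive (solve 1 (λ x → (x :+ x) :+ x := (con 1 :+ (con 1 :+ (con 1 :+ con 0))) :* x) refl dim))

    module Packing (D : ℕ) (dim≤D : dim ≤ fromℕ D) where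

      cover : ∀ x r → 0# < r → ∃[ m ] m ℕ.≤ 2 ℕ.^ D ×
        (Σ[ c ∈ (Fin m → X) ] (∀ y → d x y ≤ r → ∃[ j ] d (c j) y ≤ r * 2# ⁻¹))
      cover x r 0<r with doubling x r 0<r
      ... | m , m≤ , c , cov = m , fromℕ-reflects m (2 ℕ.^ D)
        (≤-trans m≤ (≤-trans (^-upper 1≤2 D dim≤D) (≤-reflexive (sym (2^-fromℕ D))))) , c , cov

      -- The radius is halved `j` times, each time at the price of `2 ^ D` balls. In the end two
      -- points of one ball would be within `s + s` of each other.
      pack : ∀ {s} → 0# < s → ∀ j x qs → Unique qs → (∀ {q} → q ∈ qs → d x q ≤ fromℕ (2 ℕ.^ j) * s) →
        (∀ {q q′} → q ∈ qs → q′ ∈ qs → d q q′ ≤ s + s → q ≡ q′) → List.length qs ℕ.≤ (2 ℕ.^ D) ℕ.^ j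
      pack {s} 0<s zero x [] u near sep = z≤n
      pack {s} 0<s zero x (q ∷ []) u near sep = s≤s z≤n
      pack {s} 0<s zero x (q ∷ q′ ∷ qs) ((q≢q′ ∷ _) ∷ _) near sep =
        ⊥-elim (q≢q′ (sep (here refl) (there (here refl)) (≤-trans (d-triangle q x q′)
          (+-mono-≤ (≤-trans (≤-reflexive (d-sym q x)) (within (near (here refl)))) (within (near (there (here refl))))))))
        where within : ∀ {r} → r ≤ fromℕ 1 * s → r ≤ s
              within h = ≤-trans h (≤-reflexive (trans (cong (_* s) fromℕ-1) (*-identityˡ s)))
      pack {s} 0<s (suc j) x qs u near sep with cover x (fromℕ (2 ℕ.^ suc j) * s) (*-pos (0<fromℕ (ℕ.m^n>0 2 (suc j))) 0<s)
      ... | m , m≤ , c , cov = begin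
        List.length qs ≤⟨ length-cover in? (allFin m) qs (λ {q} q∈ → let (t , h) = cov q (near q∈) in t , ∈-allFin t , ≤-trans h (≤-reflexive radius)) ⟩
        ∑ (λ t → List.length (filter (in? t) qs)) (allFin m) ≤⟨ ∑-≤-const ((2 ℕ.^ D) ℕ.^ j) (allFin m) (λ {t} _ → part t) ⟩
        List.length (allFin m) ℕ.* (2 ℕ.^ D) ℕ.^ j ≡⟨ cong (ℕ._* (2 ℕ.^ D) ℕ.^ j) (length-tabulate {n = m} id) ⟩
        m ℕ.* (2 ℕ.^ D) ℕ.^ j ≤⟨ ℕ.*-monoˡ-≤ ((2 ℕ.^ D) ℕ.^ j) m≤ ⟩
        (2 ℕ.^ D) ℕ.^ suc j ∎
        where
          open ℕ.≤-Reasoning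
          in? : ∀ t q → Dec (d (c t) q ≤ fromℕ (2 ℕ.^ j) * s)
          in? t q = d (c t) q ≤? fromℕ (2 ℕ.^ j) * s
          radius : fromℕ (2 ℕ.^ suc j) * s * 2# ⁻¹ ≡ fromℕ (2 ℕ.^ j) * s
          radius = trans (cong (λ t → t * s * 2# ⁻¹) (trans (fromℕ-* 2 (2 ℕ.^ j)) (cong (_* fromℕ (2 ℕ.^ j)) fromℕ-2)))
            (trans (lem 2# (2# ⁻¹) (fromℕ (2 ℕ.^ j)) s) (trans (cong (_* (fromℕ (2 ℕ.^ j) * s)) (*-⁻¹ˡ 0<2)) (*-identityˡ _)))
            where lem : ∀ t i p s → t * p * s * i ≡ i * t * (p * s)
                  lem = solve 4 (λ t i p s → t :* p :* s :* i := i :* t :* (p :* s)) refl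
          part : ∀ t → List.length (filter (in? t) qs) ℕ.≤ (2 ℕ.^ D) ℕ.^ j
          part t = pack 0<s j (c t) (filter (in? t) qs) (Unique.filter⁺ (in? t) u)
            (λ q∈ → proj₂ (∈-filter⁻ (in? t) {xs = qs} q∈))
            (λ q∈ q′∈ → sep (proj₁ (∈-filter⁻ (in? t) {xs = qs} q∈)) (proj₁ (∈-filter⁻ (in? t) {xs = qs} q′∈)))

      module Scaling (γ′ : ℕ) (4≤γ′ : 4 ℕ.≤ γ′) where

        γ : ℕ
        γ = suc γ′

        half B Λ : ℕ
        half = 2 ℕ.^ γ′
        B    = 2 ℕ.^ γ
        -- With `t` half of the separation `B ^ i`, the crossing radius `2 * B ^ (2 + i)` is
        -- `4 * B * B` times `t`, that is `2 + 2γ` halvings.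
        Λ    = (2 ℕ.^ D) ℕ.^ (2 ℕ.+ (γ ℕ.+ γ))

        1≤B : 1 ℕ.≤ B
        1≤B = ℕ.m^n>0 2 γ

        0<2B : 0# < fromℕ (2 ℕ.* B)
        0<2B = 0<fromℕ (ℕ.≤-trans 1≤B (ℕ.m≤m+n B _))

        -- The closest pair is `2 * B` units apart, so a distance of at most `B` units forces
        -- equality.
        s : ℝ
        s = μ * fromℕ (2 ℕ.* B) ⁻¹

        0<s : 0# < s
        0<s = *-pos 0<μ (⁻¹-pos 0<2B)

        2Bs : fromℕ (2 ℕ.* B) * s ≡ μ
        2Bs = trans (lem (fromℕ (2 ℕ.* B)) μ (fromℕ (2 ℕ.* B) ⁻¹)) (trans (cong (_* μ) (*-⁻¹ʳ 0<2B)) (*-identityˡ μ))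
          where lem : ∀ t m i → t * (m * i) ≡ t * i * m
                lem = solve 3 (λ t m i → t :* (m :* i) := t :* i :* m) refl

        open Units 0<s

        discrete : ∀ {x y} → d x y ≤ ⟦ B ⟧ → x ≡ y
        discrete {x} {y} h with x Fin.≟ y
        ... | yes e = e
        ... | no ne = ⊥-elim (ℕ.<-irrefl refl (ℕ.<-≤-trans (ℕ.m<m+n B (ℕ.≤-trans 1≤B (ℕ.m≤m+n B 0)))
                        (⟦⟧-reflects (2 ℕ.* B) B (≤-trans (≤-reflexive 2Bs) (≤-trans (closest ne) h)))))

        n≤B^n : ∀ c → c ℕ.≤ B ℕ.^ c
        n≤B^n zero = z≤n
        n≤B^n (suc c) = begin
          suc c ≤⟨ ℕ.+-mono-≤ (ℕ.m^n>0 B {{ℕ.>-nonZero 1≤B}} c) (n≤B^n c) ⟩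
          B ℕ.^ c ℕ.+ B ℕ.^ c ≡⟨ cong (B ℕ.^ c ℕ.+_) (sym (ℕ.+-identityʳ _)) ⟩
          2 ℕ.* B ℕ.^ c ≤⟨ ℕ.*-monoˡ-≤ (B ℕ.^ c) (ℕ.*-monoʳ-≤ 2 (ℕ.m^n>0 2 γ′)) ⟩
          B ℕ.* B ℕ.^ c ∎
          where open ℕ.≤-Reasoning

        tops : ∀ (ps : List (X × X)) → ∃[ T ] (∀ {x y} → (x , y) ∈ ps → d x y ≤ ⟦ B ℕ.^ T ⟧)
        tops [] = 0 , λ ()
        tops ((x , y) ∷ ps) with ⟦⟧-unbounded (d x y) | tops ps
        ... | c , h | T , hs = c ℕ.⊔ T , λ
          { (here refl) → ≤-trans h (⟦⟧-mono (ℕ.≤-trans (n≤B^n c) (up (ℕ.m≤m⊔n c T))))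
          ; (there p) → ≤-trans (hs p) (⟦⟧-mono (up (ℕ.m≤n⊔m c T))) }
          where up : ∀ {i j} → i ℕ.≤ j → B ℕ.^ i ℕ.≤ B ℕ.^ j
                up = ℕ.^-monoʳ-≤ B {{ℕ.>-nonZero 1≤B}}

        packing : ∀ i p qs → Unique qs → (∀ {q} → q ∈ qs → d p q ≤ ⟦ 2 ℕ.* B ℕ.^ (2 ℕ.+ i) ⟧) →
          (∀ {q q′} → q ∈ qs → q′ ∈ qs → d q q′ ≤ ⟦ B ℕ.^ i ⟧ → q ≡ q′) → List.length qs ℕ.≤ Λ
        packing i p qs u near sep = pack 0<t (2 ℕ.+ (γ ℕ.+ γ)) p qs u
          (λ q∈ → ≤-trans (near q∈) (≤-reflexive big)) (λ q∈ q′∈ h → sep q∈ q′∈ (≤-trans h (≤-reflexive t+t)))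
          where
            t = ⟦ B ℕ.^ i ⟧ * 2# ⁻¹
            0<t : 0# < t
            0<t = *-pos (*-pos (0<fromℕ (ℕ.m^n>0 B {{ℕ.>-nonZero 1≤B}} i)) 0<s) (⁻¹-pos 0<2)
            t+t : t + t ≡ ⟦ B ℕ.^ i ⟧
            t+t = trans (lem ⟦ B ℕ.^ i ⟧ (2# ⁻¹)) (trans (cong (⟦ B ℕ.^ i ⟧ *_) (*-⁻¹ˡ 0<2)) (*-identityʳ _))
              where lem : ∀ v i → v * i + v * i ≡ v * (i * 2#)
                    lem = solve 2 (λ v i → v :* i :+ v :* i := v :* (i :* con 2)) refl
            powers : 2 ℕ.^ (2 ℕ.+ (γ ℕ.+ γ)) ≡ 4 ℕ.* (B ℕ.* B)
            powers = trans (ℕ.^-distribˡ-+-* 2 2 (γ ℕ.+ γ)) (cong (4 ℕ.*_) (ℕ.^-distribˡ-+-* 2 γ γ))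
            big : ⟦ 2 ℕ.* B ℕ.^ (2 ℕ.+ i) ⟧ ≡ fromℕ (2 ℕ.^ (2 ℕ.+ (γ ℕ.+ γ))) * t
            big = sym (trans (cong (λ z → fromℕ z * t) powers) (trans (cong (_* t) (trans (fromℕ-* 4 (B ℕ.* B))
                    (cong (_* fromℕ (B ℕ.* B)) (trans (fromℕ-* 2 2) (cong₂ _*_ fromℕ-2 fromℕ-2)))))
                    (trans (lem 2# (2# ⁻¹) (fromℕ (B ℕ.* B)) ⟦ B ℕ.^ i ⟧)
                    (trans (cong (λ z → 2# * (z * (fromℕ (B ℕ.* B) * ⟦ B ℕ.^ i ⟧))) (*-⁻¹ˡ 0<2))
                    (trans (cong (2# *_) (trans (*-identityˡ _) (trans (sym (⟦⟧-* (B ℕ.* B) (B ℕ.^ i))) (cong ⟦_⟧ (ℕ.*-assoc B B (B ℕ.^ i))))))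
                    (trans (cong (_* ⟦ B ℕ.^ (2 ℕ.+ i) ⟧) (sym fromℕ-2)) (sym (⟦⟧-* 2 (B ℕ.^ (2 ℕ.+ i))))))))))
              where lem : ∀ t i b v → (t * t * b) * (v * i) ≡ t * ((i * t) * (b * v))
                    lem = solve 4 (λ t i b v → (t :* t :* b) :* (v :* i) := t :* ((i :* t) :* (b :* v))) refl

        scale : Scale n
        scale = record
          { Le = λ x y c → d x y ≤ ⟦ c ⟧
          ; Le? = λ x y c → d x y ≤? ⟦ c ⟧
          ; Le-refl = λ x → ≤-reflexive (trans (d-refl x) (sym (zeroˡ s)))
          ; Le-sym = λ {x} {y} h → ≤-trans (≤-reflexive (d-sym y x)) h
          ; Le-trans = λ {x} {y} {z} {c} {c′} h h′ → ≤-trans (d-triangle x y z) (≤-trans (+-mono-≤ h h′) (≤-reflexive (sym (⟦⟧-+ c c′))))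
          ; Le-mono = λ c≤ h → ≤-trans h (⟦⟧-mono c≤)
          ; half = half ; B = B ; B≡ = refl
          ; 16≤half = ℕ.^-monoʳ-≤ 2 4≤γ′
          ; discrete = discrete
          ; top = proj₁ T ; Le-top = λ x y → proj₂ T (∈-cartesianProduct⁺ (∈-allFin x) (∈-allFin y))
          ; Λ = Λ ; packing = packing
          }
          where T = tops (cartesianProduct (allFin n) (allFin n))

-- Degree, stretch, hops and weight of the constructed graph.

module Result (𝓡 : CompleteOrderedField) {n : ℕ} (M : Spanners.Metric 𝓡 n) (𝓢 : Scale n)
  (s : CompleteOrderedField.Carrier 𝓡) (0<s : CompleteOrderedField._<_ 𝓡 (CompleteOrderedField.0# 𝓡) s)
  (Le⇒ : ∀ {x y c} → Scale.Le 𝓢 x y c → CompleteOrderedField._≤_ 𝓡 (Spanners.Metric.d M x y) (CompleteOrderedField._*_ 𝓡 (CompleteOrderedField.fromℕ 𝓡 c) s))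
  (⇒Le : ∀ {x y c} → CompleteOrderedField._≤_ 𝓡 (Spanners.Metric.d M x y) (CompleteOrderedField._*_ 𝓡 (CompleteOrderedField.fromℕ 𝓡 c) s) → Scale.Le 𝓢 x y c)
  (k : ℕ) (1≤k : 1 ℕ.≤ k) (2≤n : 2 ℕ.≤ n) (o : Fin n) (m : ℕ) (n<2^m : n ℕ.< 2 ℕ.^ m) where

  open OrderedField 𝓡
  open Spanners 𝓡
  open Graphs 𝓡
  open Tours 𝓡
  open Metric M
  open Units 0<s
  open FromPairs {n}
  open Weights M using (weight-≤)
  open Paths M

  Hb : ℕ
  Hb = 3 ℕ.* m

  Hb-spec : ∀ h → 2 ℕ.^ h ℕ.≤ n ℕ.* n ℕ.* n → h ℕ.≤ Hb
  Hb-spec h hb with h ℕ.≤? Hb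
  ... | yes p = p
  ... | no ¬p = ⊥-elim (ℕ.<-irrefl refl (ℕ.<-≤-trans (ℕ.^-monoʳ-< 2 (s≤s (s≤s z≤n)) (ℕ.≰⇒> ¬p)) (ℕ.≤-trans hb (begin
      n ℕ.* n ℕ.* n ≤⟨ ℕ.*-mono-≤ (ℕ.*-mono-≤ n≤ n≤) n≤ ⟩
      2 ℕ.^ m ℕ.* 2 ℕ.^ m ℕ.* 2 ℕ.^ m ≡⟨ lem (2 ℕ.^ m) ⟩
      (2 ℕ.^ m) ℕ.^ 3 ≡⟨ ℕ.^-*-assoc 2 m 3 ⟩
      2 ℕ.^ (m ℕ.* 3) ≡⟨ cong (2 ℕ.^_) (ℕ.*-comm m 3) ⟩
      2 ℕ.^ Hb ∎))))
    where
      open ℕ.≤-Reasoning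
      n≤ : n ℕ.≤ 2 ℕ.^ m
      n≤ = ℕ.<⇒≤ n<2^m
      lem : ∀ a → a ℕ.* a ℕ.* a ≡ a ℕ.* (a ℕ.* (a ℕ.* 1))
      lem = solve-∀

  open Nets 𝓢 hiding (points)
  open Hopping 𝓢 using (Conn; nil; edge; rev; _▸_; weak)
  open FaultTolerance 𝓢 k using (Bridged)
  open Construction 𝓢 o k Hb Hb-spec

  pair : Edge → Fin n × Fin n
  pair (x , y , _) = x , y

  H : Graph n
  H = graph (map pair edges)

  joined⇒linked : ∀ {x y} → Joined (map pair edges) x y → Linked edges x y
  joined⇒linked (_ , inj₁ p) with ∈-map⁻ pair p
  ... | (x , y , c) , e∈ , refl = c , inj₁ e∈
  joined⇒linked (_ , inj₂ p) with ∈-map⁻ pair p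
  ... | (x , y , c) , e∈ , refl = c , inj₂ e∈

  linked⇒adj : ∀ {x y} → x ≢ y → Linked edges x y → Graph.Adj H x y
  linked⇒adj ne (c , inj₁ e∈) = adj⁺ (map pair edges) (ne , inj₁ (∈-map⁺ pair e∈))
  linked⇒adj ne (c , inj₂ e∈) = adj⁺ (map pair edges) (ne , inj₂ (∈-map⁺ pair e∈))

  1≤Λ : 1 ℕ.≤ Λ
  1≤Λ = packing 0 o (o ∷ []) ([] ∷ []) (λ { (here refl) → Le-mono z≤n (Le-refl o) }) (λ { (here refl) (here refl) _ → refl })

  suck≤2k : suc k ℕ.≤ 2 ℕ.* k
  suck≤2k = ℕ.≤-trans (ℕ.+-monoˡ-≤ k 1≤k) (ℕ.≤-reflexive (cong (k ℕ.+_) (sym (ℕ.+-identityʳ k))))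

  1≤kk : 1 ℕ.≤ k ℕ.* k
  1≤kk = ℕ.*-mono-≤ 1≤k 1≤k

  maxDegree-bound : Graph.maxDegree H ℕ.≤ 64 ℕ.* (Λ ℕ.* (k ℕ.* k))
  maxDegree-bound = foldr-⊔-≤ (Graph.degree H) _ λ x → begin
    Graph.degree H x ≤⟨ degree-≤ H x (around x) (λ a → ∈around x (joined⇒linked (adj⁻ (map pair edges) a))) ⟩
    List.length (around x) ≤⟨ around-bound x ⟩
    6 ℕ.* suc k ℕ.* (Λ ℕ.* suc k) ℕ.+ (6 ℕ.+ Λ) ℕ.* 2
      ≤⟨ ℕ.+-mono-≤ (ℕ.*-mono-≤ (ℕ.*-monoʳ-≤ 6 suck≤2k) (ℕ.*-monoʳ-≤ Λ suck≤2k))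
           (ℕ.*-monoˡ-≤ 2 (ℕ.+-monoˡ-≤ Λ (ℕ.*-monoʳ-≤ 6 1≤Λ))) ⟩
    6 ℕ.* (2 ℕ.* k) ℕ.* (Λ ℕ.* (2 ℕ.* k)) ℕ.+ (6 ℕ.* Λ ℕ.+ Λ) ℕ.* 2 ≡⟨ lem₁ Λ k ⟩
    24 ℕ.* (Λ ℕ.* (k ℕ.* k)) ℕ.+ 14 ℕ.* (Λ ℕ.* 1)
      ≤⟨ ℕ.+-monoʳ-≤ (24 ℕ.* (Λ ℕ.* (k ℕ.* k))) (ℕ.*-monoʳ-≤ 14 (ℕ.*-monoʳ-≤ Λ 1≤kk)) ⟩
    24 ℕ.* (Λ ℕ.* (k ℕ.* k)) ℕ.+ 14 ℕ.* (Λ ℕ.* (k ℕ.* k)) ≡⟨ sym (ℕ.*-distribʳ-+ (Λ ℕ.* (k ℕ.* k)) 24 14) ⟩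
    -- Rounded up to a power of two, which is later absorbed into a power of `2 ^ D`.
    38 ℕ.* (Λ ℕ.* (k ℕ.* k)) ≤⟨ ℕ.*-monoˡ-≤ (Λ ℕ.* (k ℕ.* k)) (ℕ.m≤m+n 38 26) ⟩
    64 ℕ.* (Λ ℕ.* (k ℕ.* k)) ∎
    where
      open ℕ.≤-Reasoning
      lem₁ : ∀ l k → 6 ℕ.* (2 ℕ.* k) ℕ.* (l ℕ.* (2 ℕ.* k)) ℕ.+ (6 ℕ.* l ℕ.+ l) ℕ.* 2 ≡ 24 ℕ.* (l ℕ.* (k ℕ.* k)) ℕ.+ 14 ℕ.* (l ℕ.* 1)
      lem₁ = solve-∀

  -- Two linked vertices may coincide; the trivial path then replaces the edge, as `graph` drops
  -- loops.
  hop : ∀ {U x y} → x ∈ˢ U → y ∈ˢ U → Linked edges x y → ShortPath H U x y (d x y) 1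
  hop {U} {x} {y} x∈ y∈ l with x Fin.≟ y
  ... | yes refl = stop x∈ , d-nonneg x x , z≤n
  ... | no ne    = step x∈ (linked⇒adj ne l) (stop y∈) , ≤-reflexive (+-identityʳ _) , s≤s z≤n

  toPath : ∀ {x y c h} → Conn opened x y c h → ShortPath H ⊤ x y ⟦ c ⟧ h
  toPath nil = stop Subset.∈⊤ , *-nonNegative ≤-refl (<⇒≤ 0<s) , z≤n
  toPath (edge l∈ le) = relax (Le⇒ le) ℕ.≤-refl (hop Subset.∈⊤ Subset.∈⊤ (opened-linked l∈))
  toPath (rev p) = flip (toPath p)
  toPath (_▸_ {c = c} {c′ = c′} p q) = relax (≤-reflexive (sym (⟦⟧-+ c c′))) ℕ.≤-refl (join (toPath p) (toPath q))
  toPath (weak c≤ h≤ p) = relax (⟦⟧-mono c≤) h≤ (toPath p)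

  module Stretch {ε : ℝ} (0<ε : 0# < ε) (ε≤1 : ε ≤ 1#) (ε-large : fromℕ 128 ≤ fromℕ B * ε) where

    0≤ε = <⇒≤ 0<ε

    t : ℝ
    t = 1# + ε

    0≤t : 0# ≤ t
    0≤t = +-nonNegative 0≤1 0≤ε

    t≤2 : t ≤ 2#
    t≤2 = +-monoʳ-≤ 1# ε≤1

    unit : ℕ → ℝ
    unit i = ⟦ B ℕ.^ i ⟧

    0≤unit : ∀ i → 0# ≤ unit i
    0≤unit i = *-nonNegative (0≤fromℕ (B ℕ.^ i)) (<⇒≤ 0<s)

    ⟦⟧-unit : ∀ c i → ⟦ c ℕ.* B ℕ.^ i ⟧ ≡ fromℕ c * unit i
    ⟦⟧-unit c i = ⟦⟧-* c (B ℕ.^ i)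

    -- A pair farther apart than `B ^ suc i` tolerates a detour of 128 times `B ^ i`. The stretch
    -- argument uses 24 of these and the hop argument 92, and 128 is a power of two above both.
    slack : ∀ {x y} i → ¬ Le x y (B ℕ.^ suc i) → fromℕ 128 * unit i ≤ ε * d x y
    slack {x} {y} i far = ≤-trans (*-monoˡ-≤ (0≤unit i) ε-large) (≤-trans
      (≤-reflexive (solve 3 (λ b e u → b :* e :* u := e :* (b :* u)) refl (fromℕ B) ε (unit i)))
      (*-monoʳ-≤ 0≤ε (≤-trans (≤-reflexive (sym (⟦⟧-unit B i))) (<⇒≤ (≰⇒> (λ h → far (⇒Le h)))))))

    stretch : ∀ {x y} i c → ¬ Le x y (B ℕ.^ suc i) → c ℕ.≤ 128 → d x y + fromℕ c * unit i ≤ t * d x y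
    stretch {x} {y} i c far c≤ = ≤-trans (+-monoʳ-≤ (d x y) (≤-trans (*-monoˡ-≤ (0≤unit i) (fromℕ-mono c≤)) (slack i far)))
      (≤-reflexive (solve 2 (λ e d → d :+ e :* d := (con 1 :+ e) :* d) refl ε (d x y)))

    near : ∀ {x x′} i → anc i x′ ≡ anc i x → d x x′ ≤ fromℕ 4 * unit i
    near i e = ≤-trans (Le⇒ (Le-cluster i (sym e))) (≤-reflexive (⟦⟧-unit 4 i))

    detour : ∀ {x x′ y y′} i → anc i x′ ≡ anc i x → anc i y′ ≡ anc i y → d x′ y′ ≤ fromℕ 4 * unit i + (d x y + fromℕ 4 * unit i)
    detour {x} {x′} {y} {y′} i ex ey = ≤-trans (d-triangle x′ x y′) (+-mono-≤ (≤-trans (≤-reflexive (d-sym x′ x)) (near i ex))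
      (≤-trans (d-triangle x y y′) (+-monoʳ-≤ (d x y) (near i ey))))

    Connects : Subset n → Fin n → Fin n → Set
    Connects S x y = ∃[ h ] ShortPath H (∁ S) x y (t * d x y) h

    -- The pieces from `x` and `y` to the ends of the bridge have length at most `4 * B ^ i`, so for
    -- them the crude stretch 2 is enough. In total the detour is 8 + 8 for these pieces and 4 + 4
    -- for the displaced ends of the bridge.
    survive : ∀ (S : Subset n) → ∣ S ∣ ℕ.≤ k → ∀ i x y → x ∉ˢ S → y ∉ˢ S → Le x y (B ℕ.^ suc i) →
      Connects S x y
    survive S S≤k zero x y x∉ y∉ le with discrete (Le-mono (ℕ.≤-reflexive (ℕ.*-identityʳ B)) le)
    ... | refl = 0 , stop (Subset.x∉p⇒x∈∁p x∉) , *-nonNegative 0≤t (d-nonneg x x) , z≤n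
    survive S S≤k (suc i) x y x∉ y∉ le = decide (Le? x y (B ℕ.^ suc i))
      where
        assemble : Bridged edges S i x y →
          ¬ Le x y (B ℕ.^ suc i) → Connects S x y
        assemble (x′ , y′ , x′∉ , y′∉ , ex , ey , l) far =
          conclude (side x∉ x′∉ ex) (hop (Subset.x∉p⇒x∈∁p x′∉) (Subset.x∉p⇒x∈∁p y′∉) l) (side y∉ y′∉ ey)
          where
            u = fromℕ 4 * unit i
            side : ∀ {z z′} → z ∉ˢ S → z′ ∉ˢ S → anc i z′ ≡ anc i z → ∃[ h ] ShortPath H (∁ S) z z′ (2# * u) h
            side {z} {z′} z∉ z′∉ e = bound (survive S S≤k i z z′ z∉ z′∉
              (Le-mono (ℕ.≤-trans (*B^-step 4 {1} i (ℕ.m≤m+n 4 28)) (ℕ.≤-reflexive (ℕ.*-identityˡ _))) (Le-cluster i (sym e))))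
              where
                bound : Connects S z z′ → ∃[ h ] ShortPath H (∁ S) z z′ (2# * u) h
                bound (h , p) = h , relax (*-mono-≤ 0≤t (*-nonNegative (0≤fromℕ 4) (0≤unit i)) t≤2 (near i e)) ℕ.≤-refl p
            conclude : ∃[ h ] ShortPath H (∁ S) x x′ (2# * u) h → ShortPath H (∁ S) x′ y′ (d x′ y′) 1 →
              ∃[ h ] ShortPath H (∁ S) y y′ (2# * u) h → Connects S x y
            conclude (_ , p) q (_ , r) = _ , relax
              (≤-trans (+-monoʳ-≤ (2# * u) (+-monoˡ-≤ (2# * u) (detour i ex ey)))
                (≤-trans (≤-reflexive total) (stretch i 24 far (ℕ.m≤m+n 24 104))))
              ℕ.≤-refl (join p (join q (flip r)))
              where
                total : 2# * u + ((u + (d x y + u)) + 2# * u) ≡ d x y + fromℕ 24 * unit i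
                total = trans (solve 3 (λ d a v → con 2 :* (a :* v) :+ ((a :* v :+ (d :+ a :* v)) :+ con 2 :* (a :* v)) :=
                                   d :+ ((a :+ a) :+ (a :+ a) :+ (a :+ a)) :* v) refl (d x y) (fromℕ 4) (unit i))
                  (cong (λ z → d x y + z * unit i) (trans (cong₂ _+_ (trans (cong₂ _+_ 8≡ 8≡) (sym (fromℕ-+ 8 8))) 8≡) (sym (fromℕ-+ 16 8))))
                  where 8≡ = sym (fromℕ-+ 4 4)
        decide : Dec (Le x y (B ℕ.^ suc i)) → Connects S x y
        decide (yes le′) = survive S S≤k i x y x∉ y∉ le′
        decide (no far)  = assemble (bridge S S≤k i x∉ y∉ far le) far

    vfts : ∀ {μ} → 0# < μ → (∀ {x y} → x ≢ y → μ ≤ d x y) → IsVFTS M k t H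
    vfts 0<μ far S S≤k x y x∈ y∈ = distance 0<μ far (path (survive S S≤k top x y
        (Subset.x∈∁p⇒x∉p x∈) (Subset.x∈∁p⇒x∉p y∈) (Le-mono (B^-mono (ℕ.n≤1+n top)) (Le-top x y))))
      where path : Connects S x y → Σ[ p ∈ Path H (∁ S) x y ] length M p ≤ t * d x y
            path (_ , p , l , _) = p , l

    -- The bridge at the right level, taken with no faults, is a single hop. Its ends are reached
    -- inside the clusters of that level by two routes of `2 * Hb` hops and cost 42 each; with 4 + 4
    -- for the displacement this makes 92.
    hopBound : HopBound M t H (12 ℕ.* m ℕ.+ 1)
    hopBound x y = decide (x Fin.≟ y)
      where
        Goal : Set
        Goal = ShortPath H ⊤ x y (t * d x y) (12 ℕ.* m ℕ.+ 1)
        assemble : ∀ i → i ℕ.≤ top → ¬ Le x y (B ℕ.^ suc i) →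
          Bridged edges ∅ i x y → Goal
        assemble i i≤ far (x′ , y′ , _ , _ , ex , ey , l) = relax
          (≤-trans (+-mono-≤ (≤-reflexive (⟦⟧-unit 42 i)) (+-mono-≤ (detour i ex ey) (≤-reflexive (⟦⟧-unit 42 i))))
            (≤-trans (≤-reflexive total) (stretch i 92 far (ℕ.m≤m+n 92 36))))
          (ℕ.≤-reflexive (hops≡ m))
          (join (toPath (hop-within i i≤ (sym ex))) (join (hop Subset.∈⊤ Subset.∈⊤ l) (flip (toPath (hop-within i i≤ (sym ey))))))
          where
            hops≡ : ∀ m → 2 ℕ.* (3 ℕ.* m) ℕ.+ (1 ℕ.+ 2 ℕ.* (3 ℕ.* m)) ≡ 12 ℕ.* m ℕ.+ 1
            hops≡ = solve-∀
            v = unit i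
            total : fromℕ 42 * v + ((fromℕ 4 * v + (d x y + fromℕ 4 * v)) + fromℕ 42 * v) ≡ d x y + fromℕ 92 * v
            total = trans (solve 4 (λ a b d v → a :* v :+ ((b :* v :+ (d :+ b :* v)) :+ a :* v) := d :+ ((a :+ b) :+ (b :+ a)) :* v) refl (fromℕ 42) (fromℕ 4) (d x y) v)
              (cong (λ z → d x y + z * v) (trans (cong₂ _+_ (sym (fromℕ-+ 42 4)) (sym (fromℕ-+ 4 42))) (sym (fromℕ-+ 46 46))))
        find-level : x ≢ y → ∃[ l ] Le x y (B ℕ.^ l) × (∀ j → Le x y (B ℕ.^ j) → l ℕ.≤ j) → Goal
        find-level ne (0 , le , _) = ⊥-elim (ne (discrete (Le-mono 1≤B le)))
        find-level ne (1 , le , _) = ⊥-elim (ne (discrete (Le-mono (ℕ.≤-reflexive (ℕ.*-identityʳ B)) le)))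
        find-level ne (suc (suc i) , le , min) = assemble i (ℕ.≤-trans (ℕ.m≤n+m i 2) (min top (Le-top x y))) far
          (bridge ∅ (ℕ.≤-trans (ℕ.≤-reflexive (Subset.∣⊥∣≡0 n)) z≤n) i Subset.∉⊥ Subset.∉⊥ far le)
          where far : ¬ Le x y (B ℕ.^ suc i)
                far le′ = ℕ.<-irrefl refl (min (suc i) le′)
        decide : Dec (x ≡ y) → Goal
        decide (yes refl) = stop Subset.∈⊤ , *-nonNegative 0≤t (d-nonneg x x) , z≤n
        decide (no ne)    = find-level ne (least (λ l → Le? x y (B ℕ.^ l)) top (Le-top x y))

  length-deaths : ∀ i → List.length (deaths 0 i) ℕ.≤ ΦUpTo i
  length-deaths zero    = z≤n
  length-deaths (suc i) = ℕ.≤-trans (ℕ.≤-reflexive (length-++ (dying i)))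
    (ℕ.+-mono-≤ (ℕ.≤-trans (ℕ.≤-reflexive (sym (ℕ.*-identityʳ _))) (ℕ.*-monoʳ-≤ (List.length (dying i)) (1≤B^ i))) (length-deaths i))

  length-points : List.length (allFin n) ≡ n
  length-points = length-tabulate {n = n} id

  -- All points but `r` die, and each death is worth at least one unit. The leaf charge of `4 * n`
  -- units is thereby absorbed into `Φ`.
  n≤1+Φ : n ℕ.≤ suc Φ
  n≤1+Φ = ℕ.≤-trans (ℕ.≤-reflexive (sym length-points)) (ℕ.≤-trans
    (unique-⊆-length (allFin n) (r ∷ deaths 0 top) (Unique.allFin⁺ n) (λ {x} _ → cover x (alive? top x)))
    (s≤s (length-deaths top)))
    where cover : ∀ x → Dec (Alive top x) → x ∈ r ∷ deaths 0 top
          cover x (yes a) = here (trans (sym a) (anc-top x))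
          cover x (no ¬a) = there (dead⇒deaths top ¬a)

  1≤Φ : 1 ℕ.≤ Φ
  1≤Φ = ℕ.≤-pred (ℕ.≤-trans 2≤n n≤1+Φ)

  total-length : ∑ len edges ℕ.≤ 128 ℕ.* (B ℕ.* B) ℕ.* (Λ ℕ.* (k ℕ.* k)) ℕ.* Φ
  total-length = begin
    ∑ len edges ≤⟨ edges-weight ⟩
    9 ℕ.* (B ℕ.* B) ℕ.* (Λ ℕ.* (suc k ℕ.* suc k)) ℕ.* Φ ℕ.+ (6 ℕ.+ Λ) ℕ.* (n ℕ.* 4 ℕ.+ 4 ℕ.* B ℕ.* Φ)
      ≤⟨ ℕ.+-mono-≤ (ℕ.*-monoˡ-≤ Φ (ℕ.*-monoʳ-≤ (9 ℕ.* (B ℕ.* B)) (ℕ.*-monoʳ-≤ Λ (ℕ.*-mono-≤ suck≤2k suck≤2k))))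
           (ℕ.*-mono-≤ (ℕ.+-monoˡ-≤ Λ (ℕ.*-monoʳ-≤ 6 1≤Λ)) (ℕ.+-monoˡ-≤ (4 ℕ.* B ℕ.* Φ) (ℕ.*-monoˡ-≤ 4 n≤2ΦB))) ⟩
    9 ℕ.* (B ℕ.* B) ℕ.* (Λ ℕ.* (2 ℕ.* k ℕ.* (2 ℕ.* k))) ℕ.* Φ ℕ.+ (6 ℕ.* Λ ℕ.+ Λ) ℕ.* ((B ℕ.* Φ ℕ.+ B ℕ.* Φ) ℕ.* 4 ℕ.+ 4 ℕ.* B ℕ.* Φ)
      ≡⟨ lem₁ B Λ k Φ ⟩
    36 ℕ.* Q ℕ.+ 84 ℕ.* (B ℕ.* 1 ℕ.* (Λ ℕ.* 1) ℕ.* Φ)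
      ≤⟨ ℕ.+-monoʳ-≤ (36 ℕ.* Q) (ℕ.*-monoʳ-≤ 84 (ℕ.*-monoˡ-≤ Φ (ℕ.*-mono-≤ (ℕ.*-monoʳ-≤ B 1≤B) (ℕ.*-monoʳ-≤ Λ 1≤kk)))) ⟩
    36 ℕ.* Q ℕ.+ 84 ℕ.* Q ≡⟨ sym (ℕ.*-distribʳ-+ Q 36 84) ⟩
    120 ℕ.* Q ≤⟨ ℕ.*-monoˡ-≤ Q (ℕ.m≤m+n 120 8) ⟩
    128 ℕ.* Q ≡⟨ lem₂ 128 (B ℕ.* B) (Λ ℕ.* (k ℕ.* k)) Φ ⟩
    128 ℕ.* (B ℕ.* B) ℕ.* (Λ ℕ.* (k ℕ.* k)) ℕ.* Φ ∎
    where
      open ℕ.≤-Reasoning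
      Q = B ℕ.* B ℕ.* (Λ ℕ.* (k ℕ.* k)) ℕ.* Φ
      n≤2ΦB : n ℕ.≤ B ℕ.* Φ ℕ.+ B ℕ.* Φ
      n≤2ΦB = ℕ.≤-trans n≤1+Φ (ℕ.≤-trans (ℕ.+-monoˡ-≤ Φ 1≤Φ) (ℕ.+-mono-≤ Φ≤ Φ≤))
        where Φ≤ = ℕ.≤-trans (ℕ.≤-reflexive (sym (ℕ.*-identityˡ Φ))) (ℕ.*-monoˡ-≤ Φ 1≤B)
      lem₁ : ∀ b l k f → 9 ℕ.* (b ℕ.* b) ℕ.* (l ℕ.* (2 ℕ.* k ℕ.* (2 ℕ.* k))) ℕ.* f ℕ.+ (6 ℕ.* l ℕ.+ l) ℕ.* ((b ℕ.* f ℕ.+ b ℕ.* f) ℕ.* 4 ℕ.+ 4 ℕ.* b ℕ.* f)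
        ≡ 36 ℕ.* (b ℕ.* b ℕ.* (l ℕ.* (k ℕ.* k)) ℕ.* f) ℕ.+ 84 ℕ.* (b ℕ.* 1 ℕ.* (l ℕ.* 1) ℕ.* f)
      lem₁ = solve-∀
      lem₂ : ∀ c a b f → c ℕ.* (a ℕ.* b ℕ.* f) ≡ c ℕ.* a ℕ.* b ℕ.* f
      lem₂ = solve-∀

  weight-total : ∀ es → (∀ {x y c} → (x , y , c) ∈ es → Le x y c) → ∑ℝ (λ (x , y) → d x y) (map pair es) ≤ ⟦ ∑ len es ⟧
  weight-total [] h = ≤-reflexive (sym (zeroˡ s))
  weight-total ((x , y , c) ∷ es) h = ≤-trans (+-mono-≤ (Le⇒ (h (here refl))) (weight-total es (h ∘ there)))
    (≤-reflexive (sym (⟦⟧-+ c (∑ len es))))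

  d≤Δ : ∀ (T : Graph n) → Connected T → ∀ x y → d x y ≤ weight M T + weight M T
  d≤Δ T connected x y = d≤weight M T connected o x y

  module Lightness (T : Graph n) (connected : Connected T) where

    Δ : ℝ
    Δ = weight M T + weight M T

    0≤Δ : 0# ≤ Δ
    0≤Δ = ≤-trans (d-nonneg o o) (d≤Δ T connected o o)

    -- Adding the immortal `r` to the dying points gives one separated point more, so the tour has a
    -- full leg for each death.
    level : ∀ i → ⟦ List.length (dying i) ℕ.* B ℕ.^ i ⟧ ≤ Δ
    level i = ≤-trans (≤-reflexive (⟦⟧-* (List.length (dying i)) (B ℕ.^ i)))
      (far-weight M T connected o (*-nonNegative (0≤fromℕ (B ℕ.^ i)) (<⇒≤ 0<s)) r (dying i) unique
        (λ a∈ b∈ ne → <⇒≤ (≰⇒> (λ h → ne (alive-sep i (alive a∈) (alive b∈) (⇒Le h))))))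
      where
        r-alive : ∀ i → Alive i r
        r-alive i with i ℕ.≤? top
        ... | yes i≤ = alive-≤ i (top ℕ.∸ i) (subst (λ j → Alive j r) (sym (ℕ.m∸n+n≡m i≤)) (alive-anc top o))
        ... | no i≰ with alive? i r
        ...   | yes a = a
        ...   | no ¬a with deaths-∈ 0 i (dead⇒deaths i ¬a)
        ...     | j , _ , _ , dj@(_ , ¬aj) = ⊥-elim (¬aj (alive-≤ (suc j) (top ℕ.∸ suc j)
                    (subst (λ j → Alive j r) (sym (ℕ.m∸n+n≡m (dies<top j dj))) (alive-anc top o))))
        alive : ∀ {x} → x ∈ r ∷ dying i → Alive i x
        alive (here refl) = r-alive i
        alive (there x∈)  = proj₁ (dying-∈ i x∈)
        unique : Unique (r ∷ dying i)
        unique = All.tabulate (λ {x} x∈ e → proj₂ (dying-∈ i (subst (_∈ dying i) (sym e) x∈)) (r-alive (suc i))) ∷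
                 Unique.filter⁺ (dies? i) (Unique.allFin⁺ n)

    -- Below the first level where this fails, the deaths may be counted crudely as `n` times the
    -- scale. About `m` levels later the scale itself exceeds the diameter, which leaves `m` levels
    -- to pay `Δ` each.
    Low : ℕ → Set
    Low i = ⟦ n ℕ.* B ℕ.^ i ⟧ ≤ Δ

    threshold : ∃[ i₀ ] ¬ Low i₀ × (∀ j → ¬ Low j → i₀ ℕ.≤ j)
    threshold with ⟦⟧-unbounded Δ
    ... | c , h = least (λ i → ¬? (_ ≤? Δ)) (suc c) λ low → ℕ.<-irrefl refl
          (ℕ.≤-trans (ℕ.≤-trans (n<B^n (suc c)) (ℕ.≤-trans (ℕ.≤-reflexive (sym (ℕ.*-identityˡ _))) (ℕ.*-monoˡ-≤ _ (ℕ.≤-trans (s≤s z≤n) 2≤n))))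
                     (⟦⟧-reflects _ c (≤-trans low h)))
      where n<B^n : ∀ c → c ℕ.≤ B ℕ.^ c
            n<B^n zero = z≤n
            n<B^n (suc c) = ℕ.≤-trans (ℕ.+-mono-≤ (1≤B^ c) (n<B^n c)) (ℕ.≤-trans
              (ℕ.≤-reflexive (cong (B ℕ.^ c ℕ.+_) (sym (ℕ.+-identityʳ _)))) (ℕ.*-monoˡ-≤ (B ℕ.^ c) (ℕ.≤-trans (ℕ.m≤m+n 2 30) 32≤B)))

    i₀ : ℕ
    i₀ = proj₁ threshold

    -- Every death is valued at the scale of the topmost low level, and there are at most `n` of
    -- them.
    low-levels : ∀ i₀ → (∀ j → j ℕ.< i₀ → Low j) → ⟦ ΦUpTo i₀ ⟧ ≤ Δ
    low-levels zero    low = ≤-trans (≤-reflexive (zeroˡ s)) 0≤Δ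
    low-levels (suc i) low = ≤-trans (⟦⟧-mono (ℕ.≤-trans (geometric (suc i) ℕ.≤-refl)
        (ℕ.*-monoˡ-≤ (B ℕ.^ i) (ℕ.≤-trans (unique-⊆-length (deaths 0 (suc i)) (allFin n) (deaths-unique (suc i)) (λ {x} _ → ∈-allFin x))
          (ℕ.≤-reflexive length-points))))) (low i ℕ.≤-refl)
      where
        geometric : ∀ j → j ℕ.≤ suc i → ΦUpTo j ℕ.≤ List.length (deaths 0 j) ℕ.* B ℕ.^ i
        geometric zero    h = z≤n
        geometric (suc j) h = ℕ.≤-trans
          (ℕ.+-mono-≤ (ℕ.*-monoʳ-≤ (List.length (dying j)) (B^-mono (ℕ.≤-pred h))) (geometric j (ℕ.<⇒≤ h)))
          (ℕ.≤-reflexive (sym (trans (cong (ℕ._* B ℕ.^ i) (length-++ (dying j))) (ℕ.*-distribʳ-+ (B ℕ.^ i) (List.length (dying j)) _))))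

    -- From `i₀` on, `m` levels multiply the scale by more than `n`, which lifts it above `Δ`. A
    -- dying point would be farther than that from its parent.
    high-empty : ∀ j → m ℕ.≤ j → dying (j ℕ.+ i₀) ≡ []
    high-empty j m≤j = empty (dying (j ℕ.+ i₀)) (λ x∈ → contra (dying-∈ (j ℕ.+ i₀) x∈))
      where
        empty : ∀ (xs : List (Fin n)) → (∀ {x} → x ∈ xs → ⊥) → xs ≡ []
        empty [] _ = refl
        empty (x ∷ xs) h = ⊥-elim (h (here refl))
        contra : ∀ {x} → Dies (j ℕ.+ i₀) x → ⊥
        contra {x} (a , ¬a) = proj₁ (proj₂ threshold) (≤-trans (⟦⟧-mono bound) (≤-trans (<⇒≤ (≰⇒> (λ h →
            ¬a (sym (alive-sep (j ℕ.+ i₀) a (alive-pred (j ℕ.+ i₀) (alive-anc (suc (j ℕ.+ i₀)) x)) (⇒Le h))))))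
            (d≤Δ T connected x (anc (suc (j ℕ.+ i₀)) x))))
          where
            bound : n ℕ.* B ℕ.^ i₀ ℕ.≤ B ℕ.^ (j ℕ.+ i₀)
            bound = ℕ.≤-trans (ℕ.*-monoˡ-≤ (B ℕ.^ i₀) (ℕ.≤-trans (ℕ.<⇒≤ n<2^m) (ℕ.≤-trans (ℕ.^-monoʳ-≤ 2 m≤j)
              (ℕ.^-monoˡ-≤ j (ℕ.≤-trans (ℕ.m≤m+n 2 30) 32≤B))))) (ℕ.≤-reflexive (sym (ℕ.^-distribˡ-+-* B j i₀)))

    high-levels : ∀ j → ⟦ ΦUpTo (j ℕ.+ i₀) ⟧ ≤ fromℕ (suc (j ℕ.⊓ m)) * Δ
    high-levels zero = ≤-trans (low-levels i₀ (λ j j< → low j j<)) (≤-reflexive (sym (trans (cong (_* Δ) fromℕ-1) (*-identityˡ Δ))))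
      where
        low : ∀ j → j ℕ.< i₀ → Low j
        low j j< with ⟦ n ℕ.* B ℕ.^ j ⟧ ≤? Δ
        ... | yes h = h
        ... | no h  = ⊥-elim (ℕ.<-irrefl refl (ℕ.<-≤-trans j< (proj₂ (proj₂ threshold) j h)))
    high-levels (suc j) = decide (m ℕ.≤? j)
      where
        decide : Dec (m ℕ.≤ j) → ⟦ ΦUpTo (suc j ℕ.+ i₀) ⟧ ≤ fromℕ (suc (suc j ℕ.⊓ m)) * Δ
        decide (yes m≤j) = ≤-trans (≤-reflexive (cong (λ xs → ⟦ List.length xs ℕ.* B ℕ.^ (j ℕ.+ i₀) ℕ.+ ΦUpTo (j ℕ.+ i₀) ⟧) (high-empty j m≤j)))
          (≤-trans (high-levels j) (*-monoˡ-≤ 0≤Δ (fromℕ-mono (s≤s (ℕ.⊓-monoˡ-≤ m (ℕ.n≤1+n j))))))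
        decide (no m≰j) = ≤-trans (≤-reflexive (⟦⟧-+ (List.length (dying (j ℕ.+ i₀)) ℕ.* B ℕ.^ (j ℕ.+ i₀)) (ΦUpTo (j ℕ.+ i₀))))
          (≤-trans (+-mono-≤ (level (j ℕ.+ i₀)) (high-levels j))
          (≤-trans (≤-reflexive (sym (trans (distribʳ Δ 1# (fromℕ (suc (j ℕ.⊓ m)))) (cong (_+ fromℕ (suc (j ℕ.⊓ m)) * Δ) (*-identityˡ Δ)))))
            (*-monoˡ-≤ 0≤Δ (fromℕ-mono (s≤s (ℕ.≤-reflexive (trans (cong suc (ℕ.m≤n⇒m⊓n≡m (ℕ.<⇒≤ j<m))) (sym (ℕ.m≤n⇒m⊓n≡m j<m)))))))))
          where j<m = ℕ.≰⇒> m≰j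

    Φ-bound : ⟦ Φ ⟧ ≤ fromℕ (suc m) * Δ
    Φ-bound = ≤-trans (⟦⟧-mono (mono top i₀)) (≤-trans (high-levels top) (*-monoˡ-≤ 0≤Δ (fromℕ-mono (s≤s (ℕ.m⊓n≤n top m)))))
      where
        mono : ∀ a b → ΦUpTo a ℕ.≤ ΦUpTo (a ℕ.+ b)
        mono a zero    = ℕ.≤-reflexive (cong ΦUpTo (sym (ℕ.+-identityʳ a)))
        mono a (suc b) = ℕ.≤-trans (mono a b) (ℕ.≤-trans (ℕ.m≤n+m _ _) (ℕ.≤-reflexive (cong ΦUpTo (sym (ℕ.+-suc a b)))))

    weight-bound : weight M H ≤ fromℕ (128 ℕ.* (B ℕ.* B) ℕ.* (Λ ℕ.* (k ℕ.* k))) * (fromℕ (suc m) * Δ)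
    weight-bound = ≤-trans (weight-≤ (map pair edges)) (≤-trans (weight-total edges edges-Le) (≤-trans (⟦⟧-mono total-length)
      (≤-trans (≤-reflexive (⟦⟧-* Q Φ)) (*-monoʳ-≤ (0≤fromℕ Q) Φ-bound))))
      where Q = 128 ℕ.* (B ℕ.* B) ℕ.* (Λ ℕ.* (k ℕ.* k))

distinctPoints : ∀ {n} → 2 ℕ.≤ n → Σ[ u ∈ Fin n ] Σ[ v ∈ Fin n ] u ≢ v
distinctPoints (s≤s (s≤s _)) = zero , suc zero , λ ()

-- Choice of constants and assembly of the bounds.

module Main (𝓡 : CompleteOrderedField) where

  open OrderedField 𝓡
  open Spanners 𝓡
  open Graphs 𝓡

  ⌊log₂⌋ : ∀ n → 2 ℕ.≤ n → ∃[ e ] 1 ℕ.≤ e × 2 ℕ.^ e ℕ.≤ n × n ℕ.< 2 ℕ.^ suc e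
  ⌊log₂⌋ n 2≤n with least (λ m → n ℕ.<? 2 ℕ.^ m) n (n<2^n n)
  ... | 0 , lt , _ = ⊥-elim (ℕ.<-irrefl refl (ℕ.<-≤-trans lt (ℕ.≤-trans (s≤s z≤n) 2≤n)))
  ... | 1 , lt , _ = ⊥-elim (ℕ.<-irrefl refl (ℕ.<-≤-trans lt 2≤n))
  ... | suc (suc e) , lt , min = suc e , s≤s z≤n , ℕ.≮⇒≥ (λ h → ℕ.<-irrefl refl (min (suc e) h)) , lt

  ⁻¹-antitone : ∀ {a b} → 0# < a → a ≤ b → b ⁻¹ ≤ a ⁻¹
  ⁻¹-antitone {a} {b} 0<a a≤b = *-cancelˡ-≤ 0<a (≤-trans (*-monoˡ-≤ (<⇒≤ (⁻¹-pos 0<b)) a≤b)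
    (≤-reflexive (trans (*-⁻¹ʳ 0<b) (sym (*-⁻¹ʳ 0<a)))))
    where 0<b = <-≤-trans 0<a a≤b

  1<⁻¹ : ∀ {a} → 0# < a → a < 1# → 1# < a ⁻¹
  1<⁻¹ {a} 0<a a<1 = ≰⇒> λ h → <⇒≱ a<1 (≤-trans (≤-reflexive (sym (*-⁻¹ʳ 0<a)))
    (≤-trans (*-monoʳ-≤ (<⇒≤ 0<a) h) (≤-reflexive (*-identityʳ a))))

  module Constants {ε₀ : ℝ} (0<ε₀ : 0# < ε₀) (ε₀<1 : ε₀ < 1#) where

    -- The power of `ε₀ ⁻¹` that exceeds the absolute constant `2 ^ 44`. It exists because `ε₀` is
    -- strictly below 1, and it serves every smaller `ε` as well.
    m₀ : ℕ
    m₀ = proj₁ (^ⁿ-unbounded (1<⁻¹ 0<ε₀ ε₀<1) (2# ^ⁿ 44))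

    c′ c : ℕ
    c′ = m₀ ℕ.+ 4
    c  = c′ ℕ.* 3

    module _ {ε : ℝ} (0<ε : 0# < ε) (ε≤ε₀ : ε ≤ ε₀) where

      β : ℝ
      β = ε ⁻¹

      ε<1 : ε < 1#
      ε<1 = ≤-<-trans ε≤ε₀ ε₀<1

      1≤β : 1# ≤ β
      1≤β = <⇒≤ (1<⁻¹ 0<ε ε<1)

      0≤β : 0# ≤ β
      0≤β = ≤-trans 0≤1 1≤β

      Fine : ℕ → Set
      Fine γ = fromℕ 128 ≤ fromℕ (2 ℕ.^ γ) * ε

      -- The least sufficient exponent; minimality gives the upper bound, since one power of two
      -- less is not yet 128 times `β`. As `ε` is below 1 the exponent is at least 7, which makes
      -- `half` large enough.
      resolution : ∃[ γ′ ] 4 ℕ.≤ γ′ × Fine (suc γ′) × fromℕ (2 ℕ.^ suc γ′) ≤ 2# ^ⁿ 8 * β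
      resolution with ^ⁿ-unbounded 1<2 (fromℕ 128 * β)
      ... | m , h = choose (least (λ γ → fromℕ 128 ≤? fromℕ (2 ℕ.^ γ) * ε) m (≤-trans (≤-reflexive (sym (cancel (fromℕ 128))))
                      (*-monoˡ-≤ (<⇒≤ 0<ε) (≤-trans h (≤-reflexive (sym (2^-fromℕ m)))))))
        where
          cancel : ∀ x → x * β * ε ≡ x
          cancel x = trans (*-assoc x β ε) (trans (cong (x *_) (*-⁻¹ˡ 0<ε)) (*-identityʳ x))
          7≤ : ∀ γ → Fine γ → 7 ℕ.≤ γ
          7≤ γ fine with 7 ℕ.≤? γ
          ... | yes p = p
          ... | no ¬p = ⊥-elim (ℕ.<⇒≱ (ℕ.^-monoʳ-< 2 (s≤s (s≤s z≤n)) (ℕ.≰⇒> ¬p)) (fromℕ-reflects 128 (2 ℕ.^ γ)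
                  (≤-trans fine (≤-trans (*-monoʳ-≤ (0≤fromℕ (2 ℕ.^ γ)) (<⇒≤ ε<1)) (≤-reflexive (*-identityʳ _))))))
          choose : ∃[ γ ] Fine γ × (∀ j → Fine j → γ ℕ.≤ j) →
                   ∃[ γ′ ] 4 ℕ.≤ γ′ × Fine (suc γ′) × fromℕ (2 ℕ.^ suc γ′) ≤ 2# ^ⁿ 8 * β
          choose (zero , fine , _) with () ← 7≤ 0 fine
          choose (suc γ′ , fine , min) = γ′ , ℕ.≤-trans (ℕ.m≤m+n 4 2) (ℕ.≤-pred (7≤ (suc γ′) fine)) , fine ,
            ≤-trans (≤-reflexive (trans (fromℕ-* 2 (2 ℕ.^ γ′)) (cong (_* fromℕ (2 ℕ.^ γ′)) fromℕ-2)))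
            (≤-trans (*-monoʳ-≤ 0≤2 (*-cancelʳ-≤ 0<ε (≤-trans (<⇒≤ (≰⇒> (λ h′ → ℕ.<-irrefl refl (min γ′ h′))))
                (≤-reflexive (trans (2^-fromℕ 7) (sym (cancel (2# ^ⁿ 7))))))))
              (≤-reflexive (sym (*-assoc 2# (2# ^ⁿ 7) β))))

      -- The exponent 44 in `m₀` is 12 plus the 32 that comes from the fourth power of `2 ^ 8 * β`;
      -- the remaining `β ^ⁿ 4` is the 4 in `c′`.
      2^-bound : ∀ γ → fromℕ (2 ℕ.^ γ) ≤ 2# ^ⁿ 8 * β → 2# ^ⁿ (12 ℕ.+ γ ℕ.* 4) ≤ β ^ⁿ c′
      2^-bound γ h = ≤-trans (≤-reflexive (trans (^-homo-* 2# 12 (γ ℕ.* 4)) (cong (2# ^ⁿ 12 *_) (sym (^-assocʳ 2# γ 4)))))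
        (≤-trans (*-monoʳ-≤ (^ⁿ-nonneg 0≤2 12) (≤-trans (^ⁿ-monoˡ (^ⁿ-nonneg 0≤2 γ) (≤-trans (≤-reflexive (sym (2^-fromℕ γ))) h) 4)
            (≤-reflexive (trans (^-distrib-* (2# ^ⁿ 8) β 4) (cong (_* β ^ⁿ 4) (^-assocʳ 2# 8 4))))))
        (≤-trans (≤-reflexive (trans (sym (*-assoc (2# ^ⁿ 12) (2# ^ⁿ 32) (β ^ⁿ 4))) (cong (_* β ^ⁿ 4) (sym (^-homo-* 2# 12 32)))))
        (≤-trans (*-monoˡ-≤ (^ⁿ-nonneg 0≤β 4) (≤-trans (proj₂ (^ⁿ-unbounded (1<⁻¹ 0<ε₀ ε₀<1) (2# ^ⁿ 44)))
                   (^ⁿ-monoˡ (<⇒≤ (⁻¹-pos 0<ε₀)) (⁻¹-antitone 0<ε ε≤ε₀) m₀)))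
                 (≤-reflexive (sym (^-homo-* β m₀ 4))))))

      -- The exponent `12 + γ * 4` is what the lightness requires: 10 for the constant 1024, `2γ`
      -- for `B * B` and `2 + 2γ` for `Λ`. The factor 3 in `c` pays for rounding `dim` up to `D`.
      power-bound : ∀ γ → fromℕ (2 ℕ.^ γ) ≤ 2# ^ⁿ 8 * β → ∀ D {dim} → fromℕ D ≤ fromℕ 3 * dim →
        fromℕ ((2 ℕ.^ D) ℕ.^ (12 ℕ.+ γ ℕ.* 4)) ≤ ε ^ (- (fromℕ c * dim))
      power-bound γ h D {dim} hD = subst (fromℕ ((2 ℕ.^ D) ℕ.^ (12 ℕ.+ γ ℕ.* 4)) ≤_) (sym (^-small ε<1 (fromℕ c * dim)))
        (≤-trans (≤-reflexive (swap-exp (12 ℕ.+ γ ℕ.* 4)))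
        (≤-trans (^ⁿ-monoˡ (^ⁿ-nonneg 0≤2 (12 ℕ.+ γ ℕ.* 4)) (2^-bound γ h) D)
        (≤-trans (≤-reflexive (^-assocʳ β c′ D)) (⨆-lower 1≤β (c′ ℕ.* D)
          (≤-trans (≤-reflexive (fromℕ-* c′ D)) (≤-trans (*-monoʳ-≤ (0≤fromℕ c′) hD)
            (≤-reflexive (trans (sym (*-assoc (fromℕ c′) (fromℕ 3) dim)) (cong (_* dim) (sym (fromℕ-* c′ 3)))))))))))
        where
          swap-exp : ∀ N → fromℕ ((2 ℕ.^ D) ℕ.^ N) ≡ (2# ^ⁿ N) ^ⁿ D
          swap-exp N = trans (cong fromℕ (trans (ℕ.^-*-assoc 2 D N) (cong (2 ℕ.^_) (ℕ.*-comm D N))))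
            (trans (2^-fromℕ (N ℕ.* D)) (sym (^-assocʳ 2# N D)))

      module _ {n : ℕ} (M : Metric n) {dim : ℝ} (doubling : IsDoubling M dim) (k : ℕ) (1≤k : 1 ℕ.≤ k)
               (u v : Fin n) (u≢v : u ≢ v) (2≤n : 2 ℕ.≤ n) where

        open Metric M
        open Paths M using (hopDiameter)
        open Doubling 𝓡 M

        A : ℝ
        A = ε ^ (- (fromℕ c * dim))

        Conclusion : Set
        Conclusion = ∃[ H ] IsVFTS M k (1# + ε) H ×
          (fromℕ (Graph.maxDegree H) ≤ A * fromℕ (k ℕ.^ 2)) ×
          (∃[ D ] IsHopDiameter M (1# + ε) H D × fromℕ D ≤ fromℕ 25 * log₂ (fromℕ n)) ×
          (∀ ℓ → IsLightness M H ℓ → ℓ ≤ A * fromℕ (k ℕ.^ 3) * log₂ (fromℕ n))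

        conclusion : Conclusion
        conclusion = go resolution (ceil C doubling) (⌊log₂⌋ n 2≤n)
          where
            C : Closest
            C = closestPair u≢v
            go : ∃[ γ′ ] 4 ℕ.≤ γ′ × Fine (suc γ′) × fromℕ (2 ℕ.^ suc γ′) ≤ 2# ^ⁿ 8 * β →
                 ∃[ D ] 1 ℕ.≤ D × dim ≤ fromℕ D × fromℕ D ≤ fromℕ 3 * dim →
                 ∃[ e ] 1 ℕ.≤ e × 2 ℕ.^ e ℕ.≤ n × n ℕ.< 2 ℕ.^ suc e → Conclusion
            go (γ′ , 4≤γ′ , fine , coarse) (D , 1≤D , dim≤D , D≤) (e , 1≤e , 2^e≤n , n<) =
              R.H , S.vfts (0<μ C doubling) (Closest.closest C) , degree , diameter (hopDiameter (1# + ε) R.H (12 ℕ.* suc e ℕ.+ 1) S.hopBound) , light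
              where
                module Sc = Packing.Scaling C doubling D dim≤D γ′ 4≤γ′
                module R = Result 𝓡 M Sc.scale Sc.s Sc.0<s id id k 1≤k 2≤n u (suc e) n<
                module S = R.Stretch 0<ε (<⇒≤ ε<1) fine
                N = 12 ℕ.+ Sc.γ ℕ.* 4
                L = (2 ℕ.^ D) ℕ.^ N
                L≤A : fromℕ L ≤ A
                L≤A = power-bound Sc.γ coarse D D≤
                2≤2^D : 2 ℕ.≤ 2 ℕ.^ D
                2≤2^D = ℕ.^-monoʳ-≤ 2 1≤D
                open ℕ.≤-Reasoning
                P = 2 ℕ.^ D
                P^-mono : ∀ {a b} → a ℕ.≤ b → P ℕ.^ a ℕ.≤ P ℕ.^ b
                P^-mono = ℕ.^-monoʳ-≤ P {{ℕ.>-nonZero (ℕ.m^n>0 2 D)}}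
                -- Since `D` is at least 1, a factor 2 is at most one more factor `P`; constants and
                -- powers of `B` thus become part of the exponent.
                scaleΛ : ∀ a → 2 ℕ.^ a ℕ.* Sc.Λ ℕ.≤ P ℕ.^ (a ℕ.+ (2 ℕ.+ (Sc.γ ℕ.+ Sc.γ)))
                scaleΛ a = begin
                  2 ℕ.^ a ℕ.* Sc.Λ ≤⟨ ℕ.*-monoˡ-≤ Sc.Λ (ℕ.^-monoˡ-≤ a 2≤2^D) ⟩
                  P ℕ.^ a ℕ.* Sc.Λ ≡⟨ sym (ℕ.^-distribˡ-+-* P a (2 ℕ.+ (Sc.γ ℕ.+ Sc.γ))) ⟩
                  P ℕ.^ (a ℕ.+ (2 ℕ.+ (Sc.γ ℕ.+ Sc.γ))) ∎
                degreeℕ : Graph.maxDegree R.H ℕ.≤ L ℕ.* k ℕ.^ 2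
                degreeℕ = begin
                  Graph.maxDegree R.H ≤⟨ R.maxDegree-bound ⟩
                  64 ℕ.* (Sc.Λ ℕ.* (k ℕ.* k)) ≡⟨ sym (ℕ.*-assoc 64 Sc.Λ (k ℕ.* k)) ⟩
                  64 ℕ.* Sc.Λ ℕ.* (k ℕ.* k) ≤⟨ ℕ.*-monoˡ-≤ (k ℕ.* k) (ℕ.≤-trans (scaleΛ 6) (P^-mono (≤-by (4 ℕ.+ (Sc.γ ℕ.+ Sc.γ)) (exp Sc.γ)))) ⟩
                  L ℕ.* (k ℕ.* k) ≡⟨ cong (L ℕ.*_) (cong (k ℕ.*_) (sym (ℕ.*-identityʳ k))) ⟩
                  L ℕ.* k ℕ.^ 2 ∎
                  where exp : ∀ g → 6 ℕ.+ (2 ℕ.+ (g ℕ.+ g)) ℕ.+ (4 ℕ.+ (g ℕ.+ g)) ≡ 12 ℕ.+ g ℕ.* 4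
                        exp = solve-∀
                degree : fromℕ (Graph.maxDegree R.H) ≤ A * fromℕ (k ℕ.^ 2)
                degree = ≤-trans (fromℕ-mono degreeℕ) (≤-trans (≤-reflexive (fromℕ-* L (k ℕ.^ 2))) (*-monoˡ-≤ (0≤fromℕ (k ℕ.^ 2)) L≤A))
                e≤log : fromℕ e ≤ log₂ (fromℕ n)
                e≤log = log₂-lower e n 2^e≤n
                diameter : ∃[ D′ ] IsHopDiameter M (1# + ε) R.H D′ × D′ ℕ.≤ 12 ℕ.* suc e ℕ.+ 1 →
                  ∃[ D′ ] IsHopDiameter M (1# + ε) R.H D′ × fromℕ D′ ≤ fromℕ 25 * log₂ (fromℕ n)
                diameter (D′ , isD , D′≤) = D′ , isD , ≤-trans (fromℕ-mono (begin
                  D′ ≤⟨ D′≤ ⟩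
                  12 ℕ.* suc e ℕ.+ 1 ≡⟨ lem₁ e ⟩
                  -- The additive 13 is charged to the logarithm, which is at least 1 because there
                  -- are two points; hence 25.
                  12 ℕ.* e ℕ.+ 13 ℕ.* 1 ≤⟨ ℕ.+-monoʳ-≤ (12 ℕ.* e) (ℕ.*-monoʳ-≤ 13 1≤e) ⟩
                  12 ℕ.* e ℕ.+ 13 ℕ.* e ≡⟨ sym (ℕ.*-distribʳ-+ e 12 13) ⟩
                  25 ℕ.* e ∎)) (≤-trans (≤-reflexive (fromℕ-* 25 e)) (*-monoʳ-≤ (0≤fromℕ 25) e≤log))
                  where lem₁ : ∀ e → 12 ℕ.* suc e ℕ.+ 1 ≡ 12 ℕ.* e ℕ.+ 13 ℕ.* 1
                        lem₁ = solve-∀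
                lightℕ : 128 ℕ.* (Sc.B ℕ.* Sc.B) ℕ.* (Sc.Λ ℕ.* (k ℕ.* k)) ℕ.* (suc (suc e) ℕ.* 2) ℕ.≤ L ℕ.* k ℕ.^ 3 ℕ.* e
                lightℕ = begin
                  128 ℕ.* (Sc.B ℕ.* Sc.B) ℕ.* (Sc.Λ ℕ.* (k ℕ.* k)) ℕ.* (suc (suc e) ℕ.* 2)
                    ≤⟨ ℕ.*-mono-≤ (ℕ.*-monoʳ-≤ (128 ℕ.* (Sc.B ℕ.* Sc.B)) (ℕ.*-monoʳ-≤ Sc.Λ kk≤k³)) e≤8 ⟩
                  128 ℕ.* (Sc.B ℕ.* Sc.B) ℕ.* (Sc.Λ ℕ.* k ℕ.^ 3) ℕ.* (8 ℕ.* e) ≡⟨ lem₁ (Sc.B ℕ.* Sc.B) Sc.Λ (k ℕ.^ 3) e ⟩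
                  1024 ℕ.* (Sc.B ℕ.* Sc.B) ℕ.* Sc.Λ ℕ.* (k ℕ.^ 3) ℕ.* e
                    ≤⟨ ℕ.*-monoˡ-≤ e (ℕ.*-monoˡ-≤ (k ℕ.^ 3) (ℕ.≤-trans (ℕ.≤-reflexive (cong (ℕ._* Sc.Λ) powers))
                         (ℕ.≤-trans (scaleΛ (10 ℕ.+ (Sc.γ ℕ.+ Sc.γ))) (ℕ.≤-reflexive (cong (P ℕ.^_) (exp Sc.γ)))))) ⟩
                  L ℕ.* k ℕ.^ 3 ℕ.* e ∎
                  where
                    kk≤k³ : k ℕ.* k ℕ.≤ k ℕ.^ 3
                    kk≤k³ = ℕ.*-monoʳ-≤ k (begin
                      k ≡⟨ sym (ℕ.*-identityʳ k) ⟩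
                      k ℕ.* 1 ≤⟨ ℕ.*-monoʳ-≤ k (ℕ.≤-trans 1≤k (ℕ.≤-reflexive (sym (ℕ.*-identityʳ k)))) ⟩
                      k ℕ.* (k ℕ.* 1) ∎)
                    -- The factor 8 is chosen so that the constants multiply to `1024`, a power of
                    -- two.
                    e≤8 : suc (suc e) ℕ.* 2 ℕ.≤ 8 ℕ.* e
                    e≤8 = begin
                      suc (suc e) ℕ.* 2 ≡⟨ lem₂ e ⟩
                      2 ℕ.* e ℕ.+ 4 ℕ.* 1 ≤⟨ ℕ.+-monoʳ-≤ (2 ℕ.* e) (ℕ.*-mono-≤ (ℕ.m≤m+n 4 2) 1≤e) ⟩
                      2 ℕ.* e ℕ.+ 6 ℕ.* e ≡⟨ sym (ℕ.*-distribʳ-+ e 2 6) ⟩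
                      8 ℕ.* e ∎
                      where lem₂ : ∀ e → suc (suc e) ℕ.* 2 ≡ 2 ℕ.* e ℕ.+ 4 ℕ.* 1
                            lem₂ = solve-∀
                    lem₁ : ∀ b l k e → 128 ℕ.* b ℕ.* (l ℕ.* k) ℕ.* (8 ℕ.* e) ≡ 1024 ℕ.* b ℕ.* l ℕ.* k ℕ.* e
                    lem₁ = solve-∀
                    powers : 1024 ℕ.* (Sc.B ℕ.* Sc.B) ≡ 2 ℕ.^ (10 ℕ.+ (Sc.γ ℕ.+ Sc.γ))
                    powers = sym (trans (ℕ.^-distribˡ-+-* 2 10 (Sc.γ ℕ.+ Sc.γ)) (cong (1024 ℕ.*_) (ℕ.^-distribˡ-+-* 2 Sc.γ Sc.γ)))
                    exp : ∀ g → 10 ℕ.+ (g ℕ.+ g) ℕ.+ (2 ℕ.+ (g ℕ.+ g)) ≡ 12 ℕ.+ g ℕ.* 4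
                    exp = solve-∀
                light : ∀ ℓ → IsLightness M R.H ℓ → ℓ ≤ A * fromℕ (k ℕ.^ 3) * log₂ (fromℕ n)
                light ℓ (T , ((connected , _) , _) , ℓ≡) = ≤-trans (≤-reflexive ℓ≡) (≤-trans
                    (*-monoˡ-≤ (<⇒≤ (⁻¹-pos 0<w)) weight≤)
                    (≤-trans (≤-reflexive (trans (*-assoc (fromℕ (L ℕ.* k ℕ.^ 3 ℕ.* e)) w (w ⁻¹)) (trans (cong (fromℕ (L ℕ.* k ℕ.^ 3 ℕ.* e) *_) (*-⁻¹ʳ 0<w)) (*-identityʳ _))))
                    (≤-trans (≤-reflexive (trans (fromℕ-* (L ℕ.* k ℕ.^ 3) e) (cong (_* fromℕ e) (fromℕ-* L (k ℕ.^ 3)))))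
                    (*-mono-≤ (*-nonNegative (0≤fromℕ L) (0≤fromℕ (k ℕ.^ 3))) (≤-trans (0≤fromℕ e) e≤log)
                      (*-monoˡ-≤ (0≤fromℕ (k ℕ.^ 3)) L≤A) e≤log))))
                  where
                    open R.Lightness T connected using (weight-bound; Δ)
                    w = weight M T
                    0<w : 0# < w
                    0<w = ≰⇒> λ w≤0 → <⇒≱ (0<d u≢v) (≤-trans (R.d≤Δ T connected u v) (≤-trans (+-mono-≤ w≤0 w≤0) (≤-reflexive (+-identityˡ 0#))))
                    weight≤ : weight M R.H ≤ fromℕ (L ℕ.* k ℕ.^ 3 ℕ.* e) * w
                    weight≤ = ≤-trans weight-bound (≤-trans (≤-reflexive (trans
                        (solve 3 (λ a m w → a :* (m :* (w :+ w)) := (a :* (m :* con 2)) :* w) refl (fromℕ Q) (fromℕ (suc (suc e))) w)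
                        (cong (_* w) (sym (trans (fromℕ-* Q (suc (suc e) ℕ.* 2)) (cong (fromℕ Q *_) (trans (fromℕ-* (suc (suc e)) 2) (cong (fromℕ (suc (suc e)) *_) fromℕ-2))))))))
                        (*-monoˡ-≤ (<⇒≤ 0<w) (fromℕ-mono lightℕ)))
                      where Q = 128 ℕ.* (Sc.B ℕ.* Sc.B) ℕ.* (Sc.Λ ℕ.* (k ℕ.* k))

theorem1 : (𝓡 : CompleteOrderedField) →
    let open CompleteOrderedField 𝓡 renaming (Carrier to ℝ)
        open Spanners 𝓡
    in
    (ε₀ : ℝ) → 0# < ε₀ → ε₀ < 1# →
    ∃[ c₁ ] ∃[ c₂ ] ∃[ c₃ ]
      ((ε : ℝ) → 0# < ε → ε ≤ ε₀ →
       (n : ℕ) (M : Metric n) (dim : ℝ) → IsDoublingDimension M dim →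
       (k : ℕ) → 1 ℕ.≤ k → k ℕ.+ 2 ℕ.≤ n →
       ∃[ H ]
         IsVFTS M k (1# + ε) H ×
         (fromℕ (Graph.maxDegree H) ≤ ε ^ (- (c₁ * dim)) * fromℕ (k ℕ.^ 2)) ×
         (∃[ D ] IsHopDiameter M (1# + ε) H D × fromℕ D ≤ c₂ * log₂ (fromℕ n)) ×
         (∀ ℓ → IsLightness M H ℓ →
            ℓ ≤ ε ^ (- (c₃ * dim)) * fromℕ (k ℕ.^ 3) * log₂ (fromℕ n)))
theorem1 𝓡 ε₀ 0<ε₀ ε₀<1 = fromℕ c , fromℕ 25 , fromℕ c ,
  λ ε 0<ε ε≤ε₀ n M dim (doubling , _) k 1≤k k+2≤n →
    let 2≤n = ℕ.≤-trans (ℕ.m≤n+m 2 k) k+2≤n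
        (u , v , u≢v) = distinctPoints 2≤n
    in conclusion 0<ε ε≤ε₀ M doubling k 1≤k u v u≢v 2≤n
  where
    open CompleteOrderedField 𝓡 using (fromℕ)
    open Main 𝓡
    open Constants 0<ε₀ ε₀<1
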